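{- There exists a constant $c>0$ such that the following holds for every large enough integer $n$. In the $(1:1)$ Waiter-Client game played on the edge set of $K_n$, Waiter has a strategy to force Client to claim a graph which contains a copy of every tree $T$ with $n$ vertices and maximum degree $\Delta(T)\leq \frac{cn}{\log(n)}$.
   Context: In the $(1:1)$ Waiter-Client game on $K_n$, in each round Waiter offers two previously unoffered edges of $K_n$ to Client; Client chooses one of them for himself and the other goes to Waiter; if in the last round only one edge remains, it goes to Waiter. Client's graph is the spanning subgraph of $K_n$ formed by the edges Client chose. $\log$ denotes the natural logarithm. -}

module Defs where

open import Data.Nat using (ℕ; _<ᵇ_; _≤_)
open import Data.Bool using (Bool; true)
open import Data.Fin using (Fin; toℕ)
open import Data.Fin.Base using () renaming (_<_ to _<ᶠ_)
open import Data.List using (List; []; _∷_; length; filterᵇ; cartesianProduct; allFin; _∷ʳ_)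
open import Data.List.Membership.Propositional using (_∈_)
open import Data.List.Relation.Unary.Unique.Propositional using (Unique)
open import Data.List.Relation.Unary.Linked using (Linked)
open import Data.List.Relation.Binary.Permutation.Propositional using (_↭_)
open import Data.Product using (Σ; _×_; _,_)
open import Data.Sum using (_⊎_)
open import Relation.Binary.PropositionalEquality using (_≡_)
open import Relation.Nullary using (¬_)
open import Function.Definitions using (Injective)

Edge : ℕ → Set
Edge n = Fin n × Fin n

allEdges : (n : ℕ) → List (Edge n)
allEdges n = filterᵇ (λ e → toℕ (Data.Product.proj₁ e) <ᵇ toℕ (Data.Product.proj₂ e))
                     (cartesianProduct (allFin n) (allFin n))

-- (1:1) Waiter-Client game.  'WaiterWins P R C' : from the position where
-- R is the list of not-yet-offered edges and C is Client's graph so far,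
-- Waiter has a strategy guaranteeing that Client's final graph satisfies P.
-- The game ends when at most one edge is left (a last single edge goes to
-- Waiter, so it does not affect Client's graph).  In each round Waiter offers
-- two distinct unoffered edges e₁ e₂ (R is a permutation of e₁ ∷ e₂ ∷ R'),
-- and Client may pick either one.

data WaiterWins {n : ℕ} (P : List (Edge n) → Set) :
                List (Edge n) → List (Edge n) → Set where
  done : ∀ {R C} → length R ≤ 1 → P C → WaiterWins P R C
  offer : ∀ {R R' C} (e₁ e₂ : Edge n) → R ↭ (e₁ ∷ e₂ ∷ R') →
          WaiterWins P R' (e₁ ∷ C) → WaiterWins P R' (e₂ ∷ C) →
          WaiterWins P R C

ClientAdj : ∀ {n} → List (Edge n) → Fin n → Fin n → Set
ClientAdj C u v = ((u , v) ∈ C) ⊎ ((v , u) ∈ C)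

Graph : ℕ → Set
Graph n = Fin n → Fin n → Bool

Adj : ∀ {n} → Graph n → Fin n → Fin n → Set
Adj G u v = G u v ≡ true

IsSimple : ∀ {n} → Graph n → Set
IsSimple G = (∀ u v → G u v ≡ G v u) × (∀ u → ¬ Adj G u u)

data Walk {n : ℕ} (G : Graph n) : Fin n → Fin n → Set where
  here : ∀ {u} → Walk G u u
  step : ∀ {u w v} → Adj G u w → Walk G w v → Walk G u v

Connected : ∀ {n} → Graph n → Set
Connected G = ∀ u v → Walk G u v

HasCycle : ∀ {n} → Graph n → Set
HasCycle {n} G = Σ (Fin n) λ v → Σ (List (Fin n)) λ vs →
  (3 ≤ length (v ∷ vs)) × Unique (v ∷ vs) × Linked (Adj G) ((v ∷ vs) ∷ʳ v)

IsTree : ∀ {n} → Graph n → Set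
IsTree G = IsSimple G × Connected G × ¬ HasCycle G

degree : ∀ {n} → Graph n → Fin n → ℕ
degree {n} G v = length (filterᵇ (G v) (allFin n))

ContainsCopy : ∀ {n} → List (Edge n) → Graph n → Set
ContainsCopy {n} C T = Σ (Fin n → Fin n) λ φ →
  Injective _≡_ _≡_ φ × (∀ u v → Adj T u v → ClientAdj C (φ u) (φ v))

{-# OPTIONS --safe #-}
-- Waiter keeps the average, over random play, of exponentially weighted failures small by always offering two edges of nearly
-- equal influence; this costs only a polynomial factor and makes Client's graph pseudorandom with respect to any prescribed
-- families of edge sets.  Splitting K_n into the edges inside the sides A and B ∪ S and the edges across, and playing the two
-- parts one after the other, also controls common neighbourhoods of vertices from different sides; a logarithmic set X is
-- moreover made to see every pair of neighbourhoods, one star at a time.  In such a graph a tree T with maximum degree at most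
-- c n / log n is found as follows.  Choose linearly many vertices L of T with at most one child and depths congruent mod 4, and embed T - L
-- greedily from the root: a vertex whose pool is exhausted around its parent's image goes to a reserve Z, which happens for
-- children of O(log n) parents only.  Parents of L are put into X as long as possible, so that every unused vertex can play the
-- role of many members of L.  Finally L is matched to the unused vertices by augmenting paths of bounded length.
module Submission where

open import Defs
open import Data.Nat using (ℕ; zero; suc; _+_; _*_; _∸_; _^_; _≤_; _<_; z≤n; s≤s; NonZero; >-nonZero; _/_; _<ᵇ_; _≤?_; _<?_)
open import Data.Nat.Properties using (≤-refl; ≤-trans; ≤-reflexive; ≤-antisym; ≤-pred; n≤1+n; +-comm; +-assoc; +-suc; +-identityʳ; *-comm; *-assoc; *-suc; *-identityʳ; *-identityˡ; *-distribˡ-+; *-distribʳ-+; +-mono-≤; +-monoʳ-≤; +-monoˡ-≤; *-mono-≤; *-monoʳ-≤; *-monoˡ-≤; *-cancelˡ-≤; *-cancelʳ-≤; *-cancelˡ-<; *-cancelʳ-<; +-cancelˡ-≡; +-cancelˡ-≤; +-cancelʳ-≤; m≤m+n; m≤n+m; m<m+n; m≤m*n; m≤n⇒m≤1+n; ≰⇒>; ≮⇒≥; <⇒≤; <⇒≱; ≤-total; ^-monoʳ-≤; ^-monoˡ-≤; ^-distribˡ-+-*; ^-*-assoc; m∸n+n≡m; m+[n∸m]≡n; m≤n+m∸n; m≤n⇒m⊓n≡m; suc-injective; ≤∧≢⇒<; <ᵇ⇒<; ≤ᵇ⇒≤; <⇒<ᵇ; <⇒≯; <-≤-trans; ≤-<-trans;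 module ≤-Reasoning)
open import Data.Nat.Solver using (module +-*-Solver)
open import Data.Nat.DivMod using (m/n*n≤m; /-monoˡ-≤; m*n/n≡m; m≥n⇒m/n>0)
open import Data.Bool using (Bool; true; false; if_then_else_) renaming (T to IsTrue)
open import Data.Bool.Properties using (T?; ¬-not) renaming (_≟_ to _≟ᵇ_)
open import Data.Fin using (Fin; toℕ; fromℕ<)
open import Data.Fin.Properties using (toℕ-injective) renaming (_≟_ to _≟ᶠ_)
open import Data.List using (List; []; _∷_; _++_; [_]; length; map; filter; filterᵇ; take; drop; cartesianProduct; cartesianProductWith; allFin; zip; _∷ʳ_)
open import Data.Nat.ListAction using (sum)
open import Data.List.Properties using (length-map; length-++; map-++; ++-identityʳ; filter-none; length-take; filter-++; length-filter; filter-accept; filter-reject; take++drop≡id; length-tabulate; map-∘; map-cong)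
open import Data.List.Membership.Propositional using (_∈_; _∉_; find; lose)
open import Data.List.Membership.Propositional.Properties using (∈-++⁺ˡ; ∈-++⁺ʳ; ∈-++⁻; ∈-∃++; ∈-map⁺; ∈-map⁻; ∈-filter⁺; ∈-filter⁻; ∈-allFin; ∈-cartesianProduct⁺; ∈-cartesianProduct⁻; ∈-cartesianProductWith⁺)
open import Data.List.Relation.Unary.Any using (Any; here; there; any?)
open import Data.List.Relation.Unary.All using (All; []; _∷_; all?) renaming (lookup to All-lookup; tabulate to All-tabulate)
open import Data.List.Relation.Unary.All.Properties using (¬Any⇒All¬)
open import Data.List.Relation.Unary.AllPairs using ([]; _∷_)
open import Data.List.Relation.Unary.Unique.Propositional using (Unique)
open import Data.List.Relation.Unary.Unique.Propositional.Properties using (filter⁺; map⁺; ++⁺; take⁺; drop⁺; allFin⁺; cartesianProduct⁺) renaming (map⁻ to Unique-map⁻)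
open import Data.List.Relation.Unary.Linked using (Linked; []; [-]; _∷_)
open import Data.List.Relation.Binary.Permutation.Propositional using (_↭_; refl; prep; swap; trans; ↭-sym; ↭-refl; ↭-trans; ↭-reflexive; ↭⇒↭ₛ)
open import Data.List.Relation.Binary.Permutation.Propositional.Properties using (∈-resp-↭; ↭-length; filter-↭; ∷↭∷ʳ; shift; ++⁺ˡ; ++⁺ʳ) renaming (map⁺ to ↭-map⁺; ++-assoc to ↭-++-assoc)
open import Data.Maybe using (Maybe; just; nothing)
open import Data.Maybe.Properties using (just-injective) renaming (≡-dec to Maybe-≡-dec)
open import Data.Product using (Σ; ∃-syntax; _×_; _,_; proj₁; proj₂; uncurry)
open import Data.Product.Properties using () renaming (≡-dec to ×-≡-dec)
open import Data.Sum using (_⊎_; inj₁; inj₂; [_,_]′)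
open import Data.Empty using (⊥; ⊥-elim)
open import Data.Unit using (tt)
open import Function using (_∘_; id; case_of_)
open import Function.Definitions using (Injective)
open import Relation.Nullary using (¬_; Dec; yes; no; does; contradiction)
open import Relation.Nullary.Decidable using (_×-dec_; _⊎-dec_; ¬?)
open import Level using (0ℓ)
open import Relation.Unary using (Pred; Decidable)
open import Relation.Binary.Definitions using (DecidableEquality)
open import Relation.Binary.PropositionalEquality using (_≡_; _≢_; refl; sym; cong; cong₂; subst; setoid; module ≡-Reasoning) renaming (trans to ≡-trans)
import Data.List.Membership.DecPropositional as DecMem
import Data.List.Relation.Binary.Permutation.Setoid.Properties as SetoidPerm

-- Lists without repetitions

Unique-resp-↭ : {A : Set} {xs ys : List A} → xs ↭ ys → Unique xs → Unique ys
Unique-resp-↭ {A} p = SetoidPerm.Unique-resp-↭ (setoid A) (↭⇒↭ₛ p)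

∈⇒↭ : {A : Set} {x : A} {xs : List A} → x ∈ xs → ∃[ ys ] xs ↭ x ∷ ys
∈⇒↭ {x = x} x∈xs with ys , zs , refl ← ∈-∃++ x∈xs = ys ++ zs , shift x ys zs

Unique-head : {A : Set} {x : A} {xs : List A} → Unique (x ∷ xs) → x ∉ xs
Unique-head (x≢ ∷ _) x∈ = All-lookup x≢ x∈ refl

Unique-tail : {A : Set} {x : A} {xs : List A} → Unique (x ∷ xs) → Unique xs
Unique-tail (_ ∷ u) = u

Unique-cons : {A : Set} {x : A} {xs : List A} → x ∉ xs → Unique xs → Unique (x ∷ xs)
Unique-cons x∉ u = ¬Any⇒All¬ _ x∉ ∷ u

∈-∷⁻ : {A : Set} {x y : A} {ys : List A} → x ∈ y ∷ ys → x ≢ y → x ∈ ys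
∈-∷⁻ (here x≡y) x≢y = contradiction x≡y x≢y
∈-∷⁻ (there x∈) _ = x∈

unique-⊆-length : {A : Set} {xs ys : List A} → Unique xs → (∀ {x} → x ∈ xs → x ∈ ys) →
  length xs ≤ length ys
unique-⊆-length {xs = []} _ _ = z≤n
unique-⊆-length {xs = x ∷ xs} u sub with zs , ys↭ ← ∈⇒↭ (sub (here refl)) =
  ≤-trans (s≤s (unique-⊆-length (Unique-tail u)
      (λ y∈ → ∈-∷⁻ (∈-resp-↭ ys↭ (sub (there y∈))) (λ { refl → Unique-head u y∈ }))))
    (≤-reflexive (sym (↭-length ys↭)))

unique-⊆-complement : {A : Set} {xs ys : List A} → Unique xs → (∀ {x} → x ∈ xs → x ∈ ys) →
  ∃[ zs ] ys ↭ xs ++ zs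
unique-⊆-complement {xs = []} {ys} _ _ = ys , ↭-refl
unique-⊆-complement {xs = x ∷ xs} u sub with ws , ys↭ ← ∈⇒↭ (sub (here refl))
  with zs , ws↭ ← unique-⊆-complement {xs = xs} {ws} (Unique-tail u)
      (λ y∈ → ∈-∷⁻ (∈-resp-↭ ys↭ (sub (there y∈))) (λ { refl → Unique-head u y∈ }))
  = zs , ↭-trans ys↭ (prep x ws↭)

module _ {A : Set} (_≟_ : DecidableEquality A) where
  open DecMem _≟_ using (_∈?_)

  exists-fresh : {xs ys : List A} → Unique xs → length ys < length xs → ∃[ x ] x ∈ xs × x ∉ ys
  exists-fresh {xs} {ys} u lt with any? (λ x → ¬? (x ∈? ys)) xs
  ... | yes found = find found
  ... | no none = contradiction (unique-⊆-length u sub) (<⇒≱ lt)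
    where
    sub : ∀ {x} → x ∈ xs → x ∈ ys
    sub {x} x∈ with x ∈? ys
    ... | yes x∈ys = x∈ys
    ... | no x∉ys = contradiction (lose x∈ x∉ys) none

  length-without : ∀ {xs} x → Unique xs → length xs ≤ suc (length (filter (λ y → ¬? (y ≟ x)) xs))
  length-without {xs} x u = unique-⊆-length {ys = x ∷ _} u sub
    where
    sub : ∀ {y} → y ∈ xs → y ∈ x ∷ filter (λ y → ¬? (y ≟ x)) xs
    sub {y} y∈ with y ≟ x
    ... | yes y≡x = here y≡x
    ... | no y≢x = there (∈-filter⁺ _ y∈ y≢x)

  length-minus : ∀ {xs ys} → Unique xs → length xs ≤ length (filter (λ x → ¬? (x ∈? ys)) xs) + length ys
  length-minus {xs} {ys} u = ≤-trans (unique-⊆-length u sub) (≤-reflexive (length-++ (filter (λ x → ¬? (x ∈? ys)) xs)))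
    where
    sub : ∀ {x} → x ∈ xs → x ∈ filter (λ x → ¬? (x ∈? ys)) xs ++ ys
    sub {x} x∈ with x ∈? ys
    ... | yes x∈ys = ∈-++⁺ʳ _ x∈ys
    ... | no x∉ys = ∈-++⁺ˡ (∈-filter⁺ _ x∈ x∉ys)

length-filter-split : {A : Set} {P : Pred A 0ℓ} (P? : Decidable P) (xs : List A) →
  length (filter P? xs) + length (filter (¬? ∘ P?) xs) ≡ length xs
length-filter-split P? [] = refl
length-filter-split P? (x ∷ xs) with P? x
... | yes _ = cong suc (length-filter-split P? xs)
... | no _ = ≡-trans (+-suc _ _) (cong suc (length-filter-split P? xs))

half-split : ∀ {a b c} m → a + b ≡ c → m + m ≤ c → m ≤ a ⊎ m ≤ b
half-split {a} {b} m eq le with m ≤? a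
... | yes m≤a = inj₁ m≤a
... | no m≰a with m ≤? b
...   | yes m≤b = inj₂ m≤b
...   | no m≰b = contradiction (≤-trans le (≤-reflexive (sym eq))) (<⇒≱ (+-mono-≤ (≰⇒> m≰a) (<⇒≤ (≰⇒> m≰b))))

majority : {A : Set} {P : Pred A 0ℓ} (P? : Decidable P) (xs : List A) {m : ℕ} → m + m ≤ length xs →
  m ≤ length (filter P? xs) ⊎ m ≤ length (filter (¬? ∘ P?) xs)
majority P? xs {m} = half-split m (length-filter-split P? xs)

filter-length-mono : {A : Set} {P Q : Pred A 0ℓ} (P? : Decidable P) (Q? : Decidable Q) (xs : List A) →
  (∀ {x} → x ∈ xs → P x → Q x) → length (filter P? xs) ≤ length (filter Q? xs)
filter-length-mono P? Q? [] _ = z≤n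
filter-length-mono P? Q? (x ∷ xs) imp with ih ← filter-length-mono P? Q? xs (imp ∘ there) | P? x | Q? x
... | yes _ | yes _ = s≤s ih
... | yes p | no ¬q = contradiction (imp (here refl) p) ¬q
... | no _  | yes _ = m≤n⇒m≤1+n ih
... | no _  | no _  = ih

filter-map-length : {A B : Set} {P : Pred B 0ℓ} (P? : Decidable P) (f : A → B) (xs : List A) →
  length (filter P? (map f xs)) ≡ length (filter (P? ∘ f) xs)
filter-map-length P? f [] = refl
filter-map-length P? f (x ∷ xs) with P? (f x)
... | yes _ = cong suc (filter-map-length P? f xs)
... | no _ = filter-map-length P? f xs

nonempty-member : {A : Set} {xs : List A} → 0 < length xs → ∃[ x ] x ∈ xs
nonempty-member {xs = x ∷ _} _ = x , here refl

∈-take : {A : Set} {x : A} (k : ℕ) {xs : List A} → x ∈ take k xs → x ∈ xs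
∈-take (suc k) {_ ∷ _} (here eq) = here eq
∈-take (suc k) {_ ∷ _} (there x∈) = there (∈-take k x∈)

length-take-≤ : {A : Set} (k : ℕ) {xs : List A} → k ≤ length xs → length (take k xs) ≡ k
length-take-≤ k {xs} le = ≡-trans (length-take k xs) (m≤n⇒m⊓n≡m le)

Unique-map-on : {A B : Set} {f : A → B} {xs : List A} →
  (∀ {x y} → x ∈ xs → y ∈ xs → f x ≡ f y → x ≡ y) → Unique xs → Unique (map f xs)
Unique-map-on {xs = []} _ _ = []
Unique-map-on {f = f} {x ∷ xs} inj u = Unique-cons
  (λ fx∈ → case ∈-map⁻ f fx∈ of λ { (y , y∈ , eq) → Unique-head u (subst (_∈ xs) (sym (inj (here refl) (there y∈) eq)) y∈) })
  (Unique-map-on (λ x∈ y∈ → inj (there x∈) (there y∈)) (Unique-tail u))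

Unique-map-injective : {A B : Set} {f : A → B} {xs : List A} → Unique (map f xs) →
  ∀ {x y} → x ∈ xs → y ∈ xs → f x ≡ f y → x ≡ y
Unique-map-injective u (here refl) (here refl) eq = refl
Unique-map-injective {f = f} {_ ∷ xs} u (here refl) (there y∈) eq = contradiction (subst (_∈ map f xs) (sym eq) (∈-map⁺ f y∈)) (Unique-head u)
Unique-map-injective {f = f} {_ ∷ xs} u (there x∈) (here refl) eq = contradiction (subst (_∈ map f xs) eq (∈-map⁺ f x∈)) (Unique-head u)
Unique-map-injective u (there x∈) (there y∈) eq = Unique-map-injective (Unique-tail u) x∈ y∈ eq

Unique-map-filter : {A B : Set} {f : A → B} {P : Pred A 0ℓ} (P? : Decidable P) {xs : List A} →
  Unique (map f xs) → Unique (map f (filter P? xs))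
Unique-map-filter P? u = Unique-map-on
  (λ x∈ y∈ → Unique-map-injective u (proj₁ (∈-filter⁻ P? x∈)) (proj₁ (∈-filter⁻ P? y∈)))
  (filter⁺ P? (Unique-map⁻ u))

filter-cons-≤ : {A : Set} {P : Pred A 0ℓ} (P? : Decidable P) (x : A) (xs : List A) →
  length (filter P? xs) ≤ length (filter P? (x ∷ xs))
filter-cons-≤ P? x xs with P? x
... | yes _ = n≤1+n _
... | no _ = ≤-refl

filter-filter-length : {A : Set} {P Q : Pred A 0ℓ} (P? : Decidable P) (Q? : Decidable Q) (xs : List A) →
  length (filter P? (filter Q? xs)) ≤ length (filter P? xs)
filter-filter-length P? Q? [] = z≤n
filter-filter-length P? Q? (x ∷ xs) with filter-filter-length P? Q? xs | Q? x | P? x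
... | ih | yes _ | yes p = ≤-trans (≤-reflexive (cong length (filter-accept P? p))) (s≤s ih)
... | ih | yes _ | no ¬p = ≤-trans (≤-reflexive (cong length (filter-reject P? ¬p))) ih
... | ih | no _ | yes _ = m≤n⇒m≤1+n ih
... | ih | no _ | no _ = ih

module _ {A B : Set} (_≟_ : DecidableEquality B) (f : A → B) where

  representatives : (D : ℕ) (xs : List A) → (∀ b → length (filter (λ x → f x ≟ b) xs) ≤ D) →
    ∃[ ys ] Unique (map f ys) × (∀ {y} → y ∈ ys → y ∈ xs) × length xs ≤ length ys * D
  representatives D xs fib = go (length xs) xs ≤-refl fib
    where
    go : ∀ fuel (xs : List A) → length xs ≤ fuel → (∀ b → length (filter (λ x → f x ≟ b) xs) ≤ D) →
      ∃[ ys ] Unique (map f ys) × (∀ {y} → y ∈ ys → y ∈ xs) × length xs ≤ length ys * D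
    go _ [] _ _ = [] , [] , id , z≤n
    go (suc fuel) (x ∷ xs) (s≤s le) fib
      with ys , u , sub , bound ← go fuel (filter (λ y → ¬? (f y ≟ f x)) xs) (≤-trans (length-filter _ xs) le)
        (λ b → ≤-trans (≤-trans (filter-filter-length (λ y → f y ≟ b) (λ y → ¬? (f y ≟ f x)) xs) (filter-cons-≤ (λ y → f y ≟ b) x xs)) (fib b))
      = x ∷ ys , Unique-cons fresh u
      , (λ { (here refl) → here refl ; (there y∈) → there (proj₁ (∈-filter⁻ (λ y → ¬? (f y ≟ f x)) (sub y∈))) })
      , (begin
          suc (length xs) ≡⟨ cong suc (sym (length-filter-split (λ y → f y ≟ f x) xs)) ⟩
          suc (length (filter (λ y → f y ≟ f x) xs)) + length (filter (λ y → ¬? (f y ≟ f x)) xs)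
            ≤⟨ +-mono-≤ (≤-trans (≤-reflexive (sym (cong length (filter-accept (λ y → f y ≟ f x) {x} {xs} refl)))) (fib (f x))) bound ⟩
          D + length ys * D ∎)
      where
      open ≤-Reasoning
      fresh : f x ∉ map f ys
      fresh fx∈ with y , y∈ , eq ← ∈-map⁻ f fx∈ = proj₂ (∈-filter⁻ (λ y → ¬? (f y ≟ f x)) {xs = xs} (sub y∈)) (sym eq)

-- The potential

module _ {n : ℕ} where

  _≟ᵉ_ : DecidableEquality (Edge n)
  _≟ᵉ_ = ×-≡-dec _≟ᶠ_ _≟ᶠ_

  open DecMem _≟ᵉ_ public using () renaming (_∈?_ to _∈ᵉ?_)

  data Forces (Q : List (Edge n) → List (Edge n) → Set) : List (Edge n) → List (Edge n) → Set where
    stop : ∀ {R C} → Q R C → Forces Q R C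
    offer : ∀ {R R′ C} (e f : Edge n) → R ↭ e ∷ f ∷ R′ →
            Forces Q R′ (e ∷ C) → Forces Q R′ (f ∷ C) → Forces Q R C

  Forces-bind : ∀ {Q Q′ R C} → Forces Q R C → (∀ {R′ C′} → Q R′ C′ → Forces Q′ R′ C′) → Forces Q′ R C
  Forces-bind (stop q) next = next q
  Forces-bind (offer e f R↭ fe ff) next = offer e f R↭ (Forces-bind fe next) (Forces-bind ff next)

  play-out : ∀ {P : List (Edge n) → Set} → (∀ {e C} → P C → P (e ∷ C)) →
    ∀ fuel R {C} → length R ≤ fuel → P C → WaiterWins P R C
  play-out mono _ [] _ p = done z≤n p
  play-out mono _ (_ ∷ []) _ p = done (s≤s z≤n) p
  play-out mono (suc fuel) (e ∷ f ∷ R) (s≤s le) p =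
    offer e f ↭-refl (play-out mono fuel R (≤-trans (n≤1+n _) le) (mono p)) (play-out mono fuel R (≤-trans (n≤1+n _) le) (mono p))

  Forces⇒WaiterWins : ∀ {P R C} → (∀ {e C} → P C → P (e ∷ C)) → Forces (λ _ → P) R C → WaiterWins P R C
  Forces⇒WaiterWins {R = R} mono (stop p) = play-out mono (length R) R ≤-refl p
  Forces⇒WaiterWins mono (offer e f R↭ fe ff) = offer e f R↭ (Forces⇒WaiterWins mono fe) (Forces⇒WaiterWins mono ff)

  hits : List (Edge n) → List (Edge n) → ℕ
  hits As U = length (filter (_∈ᵉ? As) U)

  hits-↭ : ∀ As {U U′} → U ↭ U′ → hits As U ≡ hits As U′
  hits-↭ As U↭ = ↭-length (filter-↭ (_∈ᵉ? As) U↭)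

  bit : Bool → ℕ
  bit b = if b then 1 else 0

  hits-∷ : ∀ As e U → hits As (e ∷ U) ≡ bit (does (e ∈ᵉ? As)) + hits As U
  hits-∷ As e U with does (e ∈ᵉ? As)
  ... | true = refl
  ... | false = refl

  hits-++ : ∀ As U U′ → hits As (U ++ U′) ≡ hits As U + hits As U′
  hits-++ As U U′ = ≡-trans (cong length (filter-++ (_∈ᵉ? As) U U′)) (length-++ (filter (_∈ᵉ? As) U))

extract-max : {A : Set} (W : A → ℕ) (x : A) (xs : List A) →
  ∃[ e ] ∃[ ys ] x ∷ xs ↭ e ∷ ys × (∀ {y} → y ∈ ys → W y ≤ W e)
extract-max W x [] = x , [] , ↭-refl , λ ()
extract-max W x (y ∷ xs) with e , ys , p , top ← extract-max W y xs with ≤-total (W x) (W e)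
... | inj₁ x≤e = e , x ∷ ys , ↭-trans (prep x p) (swap x e ↭-refl) , λ { (here refl) → x≤e ; (there y∈) → top y∈ }
... | inj₂ e≤x = x , e ∷ ys , prep x p , λ { (here refl) → e≤x ; (there y∈) → ≤-trans (top y∈) e≤x }

closest-pair : {A : Set} (W : A → ℕ) (k : ℕ) (U : List A) (B : ℕ) → length U ≡ suc (suc k) → (∀ {x} → x ∈ U → W x ≤ B) →
  ∃[ e ] ∃[ f ] ∃[ U′ ] ∃[ g ] U ↭ e ∷ f ∷ U′ × W f ≤ W e × W e ≤ W f + g × g * suc k ≤ B
closest-pair W k (x ∷ y ∷ U) B len bound with extract-max W x (y ∷ U)
closest-pair W k (x ∷ y ∷ U) B len bound | e , [] , p₁ , top₁ = case ↭-length p₁ of λ ()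
closest-pair W zero (x ∷ y ∷ U) B len bound | e , z ∷ U₁ , p₁ , top₁ =
  e , z , U₁ , W e , p₁ , top₁ (here refl) , m≤n+m _ _
  , ≤-trans (≤-reflexive (*-identityʳ (W e))) (bound (∈-resp-↭ (↭-sym p₁) (here refl)))
closest-pair W (suc k) (x ∷ y ∷ U) B len bound | e , z ∷ U₁ , p₁ , top₁
  with f , U₂ , p₂ , top₂ ← extract-max W z U₁
  with e′ , f′ , U₃ , g , p₃ , f′≤e′ , gap , small ← closest-pair W k (z ∷ U₁) (W f)
         (suc-injective (≡-trans (sym (↭-length p₁)) len))
         (λ x∈ → case ∈-resp-↭ p₂ x∈ of λ { (here refl) → ≤-refl ; (there x∈′) → top₂ x∈′ })
  with ≤-total g (W e ∸ W f)
... | inj₁ g≤ = e′ , f′ , e ∷ U₃ , g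
    , ↭-trans p₁ (↭-trans (prep e p₃) (↭-trans (swap e e′ ↭-refl) (prep e′ (swap e f′ ↭-refl))))
    , f′≤e′ , gap
    , (begin
        g * suc (suc k) ≡⟨ *-suc g (suc k) ⟩
        g + g * suc k ≤⟨ +-mono-≤ g≤ small ⟩
        (W e ∸ W f) + W f ≡⟨ m∸n+n≡m (top₁ (∈-resp-↭ (↭-sym p₂) (here refl))) ⟩
        W e ≤⟨ bound (∈-resp-↭ (↭-sym p₁) (here refl)) ⟩
        B ∎)
  where open ≤-Reasoning
... | inj₂ ≤g = e , f , U₂ , (W e ∸ W f) , ↭-trans p₁ (prep e p₂) , top₁ (∈-resp-↭ (↭-sym p₂) (here refl))
    , m≤n+m∸n (W e) (W f)
    , (begin
        (W e ∸ W f) * suc (suc k) ≡⟨ *-suc (W e ∸ W f) (suc k) ⟩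
        (W e ∸ W f) + (W e ∸ W f) * suc k ≤⟨ +-monoʳ-≤ (W e ∸ W f) (≤-trans (*-monoˡ-≤ (suc k) ≤g) small) ⟩
        (W e ∸ W f) + W f ≡⟨ m∸n+n≡m (top₁ (∈-resp-↭ (↭-sym p₂) (here refl))) ⟩
        W e ≤⟨ bound (∈-resp-↭ (↭-sym p₁) (here refl)) ⟩
        B ∎)
  where open ≤-Reasoning

Σ[_]_ : {A : Set} → List A → (A → ℕ) → ℕ
Σ[ xs ] f = sum (map f xs)

Σ-≤ : {A : Set} (xs : List A) {f g : A → ℕ} → (∀ x → f x ≤ g x) → Σ[ xs ] f ≤ Σ[ xs ] g
Σ-≤ [] _ = z≤n
Σ-≤ (x ∷ xs) le = +-mono-≤ (le x) (Σ-≤ xs le)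

Σ-exchange : {A : Set} (xs : List A) {a b c d : A → ℕ} → (∀ x → 3 * a x + b x ≤ 3 * c x + d x) →
  3 * (Σ[ xs ] a) + (Σ[ xs ] b) ≤ 3 * (Σ[ xs ] c) + (Σ[ xs ] d)
Σ-exchange [] _ = z≤n
Σ-exchange (x ∷ xs) {a} {b} {c} {d} le = begin
  3 * (a x + (Σ[ xs ] a)) + (b x + (Σ[ xs ] b)) ≡⟨ rearrange (a x) (Σ[ xs ] a) (b x) (Σ[ xs ] b) ⟩
  (3 * a x + b x) + (3 * (Σ[ xs ] a) + (Σ[ xs ] b)) ≤⟨ +-mono-≤ (le x) (Σ-exchange xs le) ⟩
  (3 * c x + d x) + (3 * (Σ[ xs ] c) + (Σ[ xs ] d)) ≡⟨ sym (rearrange (c x) (Σ[ xs ] c) (d x) (Σ[ xs ] d)) ⟩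
  3 * (c x + (Σ[ xs ] c)) + (d x + (Σ[ xs ] d)) ∎
  where
  open ≤-Reasoning
  open +-*-Solver
  rearrange : ∀ p q r s → 3 * (p + q) + (r + s) ≡ (3 * p + r) + (3 * q + s)
  rearrange = solve 4 (λ p q r s → con 3 :* (p :+ q) :+ (r :+ s) := (con 3 :* p :+ r) :+ (con 3 :* q :+ s)) refl

member-≤-Σ : {A : Set} {xs : List A} (f : A → ℕ) {x : A} → x ∈ xs → f x ≤ Σ[ xs ] f
member-≤-Σ f (here refl) = m≤m+n _ _
member-≤-Σ {xs = y ∷ _} f (there x∈) = ≤-trans (member-≤-Σ f x∈) (m≤n+m _ (f y))

module Potential {n : ℕ} (𝓕 : List (ℕ × List (Edge n))) where

  -- An element of a winning set contributes 2 if Client took it, 4 if he rejected it, and the average 3 before it is offered.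
  term : List (Edge n) → List (Edge n) → List (Edge n) → ℕ × List (Edge n) → ℕ
  term D M U (c , As) = c * (2 ^ hits As D * 4 ^ hits As M * 3 ^ hits As U)

  Φ : List (Edge n) → List (Edge n) → List (Edge n) → ℕ
  Φ D M U = Σ[ 𝓕 ] term D M U

  restrict : Edge n → ℕ → ℕ × List (Edge n) → ℕ
  restrict e v (_ , As) = if does (e ∈ᵉ? As) then v else 0

  share : List (Edge n) → List (Edge n) → List (Edge n) → Edge n → ℕ
  share D M U e = Σ[ 𝓕 ] λ F → restrict e (term D M U F) F

  share≤Φ : ∀ D M U e → share D M U e ≤ Φ D M U
  share≤Φ D M U e = Σ-≤ 𝓕 λ F@(_ , As) → bounded (does (e ∈ᵉ? As))
    where
    bounded : ∀ b {v} → (if b then v else 0) ≤ v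
    bounded true = ≤-refl
    bounded false = z≤n

  term-↭ : ∀ D M {U U′} → U ↭ U′ → ∀ F → term D M U F ≡ term D M U′ F
  term-↭ D M U↭ (c , As) = cong (λ u → c * (2 ^ hits As D * 4 ^ hits As M * 3 ^ u)) (hits-↭ As U↭)

  Φ-↭ : ∀ D M {U U′} → U ↭ U′ → Φ D M U ≡ Φ D M U′
  Φ-↭ D M U↭ = cong sum (map-cong (term-↭ D M U↭) 𝓕)

  share-↭ : ∀ D M {U U′} → U ↭ U′ → ∀ e → share D M U e ≡ share D M U′ e
  share-↭ D M U↭ e = cong sum (map-cong (λ F → cong (λ v → restrict e v F) (term-↭ D M U↭ F)) 𝓕)

  private
    scaled : ∀ a b {l r} v → l ≡ a * v → r ≡ b * v → a ≤ b → l ≤ r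
    scaled a b v refl refl le = *-monoˡ-≤ v le

  open +-*-Solver

  term-exchange : ∀ D M U e f F →
    3 * term (e ∷ D) (f ∷ M) U F + restrict e (term D M (e ∷ f ∷ U) F) F
      ≤ 3 * term D M (e ∷ f ∷ U) F + restrict f (term D M (e ∷ f ∷ U) F) F
  term-exchange D M U e f (c , As)
    rewrite hits-∷ As e D | hits-∷ As f M | hits-∷ As e (f ∷ U) | hits-∷ As f U
    with does (e ∈ᵉ? As) | does (f ∈ᵉ? As)
  ... | true | true = scaled 33 36 (c * (P * Q * R))
      (solve 4 (λ c p q r → con 3 :* (c :* ((con 2 :* p) :* (con 4 :* q) :* r)) :+ c :* (p :* q :* (con 3 :* (con 3 :* r))) := con 33 :* (c :* (p :* q :* r))) refl c P Q R)
      (solve 4 (λ c p q r → con 3 :* (c :* (p :* q :* (con 3 :* (con 3 :* r)))) :+ c :* (p :* q :* (con 3 :* (con 3 :* r))) := con 36 :* (c :* (p :* q :* r))) refl c P Q R)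
      (m≤m+n 33 3)
    where P = 2 ^ hits As D ; Q = 4 ^ hits As M ; R = 3 ^ hits As U
  ... | true | false = scaled 9 9 (c * (P * Q * R))
      (solve 4 (λ c p q r → con 3 :* (c :* ((con 2 :* p) :* q :* r)) :+ c :* (p :* q :* (con 3 :* r)) := con 9 :* (c :* (p :* q :* r))) refl c P Q R)
      (solve 4 (λ c p q r → con 3 :* (c :* (p :* q :* (con 3 :* r))) :+ con 0 := con 9 :* (c :* (p :* q :* r))) refl c P Q R)
      ≤-refl
    where P = 2 ^ hits As D ; Q = 4 ^ hits As M ; R = 3 ^ hits As U
  ... | false | true = scaled 12 12 (c * (P * Q * R))
      (solve 4 (λ c p q r → con 3 :* (c :* (p :* (con 4 :* q) :* r)) :+ con 0 := con 12 :* (c :* (p :* q :* r))) refl c P Q R)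
      (solve 4 (λ c p q r → con 3 :* (c :* (p :* q :* (con 3 :* r))) :+ c :* (p :* q :* (con 3 :* r)) := con 12 :* (c :* (p :* q :* r))) refl c P Q R)
      ≤-refl
    where P = 2 ^ hits As D ; Q = 4 ^ hits As M ; R = 3 ^ hits As U
  ... | false | false = ≤-refl

  Φ-exchange : ∀ D M U e f → 3 * Φ (e ∷ D) (f ∷ M) U + share D M (e ∷ f ∷ U) e ≤ 3 * Φ D M (e ∷ f ∷ U) + share D M (e ∷ f ∷ U) f
  Φ-exchange D M U e f = Σ-exchange 𝓕 (term-exchange D M U e f)

  module _ (U₀ J C₀ : List (Edge n)) (T : ℕ) where

    Played : List (Edge n) → List (Edge n) → Set
    Played R C = ∃[ D ] ∃[ M ] ∃[ U ] R ↭ U ++ J × C ≡ D ++ C₀ × U₀ ↭ D ++ M ++ U × length U ≤ 1 × Φ D M U < T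

    private
      step-bound : ∀ {new Φ₀ g k} → 3 * new ≤ 3 * Φ₀ + g → g * k ≤ Φ₀ → new * k ≤ Φ₀ * suc k
      step-bound {new} {Φ₀} {g} {k} le small = *-cancelˡ-≤ 3 (begin
        3 * (new * k) ≡⟨ sym (*-assoc 3 new k) ⟩
        (3 * new) * k ≤⟨ *-monoˡ-≤ k le ⟩
        (3 * Φ₀ + g) * k ≡⟨ *-distribʳ-+ k (3 * Φ₀) g ⟩
        3 * Φ₀ * k + g * k ≤⟨ +-monoʳ-≤ (3 * Φ₀ * k) small ⟩
        3 * Φ₀ * k + Φ₀ ≤⟨ +-monoʳ-≤ (3 * Φ₀ * k) (m≤m+n Φ₀ (2 * Φ₀)) ⟩
        3 * Φ₀ * k + 3 * Φ₀ ≡⟨ solve 2 (λ p k → con 3 :* p :* k :+ con 3 :* p := con 3 :* (p :* (con 1 :+ k))) refl Φ₀ k ⟩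
        3 * (Φ₀ * suc k) ∎)
        where open ≤-Reasoning

    -- Offering two edges of nearly equal share multiplies Φ by at most N / (N - 1) when N edges are left,
    -- whatever Client picks; hence Φ * N is the invariant.
    play : ∀ fuel D M U {R} → length U ≤ fuel → R ↭ U ++ J → U₀ ↭ D ++ M ++ U → (k : ℕ) → 1 ≤ k → length U ≤ k →
      Φ D M U * k < T → Forces Played R (D ++ C₀)
    play fuel D M [] _ R↭ U₀↭ k@(suc _) _ _ lt = stop (D , M , [] , R↭ , refl , U₀↭ , z≤n , ≤-<-trans (m≤m*n (Φ D M []) k) lt)
    play fuel D M (x ∷ []) _ R↭ U₀↭ k@(suc _) _ _ lt = stop (D , M , x ∷ [] , R↭ , refl , U₀↭ , s≤s z≤n , ≤-<-trans (m≤m*n (Φ D M (x ∷ [])) k) lt)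
    play (suc fuel) D M (x ∷ y ∷ U) (s≤s fuel≤) R↭ U₀↭ k _ N≤k lt
      with e , f , U′ , g , p , f≤e , gap , small ← closest-pair (share D M (x ∷ y ∷ U)) (length U) (x ∷ y ∷ U) (Φ D M (x ∷ y ∷ U)) refl (λ {z} _ → share≤Φ D M (x ∷ y ∷ U) z)
      = offer e f (↭-trans R↭ (++⁺ʳ J p))
          (play fuel (e ∷ D) (f ∷ M) U′ fuel′ ↭-refl (reorder e f p) (suc (length U)) (s≤s z≤n) len≤ (below e f pick-e))
          (play fuel (f ∷ D) (e ∷ M) U′ fuel′ ↭-refl (reorder f e (↭-trans p (swap e f ↭-refl))) (suc (length U)) (s≤s z≤n) len≤ (below f e pick-f))
      where
      V = x ∷ y ∷ U
      U′≡U : length U′ ≡ length U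
      U′≡U = suc-injective (suc-injective (sym (↭-length p)))
      fuel′ : length U′ ≤ fuel
      fuel′ = ≤-trans (≤-reflexive U′≡U) (≤-trans (n≤1+n _) fuel≤)
      len≤ : length U′ ≤ suc (length U)
      len≤ = ≤-trans (≤-reflexive U′≡U) (n≤1+n _)
      below : ∀ a b → 3 * Φ (a ∷ D) (b ∷ M) U′ ≤ 3 * Φ D M V + g → Φ (a ∷ D) (b ∷ M) U′ * suc (length U) < T
      below a b le = ≤-<-trans (step-bound {Φ (a ∷ D) (b ∷ M) U′} {Φ D M V} {g} le small) (≤-<-trans (*-monoʳ-≤ (Φ D M V) N≤k) lt)
      exch : ∀ a b → V ↭ a ∷ b ∷ U′ → 3 * Φ (a ∷ D) (b ∷ M) U′ + share D M V a ≤ 3 * Φ D M V + share D M V b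
      exch a b q rewrite share-↭ D M q a | share-↭ D M q b | Φ-↭ D M q = Φ-exchange D M U′ a b
      pick-e : 3 * Φ (e ∷ D) (f ∷ M) U′ ≤ 3 * Φ D M V + g
      pick-e = ≤-trans (+-cancelʳ-≤ (share D M V e) _ _ (≤-trans (exch e f p) (+-monoʳ-≤ (3 * Φ D M V) f≤e))) (m≤m+n _ g)
      pick-f : 3 * Φ (f ∷ D) (e ∷ M) U′ ≤ 3 * Φ D M V + g
      pick-f = +-cancelʳ-≤ (share D M V f) _ _ (≤-trans (exch f e (↭-trans p (swap e f ↭-refl)))
        (≤-trans (+-monoʳ-≤ (3 * Φ D M V) gap) (≤-reflexive (solve 3 (λ a b c → a :+ (b :+ c) := a :+ c :+ b) refl (3 * Φ D M V) (share D M V f) g))))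
      reorder : ∀ a b → V ↭ a ∷ b ∷ U′ → U₀ ↭ a ∷ D ++ b ∷ M ++ U′
      reorder a b q = ↭-trans U₀↭ (↭-trans (++⁺ˡ D (++⁺ˡ M q)) (↭-trans (++⁺ˡ D (shift a M (b ∷ U′)))
        (↭-trans (shift a D (M ++ b ∷ U′)) (prep a (++⁺ˡ D (shift b M U′))))))

-- Playing on a pool of edges

four^ : ∀ h → 2 ^ (3 * h) * 3 ^ (8 * h) ≤ 4 ^ (8 * h)
four^ h = begin
  2 ^ (3 * h) * 3 ^ (8 * h) ≡⟨ sym (cong₂ _*_ (^-*-assoc 2 3 h) (^-*-assoc 3 8 h)) ⟩
  8 ^ h * 6561 ^ h ≡⟨ sym (^-distribʳ-* 8 6561 h) ⟩
  52488 ^ h ≤⟨ ^-monoˡ-≤ h (m≤m+n 52488 13048) ⟩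
  65536 ^ h ≡⟨ ^-*-assoc 4 8 h ⟩
  4 ^ (8 * h) ∎
  where
  open ≤-Reasoning
  open +-*-Solver
  ^-distribʳ-* : ∀ a b h → (a * b) ^ h ≡ a ^ h * b ^ h
  ^-distribʳ-* a b zero = refl
  ^-distribʳ-* a b (suc h) rewrite ^-distribʳ-* a b h =
    solve 4 (λ a b x y → a :* b :* (x :* y) := a :* x :* (b :* y)) refl a b (a ^ h) (b ^ h)

-- Since 8 · 3⁸ ≤ 4⁸, a family of size a ≥ 8h starts with relative weight at most 2^(1 - 2h), even when h hits are demanded.
initial-weight : ∀ {N a h k} → 8 * h ≤ a → a ≤ N → suc k ≤ 2 * h →
  2 ^ suc h * 4 ^ (N ∸ a) * 3 ^ a * 2 ^ k ≤ 4 ^ N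
initial-weight {N} {a} {h} {k} 8h≤a a≤N k<2h = begin
  2 ^ suc h * 4 ^ (N ∸ a) * 3 ^ a * 2 ^ k ≡⟨ solve 4 (λ p q r s → p :* q :* r :* s := p :* s :* r :* q) refl (2 ^ suc h) (4 ^ (N ∸ a)) (3 ^ a) (2 ^ k) ⟩
  2 ^ suc h * 2 ^ k * 3 ^ a * 4 ^ (N ∸ a) ≤⟨ *-monoˡ-≤ (4 ^ (N ∸ a)) (*-monoˡ-≤ (3 ^ a) pow2) ⟩
  2 ^ (3 * h) * 3 ^ a * 4 ^ (N ∸ a) ≤⟨ *-monoˡ-≤ (4 ^ (N ∸ a)) body ⟩
  4 ^ a * 4 ^ (N ∸ a) ≡⟨ sym (^-distribˡ-+-* 4 a (N ∸ a)) ⟩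
  4 ^ (a + (N ∸ a)) ≡⟨ cong (4 ^_) (m+[n∸m]≡n a≤N) ⟩
  4 ^ N ∎
  where
  open ≤-Reasoning
  open +-*-Solver
  pow2 : 2 ^ suc h * 2 ^ k ≤ 2 ^ (3 * h)
  pow2 = begin
    2 ^ suc h * 2 ^ k ≡⟨ sym (^-distribˡ-+-* 2 (suc h) k) ⟩
    2 ^ (suc h + k) ≡⟨ cong (2 ^_) (sym (+-suc h k)) ⟩
    2 ^ (h + suc k) ≤⟨ ^-monoʳ-≤ 2 (+-monoʳ-≤ h k<2h) ⟩
    2 ^ (3 * h) ∎
  r = a ∸ 8 * h
  a≡ : 8 * h + r ≡ a
  a≡ = m+[n∸m]≡n 8h≤a
  body : 2 ^ (3 * h) * 3 ^ a ≤ 4 ^ a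
  body = begin
    2 ^ (3 * h) * 3 ^ a ≡⟨ cong (λ b → 2 ^ (3 * h) * 3 ^ b) (sym a≡) ⟩
    2 ^ (3 * h) * 3 ^ (8 * h + r) ≡⟨ cong (2 ^ (3 * h) *_) (^-distribˡ-+-* 3 (8 * h) r) ⟩
    2 ^ (3 * h) * (3 ^ (8 * h) * 3 ^ r) ≡⟨ sym (*-assoc (2 ^ (3 * h)) (3 ^ (8 * h)) (3 ^ r)) ⟩
    2 ^ (3 * h) * 3 ^ (8 * h) * 3 ^ r ≤⟨ *-mono-≤ (four^ h) (^-monoˡ-≤ r (m≤m+n 3 1)) ⟩
    4 ^ (8 * h) * 4 ^ r ≡⟨ sym (^-distribˡ-+-* 4 (8 * h) r) ⟩
    4 ^ (8 * h + r) ≡⟨ cong (4 ^_) a≡ ⟩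
    4 ^ a ∎

final-weight : ∀ {N a h d m u} → d + m + u ≡ a → u ≤ 1 → a ≤ N → d < h →
  4 ^ N ≤ 2 ^ suc h * 4 ^ (N ∸ a) * (2 ^ d * 4 ^ m * 3 ^ u)
final-weight {N} {a} {h} {d} {m} {u} refl u≤1 a≤N d<h = begin
  4 ^ N ≡⟨ cong (4 ^_) (sym (m+[n∸m]≡n a≤N)) ⟩
  4 ^ (a + (N ∸ a)) ≡⟨ ^-distribˡ-+-* 4 a (N ∸ a) ⟩
  4 ^ (d + m + u) * 4 ^ (N ∸ a) ≤⟨ *-monoˡ-≤ (4 ^ (N ∸ a)) (^-monoʳ-≤ 4 (+-monoʳ-≤ (d + m) u≤1)) ⟩
  4 ^ (d + m + 1) * 4 ^ (N ∸ a) ≡⟨ cong (_* 4 ^ (N ∸ a)) (≡-trans (^-distribˡ-+-* 4 (d + m) 1) (cong (_* 4) (≡-trans (^-distribˡ-+-* 4 d m) (cong (_* 4 ^ m) (4^≡2^2^ d))))) ⟩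
  2 ^ d * 2 ^ d * 4 ^ m * 4 * 4 ^ (N ∸ a) ≡⟨ solve 3 (λ x y z → x :* x :* y :* con 4 :* z := (con 2 :* (con 2 :* x)) :* z :* (x :* y :* con 1)) refl (2 ^ d) (4 ^ m) (4 ^ (N ∸ a)) ⟩
  2 ^ suc (suc d) * 4 ^ (N ∸ a) * (2 ^ d * 4 ^ m * 1) ≤⟨ *-mono-≤ (*-monoˡ-≤ (4 ^ (N ∸ a)) (^-monoʳ-≤ 2 (s≤s d<h))) (*-monoʳ-≤ (2 ^ d * 4 ^ m) (^-monoʳ-≤ 3 {0} {u} z≤n)) ⟩
  2 ^ suc h * 4 ^ (N ∸ a) * (2 ^ d * 4 ^ m * 3 ^ u) ∎
  where
  open ≤-Reasoning
  open +-*-Solver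
  4^≡2^2^ : ∀ d → 4 ^ d ≡ 2 ^ d * 2 ^ d
  4^≡2^2^ d = ≡-trans (^-*-assoc 2 2 d) (≡-trans (cong (2 ^_) (cong (d +_) (+-identityʳ d))) (^-distribˡ-+-* 2 d d))

2^>0 : ∀ k → 0 < 2 ^ k
2^>0 k = ^-monoʳ-≤ 2 {0} {k} z≤n

module _ {n : ℕ} {R C : List (Edge n)} (unique-R : Unique R) (U : List (Edge n)) (unique-U : Unique U) (U⊆R : ∀ {e} → e ∈ U → e ∈ R)
  (k₁ k₂ : ℕ) (Fs₁ Fs₂ : List (List (Edge n)))
  (few₁ : length Fs₁ * (4 * suc (length U)) ≤ 2 ^ k₁) (few₂ : length Fs₂ * (4 * suc (length U)) ≤ 2 ^ k₂) where

  Hit : List (Edge n) → ℕ → List (List (Edge n)) → Set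
  Hit C′ k Fs = ∀ {As} h → As ∈ Fs → Unique As → (∀ {e} → e ∈ As → e ∈ U) → 8 * h ≤ length As → suc k ≤ 2 * h →
    h ≤ length (filter (_∈ᵉ? C′) As)

  PoolPlayed : List (Edge n) → List (Edge n) → Set
  PoolPlayed R′ C′ = Unique R′ × (∀ {e} → e ∈ R → e ∉ U → e ∈ R′) × (∀ {e} → e ∈ C → e ∈ C′) × Hit C′ k₁ Fs₁ × Hit C′ k₂ Fs₂

  private
    N = length U

    quota : List (Edge n) → ℕ
    quota As = hits As U / 8

    large? : ∀ k → Decidable (λ As → suc k ≤ 2 * quota As)
    large? k As = suc k ≤? 2 * quota As

    weighted : List (Edge n) → ℕ × List (Edge n)
    weighted As = 2 ^ suc (quota As) * 4 ^ (N ∸ hits As U) , As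

    𝓕 : List (ℕ × List (Edge n))
    𝓕 = map weighted (filter (large? k₁) Fs₁ ++ filter (large? k₂) Fs₂)

    open Potential 𝓕

    hits≤N : ∀ As → hits As U ≤ N
    hits≤N As = length-filter (_∈ᵉ? As) U

    8*quota≤hits : ∀ As → 8 * quota As ≤ hits As U
    8*quota≤hits As = ≤-trans (≤-reflexive (*-comm 8 (quota As))) (m/n*n≤m (hits As U) 8)

    sum-bound : ∀ k Fs → (Σ[ map weighted (filter (large? k) Fs) ] term [] [] U) * 2 ^ k ≤ length Fs * 4 ^ N
    sum-bound k [] = z≤n
    sum-bound k (As ∷ Fs) with large? k As
    ... | no small = ≤-trans (≤-reflexive (cong (λ Gs → (Σ[ map weighted Gs ] term [] [] U) * 2 ^ k) (filter-reject (large? k) small)))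
        (≤-trans (sum-bound k Fs) (m≤n+m _ (4 ^ N)))
    ... | yes big = ≤-trans (≤-reflexive (≡-trans (cong (λ Gs → (Σ[ map weighted Gs ] term [] [] U) * 2 ^ k) (filter-accept (large? k) big))
          (*-distribʳ-+ (2 ^ k) (term [] [] U (weighted As)) (Σ[ map weighted (filter (large? k) Fs) ] term [] [] U))))
        (+-mono-≤ (≤-trans (≤-reflexive (cong (λ x → 2 ^ suc (quota As) * 4 ^ (N ∸ hits As U) * x * 2 ^ k) (+-identityʳ (3 ^ hits As U))))
          (initial-weight {h = quota As} (8*quota≤hits As) (hits≤N As) big)) (sum-bound k Fs))

    scaled-bound : ∀ k Fs → length Fs * (4 * suc N) ≤ 2 ^ k →
      (Σ[ map weighted (filter (large? k) Fs) ] term [] [] U) * (4 * suc N) ≤ 4 ^ N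
    scaled-bound k Fs few = *-cancelʳ-≤ _ _ (2 ^ k) {{>-nonZero (2^>0 k)}} (begin
      S * (4 * suc N) * 2 ^ k ≡⟨ solve 3 (λ s c t → s :* c :* t := s :* t :* c) refl S (4 * suc N) (2 ^ k) ⟩
      S * 2 ^ k * (4 * suc N) ≤⟨ *-monoˡ-≤ (4 * suc N) (sum-bound k Fs) ⟩
      length Fs * 4 ^ N * (4 * suc N) ≡⟨ solve 3 (λ s c t → s :* c :* t := s :* t :* c) refl (length Fs) (4 ^ N) (4 * suc N) ⟩
      length Fs * (4 * suc N) * 4 ^ N ≤⟨ *-monoˡ-≤ (4 ^ N) few ⟩
      2 ^ k * 4 ^ N ≡⟨ *-comm (2 ^ k) (4 ^ N) ⟩
      4 ^ N * 2 ^ k ∎)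
      where
      open ≤-Reasoning
      open +-*-Solver
      S = Σ[ map weighted (filter (large? k) Fs) ] term [] [] U

    Σ-++ : ∀ (xs ys : List (List (Edge n))) → (Σ[ map weighted (xs ++ ys) ] term [] [] U) ≡ (Σ[ map weighted xs ] term [] [] U) + (Σ[ map weighted ys ] term [] [] U)
    Σ-++ [] ys = refl
    Σ-++ (x ∷ xs) ys = ≡-trans (cong (term [] [] U (weighted x) +_) (Σ-++ xs ys)) (sym (+-assoc (term [] [] U (weighted x)) _ _))

    initially : Φ [] [] U * suc N < 4 ^ N
    initially = *-cancelˡ-< 4 _ _ (begin-strict
      4 * (Φ [] [] U * suc N) ≡⟨ solve 2 (λ p s → con 4 :* (p :* s) := p :* (con 4 :* s)) refl (Φ [] [] U) (suc N) ⟩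
      Φ [] [] U * (4 * suc N) ≡⟨ cong (_* (4 * suc N)) (Σ-++ (filter (large? k₁) Fs₁) (filter (large? k₂) Fs₂)) ⟩
      (S₁ + S₂) * (4 * suc N) ≡⟨ *-distribʳ-+ (4 * suc N) S₁ S₂ ⟩
      S₁ * (4 * suc N) + S₂ * (4 * suc N) ≤⟨ +-mono-≤ (scaled-bound k₁ Fs₁ few₁) (scaled-bound k₂ Fs₂ few₂) ⟩
      4 ^ N + 4 ^ N <⟨ m<m+n (4 ^ N + 4 ^ N) (^-monoʳ-≤ 4 {0} {N} z≤n) ⟩
      4 ^ N + 4 ^ N + 4 ^ N ≤⟨ m≤m+n (4 ^ N + 4 ^ N + 4 ^ N) (4 ^ N) ⟩
      4 ^ N + 4 ^ N + 4 ^ N + 4 ^ N ≡⟨ solve 1 (λ x → x :+ x :+ x :+ x := con 4 :* x) refl (4 ^ N) ⟩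
      4 * 4 ^ N ∎)
      where
      open ≤-Reasoning
      open +-*-Solver
      S₁ = Σ[ map weighted (filter (large? k₁) Fs₁) ] term [] [] U
      S₂ = Σ[ map weighted (filter (large? k₂) Fs₂) ] term [] [] U

    hit : ∀ {C′ J D M U′} → D ++ M ++ U′ ↭ U → length U′ ≤ 1 → Φ D M U′ < 4 ^ N → C′ ≡ D ++ J →
      ∀ {As} h → weighted As ∈ 𝓕 → (∀ {e} → e ∈ As → e ∈ U) → 8 * h ≤ hits As U → h ≤ length (filter (_∈ᵉ? C′) As)
    hit {J = J} {D} {M} {U′} U↭ u≤1 small refl {As} h As∈ As⊆U 8h≤ = ≤-trans h≤quota (≤-trans quota≤hits picked)
      where
      h≤quota : h ≤ quota As
      h≤quota = ≤-trans (≤-reflexive (sym (m*n/n≡m h 8))) (/-monoˡ-≤ 8 (≤-trans (≤-reflexive (*-comm h 8)) 8h≤))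
      total : hits As D + hits As M + hits As U′ ≡ hits As U
      total = ≡-trans (+-assoc (hits As D) _ _) (≡-trans (cong (hits As D +_) (sym (hits-++ As M U′)))
        (≡-trans (sym (hits-++ As D (M ++ U′))) (hits-↭ As U↭)))
      quota≤hits : quota As ≤ hits As D
      quota≤hits with quota As ≤? hits As D
      ... | yes le = le
      ... | no nle = contradiction (≤-trans (final-weight total (≤-trans (length-filter (_∈ᵉ? As) U′) u≤1) (hits≤N As) (≰⇒> nle))
                       (member-≤-Σ (term D M U′) As∈)) (<⇒≱ small)
      unique-D : Unique D
      unique-D = go D (Unique-resp-↭ (↭-sym U↭) unique-U)
        where
        go : ∀ D {X} → Unique (D ++ X) → Unique D
        go [] _ = []
        go (e ∷ D) u = Unique-cons (λ e∈ → Unique-head u (∈-++⁺ˡ e∈)) (go D (Unique-tail u))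
      picked : hits As D ≤ length (filter (_∈ᵉ? (D ++ J)) As)
      picked = unique-⊆-length (filter⁺ (_∈ᵉ? As) unique-D)
        (λ e∈ → let e∈D , e∈As = ∈-filter⁻ (_∈ᵉ? As) {xs = D} e∈ in ∈-filter⁺ (_∈ᵉ? (D ++ J)) e∈As (∈-++⁺ˡ e∈D))

  pool : Forces PoolPlayed R C
  pool with J , R↭ ← unique-⊆-complement unique-U U⊆R
    = Forces-bind (play U J C (4 ^ N) N [] [] U ≤-refl R↭ ↭-refl (suc N) (s≤s z≤n) (n≤1+n N) initially) finish
    where
    finish : ∀ {R′ C′} → Played U J C (4 ^ N) R′ C′ → Forces PoolPlayed R′ C′
    finish {R′} {C′} (D , M , U′ , R′↭ , refl , U↭ , u≤1 , small) = stop
      ( Unique-resp-↭ (↭-sym R′↭) unique-rest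
      , (λ {e} e∈R e∉U → ∈-resp-↭ (↭-sym R′↭) (∈-++⁺ʳ U′ (right e∉U (∈-++⁻ U (∈-resp-↭ R↭ e∈R)))))
      , ∈-++⁺ʳ D
      , (λ h As∈ u sub 8h≤ k≤ → hit {J = C} {D} {M} {U′} (↭-sym U↭) u≤1 small refl h
          (∈-map⁺ weighted (∈-++⁺ˡ (∈-filter⁺ (large? k₁) As∈ (big {h = h} u sub 8h≤ k≤)))) sub (≤-trans 8h≤ (all-hit u sub)))
      , (λ h As∈ u sub 8h≤ k≤ → hit {J = C} {D} {M} {U′} (↭-sym U↭) u≤1 small refl h
          (∈-map⁺ weighted (∈-++⁺ʳ (filter (large? k₁) Fs₁) (∈-filter⁺ (large? k₂) As∈ (big {h = h} u sub 8h≤ k≤)))) sub (≤-trans 8h≤ (all-hit u sub))) )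
      where
      right : ∀ {e : Edge n} {J : List (Edge n)} → e ∉ U → e ∈ U ⊎ e ∈ J → e ∈ J
      right e∉ (inj₁ e∈) = contradiction e∈ e∉
      right _ (inj₂ e∈) = e∈
      drop-left : ∀ (X : List (Edge n)) {Y} → Unique (X ++ Y) → Unique Y
      drop-left [] u = u
      drop-left (_ ∷ X) u = drop-left X (Unique-tail u)
      reassoc : R ↭ (D ++ M) ++ (U′ ++ J)
      reassoc = ↭-trans R↭ (↭-trans (++⁺ʳ J U↭) (↭-trans (↭-++-assoc D (M ++ U′) J) (↭-trans (++⁺ˡ D (↭-++-assoc M U′ J)) (↭-sym (↭-++-assoc D M (U′ ++ J))))))
      unique-rest : Unique (U′ ++ J)
      unique-rest = drop-left (D ++ M) (Unique-resp-↭ reassoc unique-R)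
      all-hit : ∀ {As} → Unique As → (∀ {e} → e ∈ As → e ∈ U) → length As ≤ hits As U
      all-hit {As} u sub = unique-⊆-length u (λ e∈ → ∈-filter⁺ (_∈ᵉ? As) (sub e∈) e∈)
      big : ∀ {As k h} → Unique As → (∀ {e} → e ∈ As → e ∈ U) → 8 * h ≤ length As → suc k ≤ 2 * h → suc k ≤ 2 * quota As
      big {As} {k} {h} u sub 8h≤ k≤ = ≤-trans k≤ (*-monoʳ-≤ 2 (≤-trans (≤-reflexive (sym (m*n/n≡m h 8)))
        (/-monoˡ-≤ 8 (≤-trans (≤-reflexive (*-comm h 8)) (≤-trans 8h≤ (all-hit u sub))))))

-- Edges and vertices

tuples : {A : Set} → List A → ℕ → List (List A)
tuples xs zero = [ [] ]
tuples xs (suc m) = cartesianProductWith _∷_ xs (tuples xs m)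

length-cartesianProductWith : {A B C : Set} (f : A → B → C) (xs : List A) (ys : List B) →
  length (cartesianProductWith f xs ys) ≡ length xs * length ys
length-cartesianProductWith f [] ys = refl
length-cartesianProductWith f (x ∷ xs) ys = ≡-trans (length-++ (map (f x) ys))
  (cong₂ _+_ (length-map (f x) ys) (length-cartesianProductWith f xs ys))

length-tuples : {A : Set} (xs : List A) (m : ℕ) → length (tuples xs m) ≡ length xs ^ m
length-tuples xs zero = refl
length-tuples xs (suc m) = ≡-trans (length-cartesianProductWith _∷_ xs (tuples xs m)) (cong (length xs *_) (length-tuples xs m))

∈-tuples : {A : Set} {xs : List A} (ys : List A) → (∀ {y} → y ∈ ys → y ∈ xs) → ys ∈ tuples xs (length ys)
∈-tuples [] _ = here refl
∈-tuples (y ∷ ys) sub = ∈-cartesianProductWith⁺ _∷_ (sub (here refl)) (∈-tuples ys (sub ∘ there))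

∈-tuples-length : {A : Set} {xs : List A} {m : ℕ} (ys : List A) → length ys ≡ m → (∀ {y} → y ∈ ys → y ∈ xs) → ys ∈ tuples xs m
∈-tuples-length ys refl sub = ∈-tuples ys sub

length-allFin : ∀ n → length (allFin n) ≡ n
length-allFin n = length-tabulate {n = n} id

module _ {n : ℕ} where

  edge : Fin n → Fin n → Edge n
  edge u v = if toℕ u <ᵇ toℕ v then (u , v) else (v , u)

  edge-cases : ∀ u v → edge u v ≡ (u , v) ⊎ edge u v ≡ (v , u)
  edge-cases u v with toℕ u <ᵇ toℕ v
  ... | true = inj₁ refl
  ... | false = inj₂ refl

  edge-injective : ∀ {u v u′ v′} → edge u v ≡ edge u′ v′ → (u ≡ u′ × v ≡ v′) ⊎ (u ≡ v′ × v ≡ u′)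
  edge-injective {u} {v} {u′} {v′} eq with edge-cases u v | edge-cases u′ v′
  ... | inj₁ p | inj₁ q with refl ← ≡-trans (sym p) (≡-trans eq q) = inj₁ (refl , refl)
  ... | inj₁ p | inj₂ q with refl ← ≡-trans (sym p) (≡-trans eq q) = inj₂ (refl , refl)
  ... | inj₂ p | inj₁ q with refl ← ≡-trans (sym p) (≡-trans eq q) = inj₂ (refl , refl)
  ... | inj₂ p | inj₂ q with refl ← ≡-trans (sym p) (≡-trans eq q) = inj₁ (refl , refl)

  edge-sym : ∀ u v → edge u v ≡ edge v u
  edge-sym u v with toℕ u <ᵇ toℕ v in p | toℕ v <ᵇ toℕ u in q
  ... | true | false = refl
  ... | false | true = refl
  ... | true | true = contradiction (<ᵇ⇒< (toℕ v) (toℕ u) (subst IsTrue (sym q) tt)) (<⇒≯ (<ᵇ⇒< (toℕ u) (toℕ v) (subst IsTrue (sym p) tt)))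
  ... | false | false = cong₂ _,_ (sym u≡v) u≡v
    where
    u≡v : u ≡ v
    u≡v = toℕ-injective (≤-antisym (≮⇒≥ (λ lt → subst IsTrue q (<⇒<ᵇ lt))) (≮⇒≥ (λ lt → subst IsTrue p (<⇒<ᵇ lt))))

  private
    oriented : ∀ {u v : Fin n} → toℕ u < toℕ v → edge u v ∈ allEdges n
    oriented {u} {v} lt = subst (_∈ allEdges n) (sym forward)
      (∈-filter⁺ (T? ∘ λ e → toℕ (proj₁ e) <ᵇ toℕ (proj₂ e)) (∈-cartesianProduct⁺ (∈-allFin u) (∈-allFin v)) (<⇒<ᵇ lt))
      where
      forward : edge u v ≡ (u , v)
      forward with toℕ u <ᵇ toℕ v | <⇒<ᵇ lt
      ... | true | _ = refl

  edge-∈-allEdges : ∀ {u v} → u ≢ v → edge u v ∈ allEdges n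
  edge-∈-allEdges {u} {v} u≢v with toℕ u <? toℕ v
  ... | yes lt = oriented lt
  ... | no nlt = subst (_∈ allEdges n) (edge-sym v u) (oriented (≤∧≢⇒< (≮⇒≥ nlt) (u≢v ∘ sym ∘ toℕ-injective)))

  Unique-allEdges : Unique (allEdges n)
  Unique-allEdges = filter⁺ (T? ∘ λ e → toℕ (proj₁ e) <ᵇ toℕ (proj₂ e)) (cartesianProduct⁺ (allFin⁺ n) (allFin⁺ n))

  length-allEdges : length (allEdges n) ≤ n * n
  length-allEdges = ≤-trans (length-filter (T? ∘ λ e → toℕ (proj₁ e) <ᵇ toℕ (proj₂ e)) (cartesianProduct (allFin n) (allFin n)))
    (≤-reflexive (≡-trans (length-cartesianProductWith _,_ (allFin n) (allFin n)) (cong₂ _*_ (length-allFin n) (length-allFin n))))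

  Joined : List (Edge n) → Fin n → Fin n → Set
  Joined C u v = edge u v ∈ C

  joined? : ∀ C u v → Dec (Joined C u v)
  joined? C u v = edge u v ∈ᵉ? C

  Joined-sym : ∀ {C u v} → Joined C u v → Joined C v u
  Joined-sym {C} {u} {v} = subst (_∈ C) (edge-sym u v)

  Joined⇒ClientAdj : ∀ {C u v} → Joined C u v → ClientAdj C u v
  Joined⇒ClientAdj {C} {u} {v} j with edge-cases u v
  ... | inj₁ eq = inj₁ (subst (_∈ C) eq j)
  ... | inj₂ eq = inj₂ (subst (_∈ C) eq j)

  Unique-product-edges : ∀ {xs qs} → Unique xs → Unique qs → (∀ {x} → x ∈ xs → x ∉ qs) → Unique (map (uncurry edge) (cartesianProduct xs qs))
  Unique-product-edges {xs} {qs} ux uq disj = Unique-map-on inj (cartesianProduct⁺ ux uq)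
    where
    inj : ∀ {p p′} → p ∈ cartesianProduct xs qs → p′ ∈ cartesianProduct xs qs → uncurry edge p ≡ uncurry edge p′ → p ≡ p′
    inj p∈ p′∈ eq with edge-injective eq
    ... | inj₁ (refl , refl) = refl
    ... | inj₂ (refl , _) = contradiction (proj₂ (∈-cartesianProduct⁻ xs qs p′∈)) (disj (proj₁ (∈-cartesianProduct⁻ xs qs p∈)))

  module _ {R C : List (Edge n)} (unique-R : Unique R) (U : List (Edge n)) (unique-U : Unique U) (U⊆R : ∀ {e} → e ∈ U → e ∈ R)
    (k₁ k₂ : ℕ) (bigs : List (List (Fin n × Fin n))) (stars : List (Fin n × List (Fin n)))
    (few₁ : length bigs * (4 * suc (length U)) ≤ 2 ^ k₁) (few₂ : length stars * (4 * suc (length U)) ≤ 2 ^ k₂) where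

    record StagePlayed (R′ C′ : List (Edge n)) : Set where
      field
        unique-R′ : Unique R′
        untouched : ∀ {e} → e ∈ R → e ∉ U → e ∈ R′
        C⊆C′ : ∀ {e} → e ∈ C → e ∈ C′
        big-hits : ∀ {ps} h → ps ∈ bigs → Unique (map (uncurry edge) ps) → (∀ {x y} → (x , y) ∈ ps → edge x y ∈ U) →
          8 * h ≤ length ps → suc k₁ ≤ 2 * h → h ≤ length (filter (λ p → joined? C′ (proj₁ p) (proj₂ p)) ps)
        star-hits : ∀ {v qs} h → (v , qs) ∈ stars → Unique qs → v ∉ qs → (∀ {q} → q ∈ qs → edge v q ∈ U) →
          8 * h ≤ length qs → suc k₂ ≤ 2 * h → h ≤ length (filter (joined? C′ v) qs)

    stage : Forces StagePlayed R C
    stage = Forces-bind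
      (pool unique-R U unique-U U⊆R k₁ k₂ (map (map (uncurry edge)) bigs) (map (λ { (v , qs) → map (edge v) qs }) stars)
        (≤-trans (≤-reflexive (cong (_* (4 * suc (length U))) (length-map _ bigs))) few₁)
        (≤-trans (≤-reflexive (cong (_* (4 * suc (length U))) (length-map _ stars))) few₂))
      λ { {R′} {C′} (u , rest , mono , hit₁ , hit₂) → stop (record
        { unique-R′ = u ; untouched = rest ; C⊆C′ = mono
        ; big-hits = λ {ps} h ps∈ ups sub 8h≤ k≤ → ≤-trans
            (hit₁ h (∈-map⁺ (map (uncurry edge)) ps∈) ups
              (λ e∈ → case ∈-map⁻ (uncurry edge) e∈ of λ { ((x , y) , p∈ , refl) → sub p∈ })
              (≤-trans 8h≤ (≤-reflexive (sym (length-map (uncurry edge) ps)))) k≤)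
            (≤-reflexive (filter-map-length (_∈ᵉ? C′) (uncurry edge) ps))
        ; star-hits = λ {v} {qs} h s∈ uqs v∉ sub 8h≤ k≤ → ≤-trans
            (hit₂ h (∈-map⁺ (λ { (v , qs) → map (edge v) qs }) s∈)
              (Unique-map-on (λ {x} {y} x∈ y∈ eq → case edge-injective {v} {x} {v} {y} eq of λ { (inj₁ (_ , x≡y)) → x≡y ; (inj₂ (v≡y , x≡v)) → ≡-trans x≡v v≡y }) uqs)
              (λ e∈ → case ∈-map⁻ (edge v) e∈ of λ { (q , q∈ , refl) → sub q∈ })
              (≤-trans 8h≤ (≤-reflexive (sym (length-map (edge v) qs)))) k≤)
            (≤-reflexive (filter-map-length (_∈ᵉ? C′) (edge v) qs)) }) }

-- The three stages of the game

data Part : Set where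
  pA pB pS : Part

_≟ᵖ_ : DecidableEquality Part
pA ≟ᵖ pA = yes refl
pA ≟ᵖ pB = no λ ()
pA ≟ᵖ pS = no λ ()
pB ≟ᵖ pA = no λ ()
pB ≟ᵖ pB = yes refl
pB ≟ᵖ pS = no λ ()
pS ≟ᵖ pA = no λ ()
pS ≟ᵖ pB = no λ ()
pS ≟ᵖ pS = yes refl

side : Part → Bool
side pA = true
side pB = false
side pS = false

-- The sides are A and B ∪ S.  X ⊆ A and its partners in B are set aside for parents of postponed vertices and the children of
-- these; S is for the parents of the vertices that go to X, and Z ⊆ A is a reserve.
record Layout (n : ℕ) : Set where
  field
    part : Fin n → Part
    X Z S : List (Fin n)
    partner : Fin n → Fin n
    unique-X : Unique X
    unique-Z : Unique Z
    unique-S : Unique S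
    X⊆A : ∀ {x} → x ∈ X → part x ≡ pA
    Z⊆A : ∀ {z} → z ∈ Z → part z ≡ pA
    Z∉X : ∀ {z} → z ∈ Z → z ∉ X
    S⊆S : ∀ {s} → s ∈ S → part s ≡ pS
    S-complete : ∀ {s} → part s ≡ pS → s ∈ S
    partner-B : ∀ {x} → x ∈ X → part (partner x) ≡ pB
    partner-injective : ∀ {x y} → x ∈ X → y ∈ X → partner x ≡ partner y → x ≡ y

filter-both-≤ : {A : Set} {P Q S : Pred A 0ℓ} (P? : Decidable P) (Q? : Decidable Q) (S? : Decidable S) (xs : List A) →
  (∀ {x} → x ∈ xs → P x → Q x → S x) → length (filter P? (filter Q? xs)) ≤ length (filter S? xs)
filter-both-≤ P? Q? S? [] _ = z≤n
filter-both-≤ P? Q? S? (x ∷ xs) imp with ih ← filter-both-≤ P? Q? S? xs (imp ∘ there) | Q? x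
... | no _ = ≤-trans ih (filter-cons-≤ S? x xs)
... | yes q with P? x
...   | no _ = ≤-trans ih (filter-cons-≤ S? x xs)
...   | yes p = ≤-trans (s≤s ih) (≤-reflexive (sym (cong length (filter-accept S? (imp (here refl) p q)))))

cartesianProduct-map : {A B C : Set} (f : A → C) (xs : List A) (ys : List B) →
  cartesianProduct (map f xs) ys ≡ map (λ p → f (proj₁ p) , proj₂ p) (cartesianProduct xs ys)
cartesianProduct-map f [] ys = refl
cartesianProduct-map f (x ∷ xs) ys = ≡-trans (cong₂ _++_ (map-∘ ys) (cartesianProduct-map f xs ys)) (sym (map-++ _ (map (x ,_) ys) _))

module Pseudorandom {n : ℕ} (Λ : Layout n) (m ζ σ h : ℕ) where

  open Layout Λ

  V : Set
  V = Fin n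

  sideOf : V → Bool
  sideOf v = side (part v)

  joined-to-both? : ∀ C b → Decidable (λ x → Joined C b x × Joined C b (partner x))
  joined-to-both? C b x = joined? C b x ×-dec joined? C b (partner x)

  record Base (C : List (Edge n)) : Set where
    field
      joined : ∀ {xs qs} → Unique xs → Unique qs → length xs ≡ m → length qs ≡ m → (∀ {x} → x ∈ xs → x ∉ qs) →
        (∀ {x} → x ∈ xs → part x ≡ pA × x ∉ X) ⊎ (∀ {x} → x ∈ xs → part x ≡ pB) →
        ∀ b → (∀ {q} → q ∈ qs → sideOf q ≡ b) → ∃[ x ] ∃[ q ] x ∈ xs × q ∈ qs × Joined C x q
      pairs : ∀ {xys : List (V × V)} {qs} → length xys ≡ m → length qs ≡ m → Unique (map proj₁ xys) → Unique (map proj₂ xys) → Unique qs →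
        (∀ {x y} → (x , y) ∈ xys → part x ≡ pA × x ∉ X × part y ≡ pB × x ∉ qs × y ∉ qs) →
        ∀ b → (∀ {q} → q ∈ qs → sideOf q ≡ b) →
        ∃[ x ] ∃[ y ] ∃[ q ] (x , y) ∈ xys × q ∈ qs × Joined C x q × Joined C y q
      degree-Z : ∀ v → ζ ≤ length (filter (joined? C v) Z)
      codegree-Z : ∀ {x y} → part x ≡ pA → part y ≡ pB → ζ ≤ length (filter (λ z → joined? C x z ×-dec joined? C y z) Z)
      degree-S : ∀ {v} → (part v ≡ pA × v ∉ X) ⊎ part v ≡ pB → σ ≤ length (filter (joined? C v) S)
      both-X : ∀ {b} → part b ≢ pS → 8 * h ≤ length (filter (joined-to-both? C b) X)
      partner-X : ∀ {b} → part b ≡ pS → 64 * h ≤ length (filter (joined? C b ∘ partner) X)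

  Cover : List (Edge n) → V → V → Set
  Cover C u b = h ≤ length (filter (λ x → joined? C u x ×-dec joined-to-both? C b x) X)

  Base-mono : ∀ {C C′} → (∀ {e} → e ∈ C → e ∈ C′) → Base C → Base C′
  Base-mono {C} {C′} mono base = record
    { joined = λ ux uq lx lq disj px b qb → let x , q , x∈ , q∈ , j = joined ux uq lx lq disj px b qb in x , q , x∈ , q∈ , mono j
    ; pairs = λ lx lq u₁ u₂ uq px b qb → let x , y , q , p∈ , q∈ , j , j′ = pairs lx lq u₁ u₂ uq px b qb in x , y , q , p∈ , q∈ , mono j , mono j′
    ; degree-Z = λ v → ≤-trans (degree-Z v) (filter-length-mono (joined? C v) (joined? C′ v) Z (λ _ → mono))
    ; codegree-Z = λ {x} {y} px py → ≤-trans (codegree-Z px py)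
        (filter-length-mono (λ z → joined? C x z ×-dec joined? C y z) (λ z → joined? C′ x z ×-dec joined? C′ y z) Z (λ _ (j , j′) → mono j , mono j′))
    ; degree-S = λ {v} pv → ≤-trans (degree-S pv) (filter-length-mono (joined? C v) (joined? C′ v) S (λ _ → mono))
    ; both-X = λ {b} pb → ≤-trans (both-X pb) (filter-length-mono (joined-to-both? C b) (joined-to-both? C′ b) X (λ _ (j , j′) → mono j , mono j′))
    ; partner-X = λ {b} pb → ≤-trans (partner-X pb) (filter-length-mono (joined? C b ∘ partner) (joined? C′ b ∘ partner) X (λ _ → mono))
    }
    where open Base base

  Cover-mono : ∀ {C C′ u b} → (∀ {e} → e ∈ C → e ∈ C′) → Cover C u b → Cover C′ u b
  Cover-mono {C} {C′} {u} {b} mono cov = ≤-trans cov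
    (filter-length-mono (λ x → joined? C u x ×-dec joined-to-both? C b x) (λ x → joined? C′ u x ×-dec joined-to-both? C′ b x) X (λ _ (i , j , j′) → mono i , mono j , mono j′))

  Good : List (Edge n) → Set
  Good C = Base C × (∀ {u b} → part u ≡ pS → b ≢ u → Cover C u b)

record StageParameters (n : ℕ) : Set where
  field
    Λ : Layout n
    m c k₁ k₂ ζ σ h : ℕ
    few₁ : ((n * n) ^ m * n ^ m + n ^ m * n ^ m) * (4 * suc (n * n)) ≤ 2 ^ k₁
    few₂ : (4 * n + n * n) * (4 * suc (n * n)) ≤ 2 ^ k₂
    large-c : suc k₁ ≤ 2 * c
    large-h : suc k₂ ≤ 2 * h
    large-ζ : suc k₂ ≤ 2 * ζ
    large-σ : suc k₂ ≤ 2 * σ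
    m-c : 64 * c ≤ m * m
    X-h : suc (512 * h) ≤ length (Layout.X Λ)
    Z-ζ : suc (64 * ζ) ≤ length (Layout.Z Λ)
    S-σ : 8 * σ ≤ length (Layout.S Λ)

module Stages {n : ℕ} (parameters : StageParameters n) where

  open StageParameters parameters
  open Layout Λ
  open Pseudorandom Λ m ζ σ h

  V² : List V → List V → List (V × V)
  V² = cartesianProduct

  _-ᵛ_ : List V → V → List V
  xs -ᵛ v = filter (λ y → ¬? (y ≟ᶠ v)) xs

  ∈-ᵛ : ∀ {xs v y} → y ∈ xs -ᵛ v → y ∈ xs × y ≢ v
  ∈-ᵛ {xs} {v} = ∈-filter⁻ (λ y → ¬? (y ≟ᶠ v)) {xs = xs}

  length--ᵛ : ∀ {xs} {k} v → Unique xs → suc k ≤ length xs → k ≤ length (xs -ᵛ v)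
  length--ᵛ v u le = ≤-pred (≤-trans le (length-without _≟ᶠ_ v u))

  Inside Star Cut : Edge n → Set
  Inside (u , v) = sideOf u ≡ sideOf v
  Star (u , v) = (part u ≡ pS × v ∈ X) ⊎ (part v ≡ pS × u ∈ X)
  Cut e = ¬ Inside e × ¬ Star e

  open DecMem (_≟ᶠ_ {n}) using (_∈?_)

  inside? : Decidable Inside
  inside? (u , v) = sideOf u ≟ᵇ sideOf v

  star? : Decidable Star
  star? (u , v) = (part u ≟ᵖ pS ×-dec v ∈? X) ⊎-dec (part v ≟ᵖ pS ×-dec u ∈? X)

  cut? : Decidable Cut
  cut? e = ¬? (inside? e) ×-dec ¬? (star? e)

  U₁ U₂ : List (Edge n)
  U₁ = filter inside? (allEdges n)
  U₂ = filter cut? (allEdges n)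

  Symmetric : (Edge n → Set) → Set
  Symmetric P = ∀ {u v} → P (u , v) → P (v , u)

  along-edge : ∀ {P} → Symmetric P → ∀ {u v} → P (u , v) → P (edge u v)
  along-edge sy {u} {v} p with edge-cases u v
  ... | inj₁ eq rewrite eq = p
  ... | inj₂ eq rewrite eq = sy p

  from-edge : ∀ {P} → Symmetric P → ∀ {u v} → P (edge u v) → P (u , v)
  from-edge sy {u} {v} p with edge-cases u v
  ... | inj₁ eq rewrite eq = p
  ... | inj₂ eq rewrite eq = sy p

  Star-sym : Symmetric Star
  Star-sym (inj₁ p) = inj₂ p
  Star-sym (inj₂ p) = inj₁ p

  Cut-sym : Symmetric Cut
  Cut-sym (¬in , ¬st) = ¬in ∘ sym , ¬st ∘ Star-sym

  ∈U₁ : ∀ {u v} → u ≢ v → Inside (u , v) → edge u v ∈ U₁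
  ∈U₁ {u} {v} u≢v p = ∈-filter⁺ inside? (edge-∈-allEdges u≢v) (along-edge {Inside} sym {u} {v} p)

  ∈U₂ : ∀ {u v} → Cut (u , v) → edge u v ∈ U₂
  ∈U₂ {u} {v} p = ∈-filter⁺ cut? (edge-∈-allEdges (λ { refl → proj₁ p refl })) (along-edge {Cut} Cut-sym {u} {v} p)

  U₂-avoids-U₁ : ∀ {e} → e ∈ U₂ → e ∉ U₁
  U₂-avoids-U₁ e∈₂ e∈₁ = proj₁ (proj₂ (∈-filter⁻ cut? {xs = allEdges n} e∈₂)) (proj₂ (∈-filter⁻ inside? {xs = allEdges n} e∈₁))

  few-edges : ∀ k {U} {a N} → Unique U → (∀ {e} → e ∈ U → e ∈ allEdges n) → a ≤ N → N * (4 * suc (n * n)) ≤ 2 ^ k → a * (4 * suc (length U)) ≤ 2 ^ k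
  few-edges k u sub a≤N few = ≤-trans (*-mono-≤ a≤N (*-monoʳ-≤ 4 (s≤s (≤-trans (unique-⊆-length u sub) (length-allEdges {n}))))) few

  few-stars : ∀ {U} {a} → Unique U → (∀ {e} → e ∈ U → e ∈ allEdges n) → a ≤ 4 * n + n * n → a * (4 * suc (length U)) ≤ 2 ^ k₂
  few-stars u sub a≤ = few-edges k₂ u sub a≤ few₂

  all-V : List V
  all-V = allFin n

  avoiding : V → List V
  avoiding b = filter (λ x → ¬? (partner x ≟ᶠ b)) X

  length-avoiding : ∀ b → 512 * h ≤ length (avoiding b)
  length-avoiding b = ≤-pred (≤-trans X-h (≤-trans (length-without-map X unique-X (λ x∈ → partner-injective x∈)) ≤-refl))
    where
    length-without-map : ∀ xs → Unique xs → (∀ {x y} → x ∈ xs → y ∈ xs → partner x ≡ partner y → x ≡ y) →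
      length xs ≤ suc (length (filter (λ x → ¬? (partner x ≟ᶠ b)) xs))
    length-without-map xs u inj with any? (λ x → partner x ≟ᶠ b) xs
    ... | no none = m≤n⇒m≤1+n (unique-⊆-length u (λ x∈ → ∈-filter⁺ _ x∈ (λ eq → none (lose x∈ eq))))
    ... | yes some with x₀ , x₀∈ , refl ← find some = ≤-trans (length-without _≟ᶠ_ x₀ u)
          (s≤s (unique-⊆-length (filter⁺ _ u) (λ y∈ → let y∈xs , y≢ = ∈-ᵛ {xs} y∈ in ∈-filter⁺ _ y∈xs (λ eq → y≢ (inj y∈xs x₀∈ eq)))))

  big₁ : List (List (V × V))
  big₁ = cartesianProductWith V² (tuples all-V m) (tuples all-V m)

  stars₁ : List (V × List V)
  stars₁ = map (λ v → v , Z -ᵛ v) all-V ++ map (λ v → v , S) all-V ++ map (λ v → v , X -ᵛ v) all-V ++ map (λ v → v , map partner (avoiding v)) all-V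

  record Inner (C : List (Edge n)) : Set where
    field
      inner-joined : ∀ {xs qs} → Unique xs → Unique qs → length xs ≡ m → length qs ≡ m → (∀ {x} → x ∈ xs → x ∉ qs) →
        (∀ {x q} → x ∈ xs → q ∈ qs → sideOf x ≡ sideOf q) → 8 * c ≤ length (filter (λ p → joined? C (proj₁ p) (proj₂ p)) (V² xs qs))
      inner-Z : ∀ {v} → part v ≡ pA → 8 * ζ ≤ length (filter (joined? C v) (Z -ᵛ v))
      inner-S : ∀ {v} → part v ≡ pB → σ ≤ length (filter (joined? C v) S)
      inner-X : ∀ {b} → part b ≡ pA → 64 * h ≤ length (filter (joined? C b) (X -ᵛ b))
      inner-Y : ∀ {b} → sideOf b ≡ false → 64 * h ≤ length (filter (joined? C b ∘ partner) (avoiding b))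

  After : (Edge n → Set) → (List (Edge n) → Set) → List (Edge n) → List (Edge n) → Set
  After Left P R C = Unique R × (∀ {e} → e ∈ allEdges n → Left e → e ∈ R) × P C

  private
    n≤4n+n² : 4 * n ≤ 4 * n + n * n
    n≤4n+n² = m≤m+n (4 * n) (n * n)

    length-map-V : {B : Set} (f : V → B) → length (map f all-V) ≡ n
    length-map-V f = ≡-trans (length-map f all-V) (length-allFin n)

    scale : ∀ {k} a b → a ≤ b → suc k ≤ 2 * a → suc k ≤ 2 * b
    scale a b a≤b le = ≤-trans le (*-monoʳ-≤ 2 a≤b)

    x≤kx : ∀ x k → x ≤ suc k * x
    x≤kx x k = m≤m+n x (k * x)

  stage₁ : Forces (After (_∉ U₁) Inner) (allEdges n) []
  stage₁ = Forces-bind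
    (stage {C = []} Unique-allEdges U₁ unique-U₁ U₁⊆ k₁ k₂ big₁ stars₁
      (few-edges k₁ unique-U₁ U₁⊆ (≤-trans (≤-reflexive length-big₁) (m≤n+m _ ((n * n) ^ m * n ^ m))) few₁)
      (few-stars unique-U₁ U₁⊆ (≤-trans (≤-reflexive length-stars₁) n≤4n+n²)))
    λ {R′} {C′} st → let open StagePlayed st in stop
      ( unique-R′ , untouched
      , record
        { inner-joined = λ {xs} {qs} ux uq lx lq disj same → big-hits (8 * c)
            (∈-cartesianProductWith⁺ V² (∈-tuples-length xs lx (λ _ → ∈-allFin _)) (∈-tuples-length qs lq (λ _ → ∈-allFin _)))
            (Unique-product-edges ux uq disj)
            (λ p∈ → let x∈ , q∈ = ∈-cartesianProduct⁻ xs qs p∈ in ∈U₁ (λ { refl → disj x∈ q∈ }) (same x∈ q∈))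
            (≤-trans (≤-reflexive (sym (*-assoc 8 8 c))) (≤-trans m-c (≤-reflexive (sym (≡-trans (length-cartesianProductWith _,_ xs qs) (cong₂ _*_ lx lq))))))
            (scale c (8 * c) (x≤kx c 7) large-c)
        ; inner-Z = λ {v} pv → star-hits (8 * ζ) (∈-++⁺ˡ (∈-map⁺ (λ v → v , Z -ᵛ v) (∈-allFin v))) (filter⁺ _ unique-Z)
            (λ v∈ → proj₂ (∈-ᵛ {Z} v∈) refl)
            (λ q∈ → let q∈Z , q≢v = ∈-ᵛ {Z} q∈ in ∈U₁ (q≢v ∘ sym) (cong side (≡-trans pv (sym (Z⊆A q∈Z)))))
            (≤-trans (≤-reflexive (sym (*-assoc 8 8 ζ))) (length--ᵛ v unique-Z Z-ζ)) (scale ζ (8 * ζ) (x≤kx ζ 7) large-ζ)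
        ; inner-S = λ {v} pv → star-hits σ (∈-++⁺ʳ (map (λ v → v , Z -ᵛ v) all-V) (∈-++⁺ˡ (∈-map⁺ (λ v → v , S) (∈-allFin v)))) unique-S
            (λ v∈ → case ≡-trans (sym pv) (S⊆S v∈) of λ ())
            (λ {q} q∈ → ∈U₁ (λ { refl → case ≡-trans (sym pv) (S⊆S q∈) of λ () }) (≡-trans (cong side pv) (sym (cong side (S⊆S q∈)))))
            S-σ large-σ
        ; inner-X = λ {v} pv → star-hits (64 * h) (∈-++⁺ʳ (map (λ v → v , Z -ᵛ v) all-V) (∈-++⁺ʳ (map (λ v → v , S) all-V) (∈-++⁺ˡ (∈-map⁺ (λ v → v , X -ᵛ v) (∈-allFin v))))) (filter⁺ _ unique-X)
            (λ v∈ → proj₂ (∈-ᵛ {X} v∈) refl)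
            (λ q∈ → let q∈X , q≢v = ∈-ᵛ {X} q∈ in ∈U₁ (q≢v ∘ sym) (cong side (≡-trans pv (sym (X⊆A q∈X)))))
            (≤-trans (≤-reflexive (sym (*-assoc 8 64 h))) (length--ᵛ v unique-X X-h)) (scale h (64 * h) (x≤kx h 63) large-h)
        ; inner-Y = λ {v} pv → ≤-trans (star-hits (64 * h)
            (∈-++⁺ʳ (map (λ v → v , Z -ᵛ v) all-V) (∈-++⁺ʳ (map (λ v → v , S) all-V) (∈-++⁺ʳ (map (λ v → v , X -ᵛ v) all-V) (∈-map⁺ (λ v → v , map partner (avoiding v)) (∈-allFin v)))))
            (Unique-map-on (λ x∈ y∈ → partner-injective (proj₁ (∈-avoiding v x∈)) (proj₁ (∈-avoiding v y∈))) (filter⁺ _ unique-X))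
            (λ v∈ → case ∈-map⁻ partner v∈ of λ { (x , x∈ , refl) → proj₂ (∈-avoiding v x∈) refl })
            (λ q∈ → case ∈-map⁻ partner q∈ of λ { (x , x∈ , refl) → let x∈X , ≢v = ∈-avoiding v x∈ in ∈U₁ (≢v ∘ sym) (≡-trans pv (sym (cong side (partner-B x∈X)))) })
            (≤-trans (≤-reflexive (sym (*-assoc 8 64 h))) (≤-trans (length-avoiding v) (≤-reflexive (sym (length-map partner (avoiding v)))))) (scale h (64 * h) (x≤kx h 63) large-h))
            (≤-reflexive (filter-map-length (joined? C′ v) partner (avoiding v)))
        } )
    where
    unique-U₁ : Unique U₁
    unique-U₁ = filter⁺ inside? Unique-allEdges
    U₁⊆ : ∀ {e} → e ∈ U₁ → e ∈ allEdges n
    U₁⊆ e∈ = proj₁ (∈-filter⁻ inside? e∈)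
    ∈-avoiding : ∀ b {x} → x ∈ avoiding b → x ∈ X × partner x ≢ b
    ∈-avoiding b = ∈-filter⁻ (λ x → ¬? (partner x ≟ᶠ b)) {xs = X}
    length-big₁ : length big₁ ≡ n ^ m * n ^ m
    length-big₁ = ≡-trans (length-cartesianProductWith V² (tuples all-V m) (tuples all-V m))
      (cong₂ _*_ count count)
      where
      count : length (tuples all-V m) ≡ n ^ m
      count = ≡-trans (length-tuples all-V m) (cong (_^ m) (length-allFin n))
    length-stars₁ : length stars₁ ≡ 4 * n
    length-stars₁ = ≡-trans (length-++ (map (λ v → v , Z -ᵛ v) all-V)) (cong₂ _+_ (length-map-V _)
      (≡-trans (length-++ (map (λ v → v , S) all-V)) (cong₂ _+_ (length-map-V _)
      (≡-trans (length-++ (map (λ v → v , X -ᵛ v) all-V)) (cong₂ _+_ (length-map-V _) (≡-trans (length-map-V _) (sym (+-identityʳ n))))))))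

  cut-product : ∀ (C : List (Edge n)) (xys : List (V × V)) (qs : List V) → List ((V × V) × V)
  cut-product C xys qs = filter (λ p → joined? C (proj₁ (proj₁ p)) (proj₂ p)) (cartesianProduct xys qs)

  second : (V × V) × V → V × V
  second ((x , y) , q) = y , q

  big₂ : List (Edge n) → List (List (V × V))
  big₂ C = cartesianProductWith (λ xys qs → map second (cut-product C xys qs)) (tuples (cartesianProduct all-V all-V) m) (tuples all-V m)
    ++ cartesianProductWith V² (tuples all-V m) (tuples all-V m)

  common : List (Edge n) → V → V → List V
  common C x y = filter (joined? C x) (Z -ᵛ x)

  stars₂ : List (Edge n) → List (V × List V)
  stars₂ C = map (λ v → v , Z) all-V ++ map (λ v → v , S) all-V
    ++ map (λ b → b , map partner (filter (joined? C b) (X -ᵛ b))) all-V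
    ++ map (λ b → b , filter (joined? C b ∘ partner) (avoiding b)) all-V
    ++ map (λ p → proj₂ p , common C (proj₁ p) (proj₂ p)) (cartesianProduct all-V all-V)

  c>0 : 1 ≤ c
  c>0 = positive c large-c
    where
    positive : ∀ c → suc k₁ ≤ 2 * c → 1 ≤ c
    positive (suc _) _ = s≤s z≤n

  stage₂ : ∀ {R C} → After (_∉ U₁) Inner R C → Forces (After (λ e → e ∉ U₁ × e ∉ U₂) Base) R C
  stage₂ {R} {C} (unique-R , left , inner) = Forces-bind
    (stage {C = C} unique-R U₂ unique-U₂ (λ e∈ → left (U₂⊆ e∈) (U₂-avoids-U₁ e∈)) k₁ k₂ (big₂ C) (stars₂ C)
      (few-edges k₁ unique-U₂ U₂⊆ (≤-reflexive length-big₂) few₁)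
      (few-stars unique-U₂ U₂⊆ (≤-reflexive length-stars₂)))
    λ {R′} {C′} st → let open StagePlayed st in stop
      ( unique-R′ , (λ e∈ (e∉₁ , e∉₂) → untouched (left e∈ e∉₁) e∉₂) , base C⊆C′ big-hits star-hits )
    where
    open Inner inner
    unique-U₂ : Unique U₂
    unique-U₂ = filter⁺ cut? Unique-allEdges
    U₂⊆ : ∀ {e} → e ∈ U₂ → e ∈ allEdges n
    U₂⊆ e∈ = proj₁ (∈-filter⁻ cut? e∈)
    length-all² : length (cartesianProduct all-V all-V) ≡ n * n
    length-all² = ≡-trans (length-cartesianProductWith _,_ all-V all-V) (cong₂ _*_ (length-allFin n) (length-allFin n))
    length-tuples-V : length (tuples all-V m) ≡ n ^ m
    length-tuples-V = ≡-trans (length-tuples all-V m) (cong (_^ m) (length-allFin n))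
    length-big₂ : length (big₂ C) ≡ (n * n) ^ m * n ^ m + n ^ m * n ^ m
    length-big₂ = ≡-trans (length-++ (cartesianProductWith (λ xys qs → map second (cut-product C xys qs)) (tuples (cartesianProduct all-V all-V) m) (tuples all-V m)))
      (cong₂ _+_
        (≡-trans (length-cartesianProductWith (λ xys qs → map second (cut-product C xys qs)) (tuples (cartesianProduct all-V all-V) m) (tuples all-V m))
          (cong₂ _*_ (≡-trans (length-tuples (cartesianProduct all-V all-V) m) (cong (_^ m) length-all²)) length-tuples-V))
        (≡-trans (length-cartesianProductWith V² (tuples all-V m) (tuples all-V m)) (cong₂ _*_ length-tuples-V length-tuples-V)))
    star-Z = map (λ v → v , Z) all-V
    star-S = map (λ v → v , S) all-V
    star-A = map (λ b → b , map partner (filter (joined? C b) (X -ᵛ b))) all-V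
    star-B = map (λ b → b , filter (joined? C b ∘ partner) (avoiding b)) all-V
    star-C = map (λ p → proj₂ p , common C (proj₁ p) (proj₂ p)) (cartesianProduct all-V all-V)
    length-stars₂ : length (stars₂ C) ≡ 4 * n + n * n
    length-stars₂ = ≡-trans (length-++ star-Z) (≡-trans (cong₂ _+_ (length-map-V _)
      (≡-trans (length-++ star-S) (cong₂ _+_ (length-map-V _)
      (≡-trans (length-++ star-A) (cong₂ _+_ (length-map-V _)
      (≡-trans (length-++ star-B) (cong₂ _+_ (length-map-V _) (≡-trans (length-map _ (cartesianProduct all-V all-V)) length-all²))))))))
      (solve 2 (λ a b → a :+ (a :+ (a :+ (a :+ b))) := con 4 :* a :+ b) refl n (n * n)))
      where open +-*-Solver

    module _ {C′} (mono : ∀ {e} → e ∈ C → e ∈ C′)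
      (big-hits : ∀ {ps} h → ps ∈ big₂ C → Unique (map (uncurry edge) ps) → (∀ {x y} → (x , y) ∈ ps → edge x y ∈ U₂) →
          8 * h ≤ length ps → suc k₁ ≤ 2 * h → h ≤ length (filter (λ p → joined? C′ (proj₁ p) (proj₂ p)) ps))
      (star-hits : ∀ {v qs} h → (v , qs) ∈ stars₂ C → Unique qs → v ∉ qs → (∀ {q} → q ∈ qs → edge v q ∈ U₂) →
          8 * h ≤ length qs → suc k₂ ≤ 2 * h → h ≤ length (filter (joined? C′ v) qs)) where

      private
        opposite : ∀ {a b} → a ≡ true → b ≡ false → a ≢ b
        opposite refl refl ()

        c-size : 8 * c ≤ m * m
        c-size = ≤-trans (*-monoˡ-≤ c (m≤m+n 8 56)) m-c

      some-pair : ∀ {xs qs} → length xs ≡ m → length qs ≡ m → Unique xs → Unique qs → (∀ {x} → x ∈ xs → x ∉ qs) →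
        (∀ {x q} → x ∈ xs → q ∈ qs → Cut (x , q)) → ∃[ x ] ∃[ q ] x ∈ xs × q ∈ qs × Joined C′ x q
      some-pair {xs} {qs} lx lq ux uq disj cut with
        nonempty-member {xs = filter (λ p → joined? C′ (proj₁ p) (proj₂ p)) (V² xs qs)} (≤-trans c>0 (big-hits c
            (∈-++⁺ʳ (cartesianProductWith (λ xys qs → map second (cut-product C xys qs)) (tuples (cartesianProduct all-V all-V) m) (tuples all-V m))
              (∈-cartesianProductWith⁺ V² (∈-tuples-length xs lx (λ _ → ∈-allFin _)) (∈-tuples-length qs lq (λ _ → ∈-allFin _))))
            (Unique-product-edges ux uq disj)
            (λ p∈ → let x∈ , q∈ = ∈-cartesianProduct⁻ xs qs p∈ in ∈U₂ (cut x∈ q∈))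
            (≤-trans c-size (≤-reflexive (sym (≡-trans (length-cartesianProductWith _,_ xs qs) (cong₂ _*_ lx lq)))))
            large-c))
      ... | (x , q) , p∈ with p∈V² , j ← ∈-filter⁻ (λ p → joined? C′ (proj₁ p) (proj₂ p)) {xs = V² xs qs} p∈
        with x∈ , q∈ ← ∈-cartesianProduct⁻ xs qs p∈V² = x , q , x∈ , q∈ , j

      some-inner-pair : ∀ {xs qs} → length xs ≡ m → length qs ≡ m → Unique xs → Unique qs → (∀ {x} → x ∈ xs → x ∉ qs) →
        (∀ {x q} → x ∈ xs → q ∈ qs → sideOf x ≡ sideOf q) → ∃[ x ] ∃[ q ] x ∈ xs × q ∈ qs × Joined C′ x q
      some-inner-pair {xs} {qs} lx lq ux uq disj same with
        nonempty-member {xs = filter (λ p → joined? C (proj₁ p) (proj₂ p)) (V² xs qs)} (≤-trans c>0 (≤-trans (x≤kx c 7) (inner-joined ux uq lx lq disj same)))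
      ... | (x , q) , p∈ with p∈V² , j ← ∈-filter⁻ (λ p → joined? C (proj₁ p) (proj₂ p)) {xs = V² xs qs} p∈
        with x∈ , q∈ ← ∈-cartesianProduct⁻ xs qs p∈V² = x , q , x∈ , q∈ , mono j

      module _ {xys : List (V × V)} {qs : List V} (lx : length xys ≡ m) (lq : length qs ≡ m)
        (u₁ : Unique (map proj₁ xys)) (u₂ : Unique (map proj₂ xys)) (uq : Unique qs)
        (disj : ∀ {x y} → (x , y) ∈ xys → x ∉ qs × y ∉ qs)
        (geo : ∀ {x y q} → (x , y) ∈ xys → q ∈ qs → sideOf x ≡ sideOf q × Cut (y , q)) where

        private
          member : ∀ {x y q} → ((x , y) , q) ∈ cut-product C xys qs → (x , y) ∈ xys × q ∈ qs × Joined C x q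
          member t∈ with t∈p , j ← ∈-filter⁻ (λ p → joined? C (proj₁ (proj₁ p)) (proj₂ p)) {xs = cartesianProduct xys qs} t∈
            with xy∈ , q∈ ← ∈-cartesianProduct⁻ xys qs t∈p = xy∈ , q∈ , j

          inj : ∀ {t t′} → t ∈ cut-product C xys qs → t′ ∈ cut-product C xys qs → uncurry edge (second t) ≡ uncurry edge (second t′) → t ≡ t′
          inj {(x , y) , q} {(x′ , y′) , q′} t∈ t′∈ eq with edge-injective eq | member t∈ | member t′∈
          ... | inj₁ (refl , refl) | xy∈ , _ | xy′∈ , _ with refl ← Unique-map-injective u₂ xy∈ xy′∈ refl = refl
          inj {(x , y) , q} {(x′ , y′) , q′} t∈ t′∈ eq | inj₂ (refl , _) | xy∈ , _ | _ , q′∈ , _ = contradiction q′∈ (proj₂ (disj xy∈))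

          inner-size : 8 * c ≤ length (cut-product C xys qs)
          inner-size = ≤-trans (≤-trans (inner-joined u₁ uq (≡-trans (length-map proj₁ xys) lx) lq
              (λ x∈ → case ∈-map⁻ proj₁ x∈ of λ { (_ , xy∈ , refl) → proj₁ (disj xy∈) })
              (λ x∈ q∈ → case ∈-map⁻ proj₁ x∈ of λ { (_ , xy∈ , refl) → proj₁ (geo xy∈ q∈) }))
            (≤-reflexive (cong (λ l → length (filter (λ p → joined? C (proj₁ p) (proj₂ p)) l)) (cartesianProduct-map proj₁ xys qs))))
            (≤-reflexive (filter-map-length (λ p → joined? C (proj₁ p) (proj₂ p)) (λ p → proj₁ (proj₁ p) , proj₂ p) (cartesianProduct xys qs)))

          unique-offers : Unique (map (uncurry edge) (map second (cut-product C xys qs)))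
          unique-offers = subst Unique (map-∘ (cut-product C xys qs))
            (Unique-map-on {f = λ t → uncurry edge (second t)} inj (filter⁺ _ (cartesianProduct⁺ (Unique-map⁻ u₁) uq)))

          offers-cut : ∀ {y q} → (y , q) ∈ map second (cut-product C xys qs) → edge y q ∈ U₂
          offers-cut p∈ with ((x , y) , q) , t∈ , refl ← ∈-map⁻ second p∈ =
            let xy∈ , q∈ , _ = member t∈ in ∈U₂ (proj₂ (geo xy∈ q∈))

        some-triple : ∃[ x ] ∃[ y ] ∃[ q ] (x , y) ∈ xys × q ∈ qs × Joined C′ x q × Joined C′ y q
        some-triple with nonempty-member {xs = filter (λ p → joined? C′ (proj₁ p) (proj₂ p)) (map second (cut-product C xys qs))} (≤-trans c>0 (big-hits c
            (∈-++⁺ˡ (∈-cartesianProductWith⁺ (λ xys qs → map second (cut-product C xys qs))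
              (∈-tuples-length xys lx (λ _ → ∈-cartesianProduct⁺ (∈-allFin _) (∈-allFin _))) (∈-tuples-length qs lq (λ _ → ∈-allFin _))))
            unique-offers offers-cut
            (≤-trans inner-size (≤-reflexive (sym (length-map second (cut-product C xys qs)))))
            large-c))
        ... | _ , p∈ with p∈offers , j ← ∈-filter⁻ (λ p → joined? C′ (proj₁ p) (proj₂ p)) {xs = map second (cut-product C xys qs)} p∈
          with ((x , y) , q) , t∈ , refl ← ∈-map⁻ second p∈offers =
            let xy∈ , q∈ , i = member t∈ in x , y , q , xy∈ , q∈ , mono i , j

      private
        cut-A : ∀ {u v} → part u ≡ pA → u ∉ X → sideOf v ≡ false → Cut (u , v)
        cut-A pu u∉ sv = opposite (cong side pu) sv
          , λ { (inj₁ (pu′ , _)) → case ≡-trans (sym pu) pu′ of λ () ; (inj₂ (_ , u∈)) → u∉ u∈ }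

        cut-B : ∀ {u v} → part u ≡ pB → sideOf v ≡ true → Cut (u , v)
        cut-B pu sv = (λ eq → opposite sv (cong side pu) (sym eq))
          , λ { (inj₁ (pu′ , _)) → case ≡-trans (sym pu) pu′ of λ () ; (inj₂ (pv , _)) → case ≡-trans (sym sv) (cong side pv) of λ () }

      base : Base C′
      base = record
        { joined = λ { ux uq lx lq disj (inj₁ pA∖X) true qb → some-inner-pair lx lq ux uq disj (λ x∈ q∈ → ≡-trans (cong side (proj₁ (pA∖X x∈))) (sym (qb q∈)))
                     ; ux uq lx lq disj (inj₁ pA∖X) false qb → some-pair lx lq ux uq disj (λ x∈ q∈ → cut-A (proj₁ (pA∖X x∈)) (proj₂ (pA∖X x∈)) (qb q∈))
                     ; ux uq lx lq disj (inj₂ pBs) true qb → some-pair lx lq ux uq disj (λ x∈ q∈ → cut-B (pBs x∈) (qb q∈))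
                     ; ux uq lx lq disj (inj₂ pBs) false qb → some-inner-pair lx lq ux uq disj (λ x∈ q∈ → ≡-trans (cong side (pBs x∈)) (sym (qb q∈))) }
        ; pairs = λ { lx lq u₁ u₂ uq geo true qb → some-triple lx lq u₁ u₂ uq
                        (λ p∈ → let _ , _ , _ , x∉ , y∉ = geo p∈ in x∉ , y∉)
                        (λ p∈ q∈ → let px , _ , py , _ = geo p∈ in ≡-trans (cong side px) (sym (qb q∈)) , cut-B py (qb q∈))
                    ; {xys} lx lq u₁ u₂ uq geo false qb →
                        let flip : V × V → V × V
                            flip = λ p → proj₂ p , proj₁ p
                            y , x , q , p∈ , q∈ , j , j′ = some-triple {map flip xys}
                              (≡-trans (length-map flip xys) lx) lq (subst Unique (map-∘ xys) u₂) (subst Unique (map-∘ xys) u₁) uq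
                              (λ p∈ → case ∈-map⁻ flip p∈ of λ { (_ , p∈′ , refl) → let _ , _ , _ , x∉ , y∉ = geo p∈′ in y∉ , x∉ })
                              (λ p∈ q∈ → case ∈-map⁻ flip p∈ of λ { (_ , p∈′ , refl) → let px , x∉ , py , _ = geo p∈′ in ≡-trans (cong side py) (sym (qb q∈)) , cut-A px x∉ (qb q∈) })
                        in x , y , q , (case ∈-map⁻ flip p∈ of λ { (_ , p∈′ , refl) → p∈′ }) , q∈ , j′ , j }
        ; degree-Z = λ v → degree-Z v (part v) refl
        ; codegree-Z = λ {x} {y} px py → ≤-trans
            (star-hits ζ (∈-++⁺ʳ star-Z (∈-++⁺ʳ star-S (∈-++⁺ʳ star-A (∈-++⁺ʳ star-B (∈-map⁺ (λ p → proj₂ p , common C (proj₁ p) (proj₂ p)) (∈-cartesianProduct⁺ (∈-allFin x) (∈-allFin y)))))))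
              (filter⁺ _ (filter⁺ _ unique-Z))
              (λ y∈ → case ≡-trans (sym py) (Z⊆A (common⊆Z {x} {y} y∈)) of λ ())
              (λ q∈ → ∈U₂ (cut-B py (cong side (Z⊆A (common⊆Z {x} {y} q∈)))))
              (inner-Z px) large-ζ)
            (≤-trans (filter-both-≤ (joined? C′ y) (joined? C x) (λ z → joined? C′ x z ×-dec joined? C′ y z) (Z -ᵛ x) (λ _ j i → mono i , j))
              (filter-filter-length (λ z → joined? C′ x z ×-dec joined? C′ y z) (λ z → ¬? (z ≟ᶠ x)) Z))
        ; degree-S = λ { {v} (inj₁ (pv , v∉)) → star-hits σ (∈-++⁺ʳ star-Z (∈-++⁺ˡ (∈-map⁺ (λ v → v , S) (∈-allFin v)))) unique-S
                           (λ v∈ → case ≡-trans (sym pv) (S⊆S v∈) of λ ())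
                           (λ s∈ → ∈U₂ (cut-A pv v∉ (cong side (S⊆S s∈)))) S-σ large-σ
                       ; {v} (inj₂ pv) → ≤-trans (inner-S pv) (filter-length-mono (joined? C v) (joined? C′ v) S (λ _ → mono)) }
        ; both-X = λ {b} pb → both-X b (part b) refl pb
        ; partner-X = λ {b} pb → ≤-trans (inner-Y (cong side pb)) (≤-trans
            (filter-filter-length (joined? C b ∘ partner) (λ x → ¬? (partner x ≟ᶠ b)) X)
            (filter-length-mono (joined? C b ∘ partner) (joined? C′ b ∘ partner) X (λ _ → mono)))
        }
        where
        common⊆Z : ∀ {x y z} → z ∈ common C x y → z ∈ Z
        common⊆Z {x} z∈ = proj₁ (∈-ᵛ {Z} (proj₁ (∈-filter⁻ (joined? C x) {xs = Z -ᵛ x} z∈)))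
        Z-size : 8 * ζ ≤ length Z
        Z-size = ≤-trans (*-monoˡ-≤ ζ (m≤m+n 8 56)) (≤-trans (n≤1+n _) Z-ζ)
        degree-Z : ∀ v p → part v ≡ p → ζ ≤ length (filter (joined? C′ v) Z)
        degree-Z v pA pv = ≤-trans (x≤kx ζ 7) (≤-trans (inner-Z pv) (≤-trans
          (filter-filter-length (joined? C v) (λ y → ¬? (y ≟ᶠ v)) Z) (filter-length-mono (joined? C v) (joined? C′ v) Z (λ _ → mono))))
        degree-Z v pB pv = star-hits ζ (∈-++⁺ˡ (∈-map⁺ (λ v → v , Z) (∈-allFin v))) unique-Z
          (λ v∈ → case ≡-trans (sym pv) (Z⊆A v∈) of λ ())
          (λ z∈ → ∈U₂ (cut-B pv (cong side (Z⊆A z∈)))) Z-size large-ζ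
        degree-Z v pS pv = star-hits ζ (∈-++⁺ˡ (∈-map⁺ (λ v → v , Z) (∈-allFin v))) unique-Z
          (λ v∈ → case ≡-trans (sym pv) (Z⊆A v∈) of λ ())
          (λ z∈ → ∈U₂ (opposite (cong side (Z⊆A z∈)) (cong side pv) ∘ sym
            , λ { (inj₁ (_ , z∈X)) → Z∉X z∈ z∈X ; (inj₂ (pz , _)) → case ≡-trans (sym (Z⊆A z∈)) pz of λ () })) Z-size large-ζ
        both-X : ∀ b p → part b ≡ p → p ≢ pS → 8 * h ≤ length (filter (joined-to-both? C′ b) X)
        both-X b pS _ ≢S = contradiction refl ≢S
        both-X b pA pb _ = ≤-trans
          (≤-trans (star-hits (8 * h) (∈-++⁺ʳ star-Z (∈-++⁺ʳ star-S (∈-++⁺ˡ (∈-map⁺ (λ b → b , map partner (filter (joined? C b) (X -ᵛ b))) (∈-allFin b)))))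
              (Unique-map-on (λ x∈ y∈ → partner-injective (in-X x∈) (in-X y∈)) (filter⁺ _ (filter⁺ _ unique-X)))
              (λ b∈ → case ∈-map⁻ partner b∈ of λ { (x , x∈ , refl) → case ≡-trans (sym pb) (partner-B (in-X x∈)) of λ () })
              (λ q∈ → case ∈-map⁻ partner q∈ of λ { (x , x∈ , refl) → subst (_∈ U₂) (edge-sym (partner x) b) (∈U₂ (cut-B (partner-B (in-X x∈)) (cong side pb))) })
              (≤-trans (≤-trans (≤-reflexive (sym (*-assoc 8 8 h))) (inner-X pb)) (≤-reflexive (sym (length-map partner (filter (joined? C b) (X -ᵛ b))))))
              (scale h (8 * h) (x≤kx h 7) large-h))
            (≤-reflexive (filter-map-length (joined? C′ b) partner (filter (joined? C b) (X -ᵛ b)))))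
          (≤-trans (filter-both-≤ (joined? C′ b ∘ partner) (joined? C b) (joined-to-both? C′ b) (X -ᵛ b) (λ _ j i → mono i , j))
            (filter-filter-length (joined-to-both? C′ b) (λ x → ¬? (x ≟ᶠ b)) X))
          where
          in-X : ∀ {x} → x ∈ filter (joined? C b) (X -ᵛ b) → x ∈ X
          in-X x∈ = proj₁ (∈-ᵛ {X} (proj₁ (∈-filter⁻ (joined? C b) {xs = X -ᵛ b} x∈)))
        both-X b pB pb _ = ≤-trans
          (star-hits (8 * h) (∈-++⁺ʳ star-Z (∈-++⁺ʳ star-S (∈-++⁺ʳ star-A (∈-++⁺ˡ (∈-map⁺ (λ b → b , filter (joined? C b ∘ partner) (avoiding b)) (∈-allFin b))))))
            (filter⁺ _ (filter⁺ _ unique-X))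
            (λ b∈ → case ≡-trans (sym pb) (X⊆A (in-X b∈)) of λ ())
            (λ q∈ → ∈U₂ (cut-B pb (cong side (X⊆A (in-X q∈)))))
            (≤-trans (≤-reflexive (sym (*-assoc 8 8 h))) (inner-Y (cong side pb)))
            (scale h (8 * h) (x≤kx h 7) large-h))
          (≤-trans (filter-both-≤ (joined? C′ b) (joined? C b ∘ partner) (joined-to-both? C′ b) (avoiding b) (λ _ j i → j , mono i))
            (filter-filter-length (joined-to-both? C′ b) (λ x → ¬? (partner x ≟ᶠ b)) X))
          where
          in-X : ∀ {x} → x ∈ filter (joined? C b ∘ partner) (avoiding b) → x ∈ X
          in-X x∈ = proj₁ (∈-filter⁻ (λ x → ¬? (partner x ≟ᶠ b)) {xs = X} (proj₁ (∈-filter⁻ (joined? C b ∘ partner) {xs = avoiding b} x∈)))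

  stars₃ : V → List (Edge n) → List (V × List V)
  stars₃ s C = map (λ b → s , filter (joined? C b ∘ partner) X) all-V
    ++ map (λ b → s , filter (joined-to-both? C b) X) all-V
    ++ map (λ b → s , filter (λ x → joined? C b x ×-dec joined? C s (partner x)) X) all-V

  record Covered (old : List V) (C : List (Edge n)) : Set where
    field
      base : Base C
      done-partner : ∀ {u b} → u ∈ old → part b ≡ pS → 8 * h ≤ length (filter (λ x → joined? C u x ×-dec joined? C b (partner x)) X)
      done-cover : ∀ {u b} → u ∈ old → b ≢ u → part b ≢ pS ⊎ b ∈ old → Cover C u b

  star-of : V → List (Edge n)
  star-of s = map (edge s) X

  -- Client's choices at the stars S – X interact: Cover u b needs both u x and b x.  Hence the stars are played one at a time.
  stage₃ : ∀ todo old {R C} → Unique todo → (∀ {s} → s ∈ todo → part s ≡ pS × s ∉ old) → (∀ {s} → s ∈ old → part s ≡ pS) → Unique R →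
    (∀ {s x} → s ∈ todo → x ∈ X → edge s x ∈ R) → (∀ {s x} → part s ≡ pS → x ∈ X → edge s x ∈ allEdges n) → Covered old C →
    Forces (λ _ C′ → ∃[ old′ ] (∀ {s} → s ∈ todo ⊎ s ∈ old → s ∈ old′) × Covered old′ C′) R C
  stage₃ [] old _ _ _ _ _ _ cov = stop (old , (λ { (inj₂ s∈) → s∈ }) , cov)
  stage₃ (s ∷ todo) old {R} {C} u-todo todo-S done-S unique-R left all-edges cov = Forces-bind
    (stage {C = C} unique-R (star-of s) unique-star (λ e∈ → case ∈-map⁻ (edge s) e∈ of λ { (x , x∈ , refl) → left (here refl) x∈ })
      k₁ k₂ [] (stars₃ s C) z≤n
      (few-stars unique-star (λ e∈ → case ∈-map⁻ (edge s) e∈ of λ { (x , x∈ , refl) → all-edges s-S x∈ }) (≤-trans (≤-reflexive length-stars₃) (≤-trans (*-monoˡ-≤ n (m≤m+n 3 1)) n≤4n+n²))))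
    λ {R′} {C′} st → let open StagePlayed st in Forces-bind
      (stage₃ todo (s ∷ old) {R′} {C′} (Unique-tail u-todo)
        (λ t∈ → proj₁ (todo-S (there t∈)) , λ { (here refl) → Unique-head u-todo t∈ ; (there t∈old) → proj₂ (todo-S (there t∈)) t∈old })
        (λ { (here refl) → s-S ; (there t∈) → done-S t∈ })
        unique-R′
        (λ {t} {x} t∈ x∈ → untouched (left (there t∈) x∈) (other-star (λ { refl → Unique-head u-todo t∈ }) (proj₁ (todo-S (there t∈))) x∈))
        all-edges (covered C⊆C′ star-hits))
      (λ (old′ , sub , cov′) → stop (old′ , (λ { (inj₁ (here refl)) → sub (inj₂ (here refl)) ; (inj₁ (there t∈)) → sub (inj₁ t∈) ; (inj₂ t∈) → sub (inj₂ (there t∈)) }) , cov′))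
    where
    open Covered cov
    open Base base
    s-S : part s ≡ pS
    s-S = proj₁ (todo-S (here refl))
    unique-star : Unique (star-of s)
    unique-star = Unique-map-on (λ {x} {y} x∈ y∈ eq → case edge-injective {u = s} {x} {s} {y} eq of λ { (inj₁ (_ , x≡y)) → x≡y ; (inj₂ (refl , refl)) → refl }) unique-X
    other-star : ∀ {t x} → t ≢ s → part t ≡ pS → x ∈ X → edge t x ∉ star-of s
    other-star t≢s t-S x∈ e∈ with y , y∈ , eq ← ∈-map⁻ (edge s) e∈ with edge-injective eq
    ... | inj₁ (refl , _) = t≢s refl
    ... | inj₂ (refl , _) = case ≡-trans (sym t-S) (X⊆A y∈) of λ ()
    length-stars₃ : length (stars₃ s C) ≡ 3 * n
    length-stars₃ = ≡-trans (length-++ (map (λ b → s , filter (joined? C b ∘ partner) X) all-V)) (cong₂ _+_ (length-map-V _)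
      (≡-trans (length-++ (map (λ b → s , filter (joined-to-both? C b) X) all-V)) (cong₂ _+_ (length-map-V _) (≡-trans (length-map-V _) (sym (+-identityʳ n))))))

    module _ {C′} (mono : ∀ {e} → e ∈ C → e ∈ C′)
      (star-hits : ∀ {v qs} h → (v , qs) ∈ stars₃ s C → Unique qs → v ∉ qs → (∀ {q} → q ∈ qs → edge v q ∈ star-of s) →
          8 * h ≤ length qs → suc k₂ ≤ 2 * h → h ≤ length (filter (joined? C′ v) qs)) where

      hit-filtered : ∀ {P : Pred V 0ℓ} (P? : Decidable P) g → (s , filter P? X) ∈ stars₃ s C → 8 * g ≤ length (filter P? X) → suc k₂ ≤ 2 * g →
        g ≤ length (filter (joined? C′ s) (filter P? X))
      hit-filtered P? g s∈ = star-hits g s∈ (filter⁺ P? unique-X)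
        (λ s∈ → case ≡-trans (sym s-S) (X⊆A (proj₁ (∈-filter⁻ P? {xs = X} s∈))) of λ ())
        (λ q∈ → ∈-map⁺ (edge s) (proj₁ (∈-filter⁻ P? {xs = X} q∈)))

      new-partner : ∀ {b} → part b ≡ pS → 8 * h ≤ length (filter (λ x → joined? C′ s x ×-dec joined? C′ b (partner x)) X)
      new-partner {b} pb = ≤-trans
        (hit-filtered (joined? C b ∘ partner) (8 * h) (∈-++⁺ˡ (∈-map⁺ (λ b → s , filter (joined? C b ∘ partner) X) (∈-allFin b)))
          (≤-trans (≤-reflexive (sym (*-assoc 8 8 h))) (partner-X pb)) (scale h (8 * h) (x≤kx h 7) large-h))
        (filter-both-≤ (joined? C′ s) (joined? C b ∘ partner) (λ x → joined? C′ s x ×-dec joined? C′ b (partner x)) X (λ _ j i → j , mono i))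

      both-done : ∀ {b} → part b ≢ pS ⊎ b ∈ old → 8 * h ≤ length (filter (joined-to-both? C b) X)
      both-done (inj₁ pb) = both-X pb
      both-done (inj₂ b∈) = done-partner b∈ (done-S b∈)

      cover-from-s : ∀ {b} → part b ≢ pS ⊎ b ∈ old → Cover C′ s b
      cover-from-s {b} b-ok = ≤-trans
        (hit-filtered (joined-to-both? C b) h
          (∈-++⁺ʳ (map (λ b → s , filter (joined? C b ∘ partner) X) all-V) (∈-++⁺ˡ (∈-map⁺ (λ b → s , filter (joined-to-both? C b) X) (∈-allFin b))))
          (both-done b-ok) large-h)
        (filter-both-≤ (joined? C′ s) (joined-to-both? C b) (λ x → joined? C′ s x ×-dec joined-to-both? C′ b x) X (λ _ j (i , i′) → j , mono i , mono i′))

      cover-of-s : ∀ {u} → u ∈ old → Cover C′ u s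
      cover-of-s {u} u∈ = ≤-trans
        (hit-filtered (λ x → joined? C u x ×-dec joined? C s (partner x)) h
          (∈-++⁺ʳ (map (λ b → s , filter (joined? C b ∘ partner) X) all-V) (∈-++⁺ʳ (map (λ b → s , filter (joined-to-both? C b) X) all-V)
            (∈-map⁺ (λ b → s , filter (λ x → joined? C b x ×-dec joined? C s (partner x)) X) (∈-allFin u))))
          (done-partner u∈ s-S) large-h)
        (filter-both-≤ (joined? C′ s) (λ x → joined? C u x ×-dec joined? C s (partner x)) (λ x → joined? C′ u x ×-dec joined-to-both? C′ s x) X
          (λ _ j (i , i′) → mono i , j , mono i′))

      covered : Covered (s ∷ old) C′
      covered = record
        { base = Base-mono mono base
        ; done-partner = λ { (here refl) pb → new-partner pb
                           ; {u} {b} (there u∈) pb → ≤-trans (done-partner u∈ pb)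
                               (filter-length-mono (λ x → joined? C u x ×-dec joined? C b (partner x)) (λ x → joined? C′ u x ×-dec joined? C′ b (partner x)) X (λ _ (i , j) → mono i , mono j)) }
        ; done-cover = λ { (here refl) b≢ (inj₁ pb) → cover-from-s (inj₁ pb)
                         ; (here refl) b≢ (inj₂ (here refl)) → contradiction refl b≢
                         ; (here refl) b≢ (inj₂ (there b∈)) → cover-from-s (inj₂ b∈)
                         ; (there u∈) b≢ (inj₁ pb) → Cover-mono mono (done-cover u∈ b≢ (inj₁ pb))
                         ; (there u∈) b≢ (inj₂ (here refl)) → cover-of-s u∈
                         ; (there u∈) b≢ (inj₂ (there b∈)) → Cover-mono mono (done-cover u∈ b≢ (inj₂ b∈)) } }

  Waiter-forces-good : Forces (λ _ → Good) (allEdges n) []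
  Waiter-forces-good = Forces-bind stage₁ λ after₁ → Forces-bind (stage₂ after₁) λ (unique-R , left , base) → Forces-bind
    (stage₃ S [] unique-S (λ s∈ → S⊆S s∈ , λ ()) (λ ()) unique-R
      (λ {s} {x} s∈ x∈ → left (star-edge (S⊆S s∈) x∈)
        ( (λ e∈ → case ≡-trans (≡-trans (sym (cong side (S⊆S s∈))) (from-edge {Inside} sym {s} {x} (proj₂ (∈-filter⁻ inside? {xs = allEdges n} e∈)))) (cong side (X⊆A x∈)) of λ ())
        , (λ e∈ → proj₂ (from-edge {Cut} Cut-sym {s} {x} (proj₂ (∈-filter⁻ cut? {xs = allEdges n} e∈))) (inj₁ (S⊆S s∈ , x∈))) ))
      star-edge
      (record { base = base ; done-partner = λ () ; done-cover = λ () }))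
    λ (old , sub , cov) → let open Covered cov in stop
      ( Covered.base cov , λ {u} {b} pu b≢u → done-cover (sub (inj₁ (S-complete pu))) b≢u (case part b ≟ᵖ pS of λ { (yes pb) → inj₂ (sub (inj₁ (S-complete pb))) ; (no pb) → inj₁ pb }) )
    where
    star-edge : ∀ {s x} → part s ≡ pS → x ∈ X → edge s x ∈ allEdges n
    star-edge ps x∈ = edge-∈-allEdges (λ { refl → case ≡-trans (sym ps) (X⊆A x∈) of λ () })

-- Rooted trees

-- Colours are depths modulo 4, shifted so that the postponed vertices get c0.
data Colour : Set where
  c0 c1 c2 c3 : Colour

next : Colour → Colour
next c0 = c1
next c1 = c2
next c2 = c3
next c3 = c0

_≟ᶜ_ : DecidableEquality Colour
c0 ≟ᶜ c0 = yes refl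
c0 ≟ᶜ c1 = no λ ()
c0 ≟ᶜ c2 = no λ ()
c0 ≟ᶜ c3 = no λ ()
c1 ≟ᶜ c0 = no λ ()
c1 ≟ᶜ c1 = yes refl
c1 ≟ᶜ c2 = no λ ()
c1 ≟ᶜ c3 = no λ ()
c2 ≟ᶜ c0 = no λ ()
c2 ≟ᶜ c1 = no λ ()
c2 ≟ᶜ c2 = yes refl
c2 ≟ᶜ c3 = no λ ()
c3 ≟ᶜ c0 = no λ ()
c3 ≟ᶜ c1 = no λ ()
c3 ≟ᶜ c2 = no λ ()
c3 ≟ᶜ c3 = yes refl

module _ {V : Set} (par : V → Maybe V) where

  data Ordered : List V → Set where
    [] : Ordered []
    insert : ∀ {v vs} → v ∉ vs → (∀ {u} → par v ≡ just u → u ∈ vs) → Ordered vs → Ordered (v ∷ vs)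

Ordered-cong : ∀ {V : Set} {par par′ : V → Maybe V} {vs} → (∀ {v} → v ∈ vs → par v ≡ par′ v) → Ordered par vs → Ordered par′ vs
Ordered-cong _ [] = []
Ordered-cong eq (insert v∉ p ord) = insert v∉ (λ q → p (≡-trans (eq (here refl)) q)) (Ordered-cong (eq ∘ there) ord)

module Trees {n : ℕ} (T : Graph n) where

  V : Set
  V = Fin n

  open DecMem (_≟ᶠ_ {n}) using (_∈?_)

  record Rooted (vs : List V) : Set where
    field
      par : V → Maybe V
      col : V → Colour
      ordered : Ordered par vs
      par-adj : ∀ {u v} → v ∈ vs → par v ≡ just u → Adj T v u
      col-par : ∀ {u v} → v ∈ vs → par v ≡ just u → col v ≡ next (col u)
      edge-par : ∀ {u v} → u ∈ vs → v ∈ vs → Adj T u v → par u ≡ just v ⊎ par v ≡ just u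
      root-unique : ∀ {u v} → u ∈ vs → v ∈ vs → par u ≡ nothing → par v ≡ nothing → u ≡ v

  module _ (simple : IsSimple T) (connected : Connected T) (acyclic : ¬ HasCycle T) where

    Adj-sym : ∀ {u v} → Adj T u v → Adj T v u
    Adj-sym {u} {v} = ≡-trans (proj₁ simple v u)

    data Path : V → V → List V → Set where
      [_]ᵖ : ∀ a → Path a a [ a ]
      _∷ᵖ_ : ∀ {a b c l} → Adj T a c → Path c b l → Path a b (a ∷ l)

    Path-snoc : ∀ {a b c l} → Path a b l → Adj T b c → Path a c (l ∷ʳ c)
    Path-snoc [ a ]ᵖ bc = bc ∷ᵖ [ _ ]ᵖ
    Path-snoc (ad ∷ᵖ p) bc = ad ∷ᵖ Path-snoc p bc

    Path-Linked : ∀ {u a b c l} → Adj T u a → Path a b l → Adj T b c → Linked (Adj T) (u ∷ (l ∷ʳ c))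
    Path-Linked ua [ a ]ᵖ bc = ua ∷ (bc ∷ [-])
    Path-Linked ua (ad ∷ᵖ p) bc = ua ∷ Path-Linked ad p bc

    Path-length : ∀ {a b l} → a ≢ b → Path a b l → 2 ≤ length l
    Path-length a≢b [ a ]ᵖ = contradiction refl a≢b
    Path-length a≢b (_ ∷ᵖ [ _ ]ᵖ) = s≤s (s≤s z≤n)
    Path-length a≢b (_ ∷ᵖ (_ ∷ᵖ _)) = s≤s (s≤s z≤n)

    Linking : List V → Set
    Linking vs = ∀ {a b} → a ∈ vs → b ∈ vs → ∃[ l ] Path a b l × Unique l × (∀ {x} → x ∈ l → x ∈ vs)

    module _ {vs} (R : Rooted vs) (linking : Linking vs) {v u} (v∉ : v ∉ vs) (u∈ : u ∈ vs) (vu : Adj T v u) where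
      open Rooted R

      only-parent : ∀ {w} → w ∈ vs → Adj T v w → w ≡ u
      only-parent {w} w∈ vw with w ≟ᶠ u
      ... | yes eq = eq
      ... | no w≢u with l , p , ul , l⊆ ← linking w∈ u∈ =
        contradiction (v , l , s≤s (Path-length w≢u p) , Unique-cons (v∉ ∘ l⊆) ul , Path-Linked vw p (Adj-sym vu)) acyclic

      extend-linking : Linking (v ∷ vs)
      extend-linking (here refl) (here refl) = [ v ] , [ v ]ᵖ , [] ∷ [] , λ { (here eq) → here eq }
      extend-linking (here refl) (there b∈) with l , p , ul , l⊆ ← linking u∈ b∈ =
        v ∷ l , vu ∷ᵖ p , Unique-cons (v∉ ∘ l⊆) ul , λ { (here eq) → here eq ; (there x∈) → there (l⊆ x∈) }
      extend-linking (there a∈) (here refl) with l , p , ul , l⊆ ← linking a∈ u∈ =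
        l ∷ʳ v , Path-snoc p (Adj-sym vu) , Unique-resp-↭ (∷↭∷ʳ v l) (Unique-cons (v∉ ∘ l⊆) ul)
        , λ x∈ → case ∈-++⁻ l x∈ of λ { (inj₁ x∈l) → there (l⊆ x∈l) ; (inj₂ (here eq)) → here eq }
      extend-linking (there a∈) (there b∈) with l , p , ul , l⊆ ← linking a∈ b∈ = l , p , ul , there ∘ l⊆

      private
        update : {B : Set} → (V → B) → B → V → B
        update f b w = if does (w ≟ᶠ v) then b else f w

        update-old : ∀ {B : Set} (f : V → B) b {w} → w ∈ vs → update f b w ≡ f w
        update-old f b {w} w∈ with w ≟ᶠ v
        ... | yes refl = contradiction w∈ v∉
        ... | no _ = refl

        update-new : ∀ {B : Set} (f : V → B) b → update f b v ≡ b
        update-new f b with v ≟ᶠ v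
        ... | yes _ = refl
        ... | no v≢v = contradiction refl v≢v

        par′ = update par (just u)
        col′ = update col (next (col u))

        ∈-parent : ∀ {vs w x} → Ordered par vs → w ∈ vs → par w ≡ just x → x ∈ vs
        ∈-parent (insert _ p ord) (here refl) eq = there (p eq)
        ∈-parent (insert _ p ord) (there w∈) eq = there (∈-parent ord w∈ eq)

      extend : Rooted (v ∷ vs)
      extend = record
        { par = par′ ; col = col′
        ; ordered = insert v∉ (λ eq → subst (_∈ vs) (just-injective (≡-trans (sym (update-new par (just u))) eq)) u∈)
            (Ordered-cong (λ w∈ → sym (update-old par (just u) w∈)) ordered)
        ; par-adj = λ { (here refl) eq → subst (Adj T v) (just-injective (≡-trans (sym (update-new par (just u))) eq)) vu
                      ; (there w∈) eq → par-adj w∈ (≡-trans (sym (update-old par (just u) w∈)) eq) }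
        ; col-par = λ { {x} (here refl) eq → case just-injective (≡-trans (sym (update-new par (just u))) eq) of λ { refl →
                          ≡-trans (update-new col _) (cong next (sym (update-old col _ u∈))) }
                      ; (there w∈) eq → let eq′ = ≡-trans (sym (update-old par (just u) w∈)) eq in
                          ≡-trans (update-old col _ w∈) (≡-trans (col-par w∈ eq′) (cong next (sym (update-old col _ (∈-parent ordered w∈ eq′))))) }
        ; edge-par = λ { (here refl) (here refl) vv → contradiction vv (proj₂ simple v)
                       ; (here refl) (there w∈) vw → inj₁ (≡-trans (update-new par _) (cong just (sym (only-parent w∈ vw))))
                       ; (there w∈) (here refl) wv → inj₂ (≡-trans (update-new par _) (cong just (sym (only-parent w∈ (Adj-sym wv)))))
                       ; (there w∈) (there x∈) wx → case edge-par w∈ x∈ wx of λ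
                           { (inj₁ eq) → inj₁ (≡-trans (update-old par _ w∈) eq) ; (inj₂ eq) → inj₂ (≡-trans (update-old par _ x∈) eq) } }
        ; root-unique = λ { (here refl) (here refl) _ _ → refl
                          ; (here refl) (there _) eq _ → case ≡-trans (sym eq) (update-new par _) of λ ()
                          ; (there _) (here refl) _ eq → case ≡-trans (sym eq) (update-new par _) of λ ()
                          ; (there w∈) (there x∈) eq eq′ → root-unique w∈ x∈ (≡-trans (sym (update-old par _ w∈)) eq) (≡-trans (sym (update-old par _ x∈)) eq′) } }

    crossing : ∀ {vs a b} → Walk T a b → a ∈ vs → b ∉ vs → ∃[ x ] ∃[ y ] x ∈ vs × y ∉ vs × Adj T x y
    crossing here a∈ b∉ = contradiction a∈ b∉
    crossing {vs} (step {w = w} aw walk) a∈ b∉ with w ∈? vs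
    ... | yes w∈ = crossing walk w∈ b∉
    ... | no w∉ = _ , w , a∈ , w∉ , aw

    Ordered-Unique : ∀ {par : V → Maybe V} {vs} → Ordered par vs → Unique vs
    Ordered-Unique [] = []
    Ordered-Unique (insert v∉ _ ord) = Unique-cons v∉ (Ordered-Unique ord)

    grow : ∀ fuel {r vs} → r ∈ vs → Rooted vs → Linking vs → n ≤ length vs + fuel → ∃[ ws ] Rooted ws × (∀ v → v ∈ ws)
    grow fuel {r} {vs} r∈ R linking le with any? (λ v → ¬? (v ∈? vs)) (allFin n)
    ... | no none = vs , R , visited
      where
      visited : ∀ v → v ∈ vs
      visited v with v ∈? vs
      ... | yes v∈ = v∈
      ... | no v∉ = contradiction (lose (∈-allFin v) v∉) none
    ... | yes some with v , _ , v∉ ← find some with x , y , x∈ , y∉ , xy ← crossing (connected r v) r∈ v∉ with fuel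
    ...   | zero = contradiction (≤-trans (unique-⊆-length (Unique-cons y∉ (Ordered-Unique (Rooted.ordered R))) (λ _ → ∈-allFin _)) (≤-reflexive (length-allFin n)))
              (<⇒≱ (s≤s (≤-trans le (≤-reflexive (+-identityʳ _)))))
    ...   | suc fuel′ = grow fuel′ (there r∈) (extend R linking y∉ x∈ (Adj-sym xy)) (extend-linking R linking y∉ x∈ (Adj-sym xy)) (≤-trans le (≤-reflexive (+-suc _ fuel′)))

    rooted : V → ∃[ vs ] Rooted vs × (∀ v → v ∈ vs)
    rooted r = grow n (here refl) start (λ { (here refl) (here refl) → [ r ] , [ r ]ᵖ , [] ∷ [] , id }) (m≤n+m n 1)
      where
      start : Rooted [ r ]
      start = record
        { par = λ _ → nothing ; col = λ _ → c0 ; ordered = insert (λ ()) (λ ()) []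
        ; par-adj = λ _ () ; col-par = λ _ ()
        ; edge-par = λ { (here refl) (here refl) rr → contradiction rr (proj₂ simple r) }
        ; root-unique = λ { (here refl) (here refl) _ _ → refl } }

length-fibres : {A B : Set} (_≟_ : DecidableEquality B) (f : A → B) {bs : List B} {xs : List A} → Unique bs → Unique xs →
  (Σ[ bs ] λ b → length (filter (λ x → f x ≟ b) xs)) ≤ length xs
length-fibres _≟_ f {[]} _ _ = z≤n
length-fibres {A} {B} _≟_ f {b ∷ bs} {xs} ub ux = begin
  length (filter (λ x → f x ≟ b) xs) + (Σ[ bs ] λ b → length (filter (λ x → f x ≟ b) xs))
    ≤⟨ +-monoʳ-≤ (length (filter (λ x → f x ≟ b) xs)) (other-fibres bs (Unique-head ub)) ⟩
  length (filter (λ x → f x ≟ b) xs) + (Σ[ bs ] λ b′ → length (filter (λ x → f x ≟ b′) (filter (λ x → ¬? (f x ≟ b)) xs)))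
    ≤⟨ +-monoʳ-≤ (length (filter (λ x → f x ≟ b) xs)) (length-fibres _≟_ f (Unique-tail ub) (filter⁺ _ ux)) ⟩
  length (filter (λ x → f x ≟ b) xs) + length (filter (λ x → ¬? (f x ≟ b)) xs) ≡⟨ length-filter-split (λ x → f x ≟ b) xs ⟩
  length xs ∎
  where
  open ≤-Reasoning
  other-fibres : ∀ bs → b ∉ bs → (Σ[ bs ] λ b → length (filter (λ x → f x ≟ b) xs)) ≤ (Σ[ bs ] λ b′ → length (filter (λ x → f x ≟ b′) (filter (λ x → ¬? (f x ≟ b)) xs)))
  other-fibres [] _ = z≤n
  other-fibres (b′ ∷ bs) b∉ = +-mono-≤
    (unique-⊆-length (filter⁺ _ ux) (λ x∈ → let x∈xs , eq = ∈-filter⁻ (λ x → f x ≟ b′) {xs = xs} x∈ in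
      ∈-filter⁺ _ (∈-filter⁺ _ x∈xs (λ eq′ → b∉ (here (≡-trans (sym eq′) eq)))) eq))
    (other-fibres bs (b∉ ∘ there))

Σ-lower : {A : Set} (k : ℕ) (f : A → ℕ) (xs : List A) → (∀ {x} → x ∈ xs → k ≤ f x) → length xs * k ≤ Σ[ xs ] f
Σ-lower k f [] _ = z≤n
Σ-lower k f (x ∷ xs) le = +-mono-≤ (le (here refl)) (Σ-lower k f xs (le ∘ there))

record RootedTree {n : ℕ} (T : Graph n) (D λₗ : ℕ) : Set where
  field
    par : Fin n → Maybe (Fin n)
    col : Fin n → Colour
    order : List (Fin n)
    ordered : Ordered par order
    complete : ∀ v → v ∈ order
    col-par : ∀ {u v} → par v ≡ just u → col v ≡ next (col u)
    edge-par : ∀ {u v} → Adj T u v → par u ≡ just v ⊎ par v ≡ just u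

  children : Fin n → List (Fin n)
  children u = filter (λ v → Maybe-≡-dec _≟ᶠ_ (par v) (just u)) (allFin n)

  field
    few-children : ∀ u → length (children u) ≤ D
    L : List (Fin n)
    unique-L : Unique L
    length-L : length L ≡ λₗ
    L-colour : ∀ {t} → t ∈ L → col t ≡ c0
    L-child : ∀ {t} → t ∈ L → length (children t) ≤ 1
    L-parent : ∀ {t} → t ∈ L → ∃[ p ] ∃[ u ] par t ≡ just p × par p ≡ just u

shiftᶜ : Colour → Colour → Colour
shiftᶜ c0 c = c
shiftᶜ c1 c = next (next (next c))
shiftᶜ c2 c = next (next c)
shiftᶜ c3 c = next c

shiftᶜ-next : ∀ i c → shiftᶜ i (next c) ≡ next (shiftᶜ i c)
shiftᶜ-next c0 c = refl
shiftᶜ-next c1 c = refl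
shiftᶜ-next c2 c = refl
shiftᶜ-next c3 c = refl

shiftᶜ-self : ∀ i → shiftᶜ i i ≡ c0
shiftᶜ-self c0 = refl
shiftᶜ-self c1 = refl
shiftᶜ-self c2 = refl
shiftᶜ-self c3 = refl

colours : List Colour
colours = c0 ∷ c1 ∷ c2 ∷ c3 ∷ []

pigeonhole-colour : {A : Set} (col : A → Colour) (xs : List A) (k : ℕ) → 4 * k ≤ length xs → ∃[ i ] k ≤ length (filter (λ x → col x ≟ᶜ i) xs)
pigeonhole-colour col xs k le with any? (λ i → k ≤? length (filter (λ x → col x ≟ᶜ i) xs)) colours
... | yes found with i , _ , le′ ← find found = i , le′
pigeonhole-colour col xs k le | no none = ⊥-elim (<⇒≱ (≤-trans (s≤s (sizes xs)) four-small) le)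
  where
  size : Colour → List _ → ℕ
  size i xs = length (filter (λ x → col x ≟ᶜ i) xs)
  small : ∀ {i} → i ∈ colours → suc (size i xs) ≤ k
  small i∈ = ≰⇒> (λ k≤ → none (lose i∈ k≤))
  sizes : ∀ xs → length xs ≤ size c0 xs + size c1 xs + size c2 xs + size c3 xs
  sizes [] = z≤n
  sizes (x ∷ xs) with col x
  ... | c0 = s≤s (sizes xs)
  ... | c1 = ≤-trans (s≤s (sizes xs)) (≤-reflexive (solve 4 (λ a b c d → con 1 :+ (a :+ b :+ c :+ d) := a :+ (con 1 :+ b) :+ c :+ d) refl (size c0 xs) (size c1 xs) (size c2 xs) (size c3 xs)))
    where open +-*-Solver
  ... | c2 = ≤-trans (s≤s (sizes xs)) (≤-reflexive (solve 4 (λ a b c d → con 1 :+ (a :+ b :+ c :+ d) := a :+ b :+ (con 1 :+ c) :+ d) refl (size c0 xs) (size c1 xs) (size c2 xs) (size c3 xs)))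
    where open +-*-Solver
  ... | c3 = ≤-trans (s≤s (sizes xs)) (≤-reflexive (solve 4 (λ a b c d → con 1 :+ (a :+ b :+ c :+ d) := a :+ b :+ c :+ (con 1 :+ d)) refl (size c0 xs) (size c1 xs) (size c2 xs) (size c3 xs)))
    where open +-*-Solver
  four-small : suc (size c0 xs + size c1 xs + size c2 xs + size c3 xs) ≤ 4 * k
  four-small = ≤-trans (+-mono-≤ (+-mono-≤ (+-mono-≤ (small (here refl)) (<⇒≤ (small (there (here refl))))) (<⇒≤ (small (there (there (here refl)))))) (<⇒≤ (small (there (there (there (here refl)))))))
    (≤-reflexive (solve 1 (λ k → k :+ k :+ k :+ k := con 4 :* k) refl k))
    where open +-*-Solver

module _ {n D λₗ : ℕ} (T : Graph n) (simple : IsSimple T) {vs : List (Fin n)} (R : Trees.Rooted T vs) (complete : ∀ v → v ∈ vs)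
  (deg≤ : ∀ v → degree T v ≤ D) (size : 8 * λₗ + 2 * suc D ≤ n) where

  open Trees.Rooted R

  private
    V = Fin n

    kids : V → List V
    kids u = filter (λ v → Maybe-≡-dec _≟ᶠ_ (par v) (just u)) (allFin n)

    kid-parent : ∀ {u v} → v ∈ kids u → par v ≡ just u
    kid-parent {u} v∈ = proj₂ (∈-filter⁻ (λ v → Maybe-≡-dec _≟ᶠ_ (par v) (just u)) {xs = allFin n} v∈)

    ∈-kids : ∀ {u v} → par v ≡ just u → v ∈ kids u
    ∈-kids {u} {v} = ∈-filter⁺ (λ v → Maybe-≡-dec _≟ᶠ_ (par v) (just u)) (∈-allFin v)

    kids≤D : ∀ u → length (kids u) ≤ D
    kids≤D u = ≤-trans (unique-⊆-length (filter⁺ (λ v → Maybe-≡-dec _≟ᶠ_ (par v) (just u)) (allFin⁺ n)) adjacent) (deg≤ u)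
      where
      adjacent : ∀ {v} → v ∈ kids u → v ∈ filterᵇ (T u) (allFin n)
      adjacent {v} v∈ = ∈-filter⁺ (T? ∘ T u) (∈-allFin v) (subst IsTrue (sym (≡-trans (proj₁ simple u v) (par-adj (complete v) (kid-parent v∈)))) tt)

    few? : Decidable (λ v → length (kids v) ≤ 1)
    few? v = length (kids v) ≤? 1

    few many : List V
    few = filter few? (allFin n)
    many = filter (¬? ∘ few?) (allFin n)

    n≤2few : n ≤ 2 * length few
    n≤2few = +-cancelʳ-≤ n n (2 * length few) (begin
      n + n ≡⟨ cong (λ k → k + k) (sym (≡-trans (length-filter-split few? (allFin n)) (length-allFin n))) ⟩
      (length few + length many) + (length few + length many) ≡⟨ solve 2 (λ a b → (a :+ b) :+ (a :+ b) := con 2 :* a :+ b :* con 2) refl (length few) (length many) ⟩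
      2 * length few + length many * 2 ≤⟨ +-monoʳ-≤ (2 * length few) (Σ-lower 2 (λ v → length (kids v)) many (λ v∈ → ≰⇒> (proj₂ (∈-filter⁻ (¬? ∘ few?) {xs = allFin n} v∈)))) ⟩
      2 * length few + (Σ[ many ] λ v → length (kids v)) ≤⟨ +-monoʳ-≤ (2 * length few)
        (≤-trans (Σ-just many) (length-fibres (Maybe-≡-dec _≟ᶠ_) par {map just many} {allFin n} (map⁺ just-injective (filter⁺ (¬? ∘ few?) (allFin⁺ n))) (allFin⁺ n))) ⟩
      2 * length few + length (allFin n) ≡⟨ cong (2 * length few +_) (length-allFin n) ⟩
      2 * length few + n ∎)
      where
      open ≤-Reasoning
      open +-*-Solver
      Σ-just : ∀ us → (Σ[ us ] λ v → length (kids v)) ≤ (Σ[ map just us ] λ b → length (filter (λ x → Maybe-≡-dec _≟ᶠ_ (par x) b) (allFin n)))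
      Σ-just [] = z≤n
      Σ-just (u ∷ us) = +-monoʳ-≤ (length (kids u)) (Σ-just us)

    GrandParent : V → Set
    GrandParent t = ∃[ p ] ∃[ u ] par t ≡ just p × par p ≡ just u

    grandparent? : Decidable GrandParent
    grandparent? t with par t in eq
    ... | nothing = no λ { (_ , _ , () , _) }
    ... | just p with par p in eq′
    ...   | nothing = no λ { (_ , _ , refl , eq″) → case ≡-trans (sym eq′) eq″ of λ () }
    ...   | just u = yes (p , u , refl , eq′)

    good : List V
    good = filter grandparent? few

    rest-bound : length few ≤ length good + suc D
    rest-bound = ≤-trans (≤-reflexive (sym (length-filter-split grandparent? few))) (+-monoʳ-≤ (length good) bad-bound)
      where
      bad : List V
      bad = filter (¬? ∘ grandparent?) few
      unique-bad : Unique bad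
      unique-bad = filter⁺ (¬? ∘ grandparent?) (filter⁺ few? (allFin⁺ n))
      bad-bound : length bad ≤ suc D
      bad-bound with any? (λ v → Maybe-≡-dec _≟ᶠ_ (par v) nothing) vs
      ... | yes has-root with r , r∈ , root ← find has-root = ≤-trans (unique-⊆-length unique-bad near-root) (s≤s (kids≤D r))
        where
        near-root : ∀ {t} → t ∈ bad → t ∈ r ∷ kids r
        near-root {t} t∈ with par t in eq
        ... | nothing = here (root-unique (complete t) r∈ eq root)
        ... | just p with par p in eq′
        ...   | nothing with refl ← root-unique (complete p) r∈ eq′ root = there (∈-kids eq)
        ...   | just u = contradiction (p , u , eq , eq′) (proj₂ (∈-filter⁻ (¬? ∘ grandparent?) {xs = few} t∈))
      ... | no no-root = ≤-trans (unique-⊆-length {ys = []} unique-bad none) z≤n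
        where
        none : ∀ {t} → t ∈ bad → t ∈ []
        none {t} t∈ with par t in eq
        ... | nothing = contradiction (lose (complete t) eq) no-root
        ... | just p with par p in eq′
        ...   | nothing = contradiction (lose (complete p) eq′) no-root
        ...   | just u = contradiction (p , u , eq , eq′) (proj₂ (∈-filter⁻ (¬? ∘ grandparent?) {xs = few} t∈))

    good-size : 4 * λₗ ≤ length good
    good-size = *-cancelˡ-≤ 2 (+-cancelʳ-≤ (2 * suc D) (2 * (4 * λₗ)) (2 * length good) (begin
      2 * (4 * λₗ) + 2 * suc D ≡⟨ cong (_+ 2 * suc D) (sym (*-assoc 2 4 λₗ)) ⟩
      8 * λₗ + 2 * suc D ≤⟨ size ⟩
      n ≤⟨ n≤2few ⟩
      2 * length few ≤⟨ *-monoʳ-≤ 2 rest-bound ⟩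
      2 * (length good + suc D) ≡⟨ *-distribˡ-+ 2 (length good) (suc D) ⟩
      2 * length good + 2 * suc D ∎))
      where open ≤-Reasoning

  module _ (i : Colour) (class-size : λₗ ≤ length (filter (λ x → col x ≟ᶜ i) good)) where

    private
      chosen : List V
      chosen = take λₗ (filter (λ x → col x ≟ᶜ i) good)

      ∈-good : ∀ {t} → t ∈ chosen → t ∈ good
      ∈-good t∈ = proj₁ (∈-filter⁻ (λ x → col x ≟ᶜ i) {xs = good} (∈-take λₗ t∈))

      colour : ∀ {t} → t ∈ chosen → col t ≡ i
      colour t∈ = proj₂ (∈-filter⁻ (λ x → col x ≟ᶜ i) {xs = good} (∈-take λₗ t∈))

    select : RootedTree T D λₗ
    select = record
      { par = par ; col = shiftᶜ i ∘ col ; order = vs ; ordered = ordered ; complete = complete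
      ; col-par = λ {u} {v} eq → ≡-trans (cong (shiftᶜ i) (col-par (complete v) eq)) (shiftᶜ-next i (col u))
      ; edge-par = λ {u} {v} → edge-par (complete u) (complete v)
      ; few-children = kids≤D
      ; L = chosen
      ; unique-L = take⁺ λₗ (filter⁺ (λ x → col x ≟ᶜ i) (filter⁺ grandparent? (filter⁺ few? (allFin⁺ n))))
      ; length-L = length-take-≤ λₗ class-size
      ; L-colour = λ t∈ → ≡-trans (cong (shiftᶜ i) (colour t∈)) (shiftᶜ-self i)
      ; L-child = λ t∈ → proj₂ (∈-filter⁻ few? {xs = allFin n} (proj₁ (∈-filter⁻ grandparent? {xs = few} (∈-good t∈))))
      ; L-parent = λ t∈ → proj₂ (∈-filter⁻ grandparent? {xs = few} (∈-good t∈)) }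

  select-leaves : RootedTree T D λₗ
  select-leaves = uncurry select (pigeonhole-colour col good λₗ good-size)

rooted-tree : ∀ {n D λₗ} (T : Graph n) → IsTree T → 1 ≤ n → (∀ v → degree T v ≤ D) → 8 * λₗ + 2 * suc D ≤ n → RootedTree T D λₗ
rooted-tree T (simple , connected , acyclic) n>0 deg≤ size with vs , R , complete ← Trees.rooted T simple connected acyclic (fromℕ< n>0) =
  select-leaves T simple R complete deg≤ size

-- Matching by short augmenting paths

module _ {A B : Set} (_≟₁_ : DecidableEquality A) (_≟₂_ : DecidableEquality B) {H : A → B → Set} (H? : ∀ a b → Dec (H a b))
  {L : List A} {R : List B} (unique-L : Unique L) (unique-R : Unique R) (a b : ℕ)
  (degree-L : ∀ {t} → t ∈ L → a ≤ length (filter (H? t) R))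
  (degree-R : ∀ {v} → v ∈ R → b ≤ length (filter (λ t → H? t v) L))
  (linked : ∀ {X Y} → Unique X → Unique Y → (∀ {t} → t ∈ X → t ∈ L) → (∀ {v} → v ∈ Y → v ∈ R) → a ≤ length X → b ≤ length Y →
    ∃[ t ] ∃[ v ] t ∈ X × v ∈ Y × H t v) where

  private
    _≟₁₂_ : DecidableEquality (A × B)
    _≟₁₂_ = ×-≡-dec _≟₁_ _≟₂_

    two-out : ∀ {M : List (A × B)} {p q} → p ∈ M → q ∈ M → p ≢ q → ∃[ M′ ] M ↭ p ∷ q ∷ M′
    two-out p∈ q∈ p≢q with M₁ , M↭ ← ∈⇒↭ p∈ with M₂ , M₁↭ ← ∈⇒↭ (∈-∷⁻ (∈-resp-↭ M↭ q∈) (p≢q ∘ sym)) = M₂ , ↭-trans M↭ (prep _ M₁↭)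

    drop-right : ∀ {C : Set} (xs : List C) {ys} → Unique (xs ++ ys) → Unique xs
    drop-right [] _ = []
    drop-right (x ∷ xs) u = Unique-cons (Unique-head u ∘ ∈-++⁺ˡ) (drop-right xs (Unique-tail u))

    none-unmatched : {C D : Set} {P : Pred D 0ℓ} (P? : Decidable P) (f : C → D) (M : List C) {all : List D} (rest : List D) →
      map f M ++ rest ↭ all → ¬ (∃[ d ] d ∈ rest × P d) → length (filter P? all) ≤ length (filter (P? ∘ f) M)
    none-unmatched P? f M {all} rest all↭ none = begin
      length (filter P? all) ≡⟨ ↭-length (filter-↭ P? (↭-sym all↭)) ⟩
      length (filter P? (map f M ++ rest)) ≡⟨ cong length (filter-++ P? (map f M) rest) ⟩
      length (filter P? (map f M) ++ filter P? rest) ≡⟨ length-++ (filter P? (map f M)) ⟩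
      length (filter P? (map f M)) + length (filter P? rest) ≡⟨ cong₂ _+_ (filter-map-length P? f M) (cong length (filter-none P? (All-tabulate (λ d∈ p → none (_ , d∈ , p))))) ⟩
      length (filter (P? ∘ f) M) + 0 ≡⟨ +-identityʳ _ ⟩
      length (filter (P? ∘ f) M) ∎
      where open ≤-Reasoning

    decide : {D : Set} {P : Pred D 0ℓ} (P? : Decidable P) (xs : List D) → Dec (∃[ d ] d ∈ xs × P d)
    decide P? xs with any? P? xs
    ... | yes some = yes (find some)
    ... | no none = no λ (d , d∈ , p) → none (lose d∈ p)

    Matched : List (A × B) → Set
    Matched M = ∀ {t v} → (t , v) ∈ M → H t v

  -- Unmatched t and v have so many neighbours that an edge joins a partner of N(t) to a partner of N(v): an augmenting path of length at most five.
  augment : ∀ {M t ts v vs} → map proj₁ M ++ t ∷ ts ↭ L → map proj₂ M ++ v ∷ vs ↭ R → Matched M →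
    ∃[ M′ ] ∃[ ts′ ] ∃[ vs′ ] length ts′ ≡ length ts × length vs′ ≡ length vs × map proj₁ M′ ++ ts′ ↭ L × map proj₂ M′ ++ vs′ ↭ R × Matched M′
  augment {M} {t} {ts} {v} {vs} L↭ R↭ matched with decide (H? t) (v ∷ vs)
  ... | yes (r , r∈ , tr) with vs′ , vs↭ ← ∈⇒↭ r∈ =
    (t , r) ∷ M , ts , vs′ , refl , suc-injective (sym (↭-length vs↭))
    , ↭-trans (↭-sym (shift t (map proj₁ M) ts)) L↭
    , ↭-trans (↭-trans (↭-sym (shift r (map proj₂ M) vs′)) (++⁺ˡ (map proj₂ M) (↭-sym vs↭))) R↭
    , λ { (here refl) → tr ; (there p∈) → matched p∈ }
  ... | no t-none with decide (λ s → H? s v) (t ∷ ts)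
  ...   | yes (l , l∈ , lv) with ts′ , ts↭ ← ∈⇒↭ l∈ =
    (l , v) ∷ M , ts′ , vs , suc-injective (sym (↭-length ts↭)) , refl
    , ↭-trans (↭-trans (↭-sym (shift l (map proj₁ M) ts′)) (++⁺ˡ (map proj₁ M) (↭-sym ts↭))) L↭
    , ↭-trans (↭-sym (shift v (map proj₂ M) vs)) R↭
    , λ { (here refl) → lv ; (there p∈) → matched p∈ }
  ...   | no v-none = finish (linked {map proj₁ M₁} {map proj₂ M₂}
      (Unique-map-filter (λ p → H? t (proj₂ p)) keys) (Unique-map-filter (λ p → H? (proj₁ p) v) values)
      (λ s∈ → case ∈-map⁻ proj₁ s∈ of λ { (p , p∈ , refl) → ∈-resp-↭ L↭ (∈-++⁺ˡ (∈-map⁺ proj₁ (proj₁ (∈-filter⁻ (λ p → H? t (proj₂ p)) {xs = M} p∈)))) })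
      (λ w∈ → case ∈-map⁻ proj₂ w∈ of λ { (p , p∈ , refl) → ∈-resp-↭ R↭ (∈-++⁺ˡ (∈-map⁺ proj₂ (proj₁ (∈-filter⁻ (λ p → H? (proj₁ p) v) {xs = M} p∈)))) })
      (≤-trans (degree-L (∈-resp-↭ L↭ (∈-++⁺ʳ (map proj₁ M) (here refl))))
        (≤-trans (none-unmatched (H? t) proj₂ M (v ∷ vs) R↭ t-none) (≤-reflexive (sym (length-map proj₁ M₁)))))
      (≤-trans (degree-R (∈-resp-↭ R↭ (∈-++⁺ʳ (map proj₂ M) (here refl))))
        (≤-trans (none-unmatched (λ s → H? s v) proj₁ M (t ∷ ts) L↭ v-none) (≤-reflexive (sym (length-map proj₂ M₂))))))
    where
    M₁ M₂ : List (A × B)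
    M₁ = filter (λ p → H? t (proj₂ p)) M
    M₂ = filter (λ p → H? (proj₁ p) v) M
    keys : Unique (map proj₁ M)
    keys = drop-right (map proj₁ M) (Unique-resp-↭ (↭-sym L↭) unique-L)
    values : Unique (map proj₂ M)
    values = drop-right (map proj₂ M) (Unique-resp-↭ (↭-sym R↭) unique-R)
    through : ∀ {s r l w} → (s , r) ∈ M → H t r → (l , w) ∈ M → H l v → H s w → Dec ((s , r) ≡ (l , w)) →
      ∃[ M′ ] ∃[ ts′ ] ∃[ vs′ ] length ts′ ≡ length ts × length vs′ ≡ length vs × map proj₁ M′ ++ ts′ ↭ L × map proj₂ M′ ++ vs′ ↭ R × Matched M′
    through {s} {r} sr∈ tr lw∈ lv sw (yes refl) with M′ , M↭ ← ∈⇒↭ sr∈ =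
      (t , r) ∷ (s , v) ∷ M′ , ts , vs , refl , refl
      , ↭-trans (↭-trans (prep t (↭-sym (++⁺ʳ ts (↭-map⁺ proj₁ M↭)))) (↭-sym (shift t (map proj₁ M) ts))) L↭
      , ↭-trans (↭-trans (↭-trans (swap r v ↭-refl) (prep v (↭-sym (++⁺ʳ vs (↭-map⁺ proj₂ M↭))))) (↭-sym (shift v (map proj₂ M) vs))) R↭
      , λ { (here refl) → tr ; (there (here refl)) → lv ; (there (there p∈)) → matched (∈-resp-↭ (↭-sym M↭) (there p∈)) }
    through {s} {r} {l} {w} sr∈ tr lw∈ lv sw (no ≢) with M′ , M↭ ← two-out sr∈ lw∈ ≢ =
      (t , r) ∷ (s , w) ∷ (l , v) ∷ M′ , ts , vs , refl , refl
      , ↭-trans (↭-trans (prep t (↭-sym (++⁺ʳ ts (↭-map⁺ proj₁ M↭)))) (↭-sym (shift t (map proj₁ M) ts))) L↭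
      , ↭-trans (↭-trans (↭-trans (↭-trans (prep r (swap w v ↭-refl)) (swap r v ↭-refl)) (prep v (↭-sym (++⁺ʳ vs (↭-map⁺ proj₂ M↭))))) (↭-sym (shift v (map proj₂ M) vs))) R↭
      , λ { (here refl) → tr ; (there (here refl)) → sw ; (there (there (here refl))) → lv
          ; (there (there (there p∈))) → matched (∈-resp-↭ (↭-sym M↭) (there (there p∈))) }
    finish : (∃[ s ] ∃[ w ] s ∈ map proj₁ M₁ × w ∈ map proj₂ M₂ × H s w) →
      ∃[ M′ ] ∃[ ts′ ] ∃[ vs′ ] length ts′ ≡ length ts × length vs′ ≡ length vs × map proj₁ M′ ++ ts′ ↭ L × map proj₂ M′ ++ vs′ ↭ R × Matched M′
    finish (s , w , s∈ , w∈ , sw) with (_ , r) , p∈ , refl ← ∈-map⁻ proj₁ s∈ | (l , _) , q∈ , refl ← ∈-map⁻ proj₂ w∈ =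
      let sr∈ , tr = ∈-filter⁻ (λ p → H? t (proj₂ p)) {xs = M} p∈
          lw∈ , lv = ∈-filter⁻ (λ p → H? (proj₁ p) v) {xs = M} q∈
      in through sr∈ tr lw∈ lv sw ((s , r) ≟₁₂ (l , w))

  perfect-matching : length L ≡ length R → ∃[ M ] map proj₁ M ↭ L × map proj₂ M ↭ R × Matched M
  perfect-matching same = go (length L) [] L R refl (sym same) ↭-refl ↭-refl (λ ())
    where
    go : ∀ k M ts vs → length ts ≡ k → length vs ≡ k → map proj₁ M ++ ts ↭ L → map proj₂ M ++ vs ↭ R → Matched M →
      ∃[ M ] map proj₁ M ↭ L × map proj₂ M ↭ R × Matched M
    go zero M [] [] _ _ L↭ R↭ matched = M , ↭-trans (↭-reflexive (sym (++-identityʳ _))) L↭ , ↭-trans (↭-reflexive (sym (++-identityʳ _))) R↭ , matched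
    go (suc k) M (t ∷ ts) (v ∷ vs) lt lv L↭ R↭ matched with M′ , ts′ , vs′ , lt′ , lv′ , L↭′ , R↭′ , matched′ ← augment L↭ R↭ matched =
      go k M′ ts′ vs′ (≡-trans lt′ (suc-injective lt)) (≡-trans lv′ (suc-injective lv)) L↭′ R↭′ matched′

-- Embedding the tree

-- L: postponed vertices, P: their parents, Q: their children, U: parents of those members of P that compete for X, O: others.
data Kind : Set where
  kL kP kQ kU kO : Kind

_≟ᵏ_ : DecidableEquality Kind
kL ≟ᵏ kL = yes refl
kL ≟ᵏ kP = no λ ()
kL ≟ᵏ kQ = no λ ()
kL ≟ᵏ kU = no λ ()
kL ≟ᵏ kO = no λ ()
kP ≟ᵏ kL = no λ ()
kP ≟ᵏ kP = yes refl
kP ≟ᵏ kQ = no λ ()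
kP ≟ᵏ kU = no λ ()
kP ≟ᵏ kO = no λ ()
kQ ≟ᵏ kL = no λ ()
kQ ≟ᵏ kP = no λ ()
kQ ≟ᵏ kQ = yes refl
kQ ≟ᵏ kU = no λ ()
kQ ≟ᵏ kO = no λ ()
kU ≟ᵏ kL = no λ ()
kU ≟ᵏ kP = no λ ()
kU ≟ᵏ kQ = no λ ()
kU ≟ᵏ kU = yes refl
kU ≟ᵏ kO = no λ ()
kO ≟ᵏ kL = no λ ()
kO ≟ᵏ kP = no λ ()
kO ≟ᵏ kQ = no λ ()
kO ≟ᵏ kU = no λ ()
kO ≟ᵏ kO = yes refl

kind-sizes : {A : Set} (kind : A → Kind) (xs : List A) →
  let size = λ k → length (filter (λ x → kind x ≟ᵏ k) xs) in size kL + size kP + size kQ + size kU + size kO ≡ length xs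
kind-sizes kind [] = refl
kind-sizes {A} kind (x ∷ xs) with ih ← kind-sizes kind xs | kind x
... | kL = cong suc ih
... | kP = ≡-trans (solve 5 (λ a b c d e → a :+ (con 1 :+ b) :+ c :+ d :+ e := con 1 :+ (a :+ b :+ c :+ d :+ e)) refl (size kL) (size kP) (size kQ) (size kU) (size kO)) (cong suc ih)
  where open +-*-Solver ; size = λ k → length (filter (λ x → kind x ≟ᵏ k) xs)
... | kQ = ≡-trans (solve 5 (λ a b c d e → a :+ b :+ (con 1 :+ c) :+ d :+ e := con 1 :+ (a :+ b :+ c :+ d :+ e)) refl (size kL) (size kP) (size kQ) (size kU) (size kO)) (cong suc ih)
  where open +-*-Solver ; size = λ k → length (filter (λ x → kind x ≟ᵏ k) xs)
... | kU = ≡-trans (solve 5 (λ a b c d e → a :+ b :+ c :+ (con 1 :+ d) :+ e := con 1 :+ (a :+ b :+ c :+ d :+ e)) refl (size kL) (size kP) (size kQ) (size kU) (size kO)) (cong suc ih)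
  where open +-*-Solver ; size = λ k → length (filter (λ x → kind x ≟ᵏ k) xs)
... | kO = ≡-trans (solve 5 (λ a b c d e → a :+ b :+ c :+ d :+ (con 1 :+ e) := con 1 :+ (a :+ b :+ c :+ d :+ e)) refl (size kL) (size kP) (size kQ) (size kU) (size kO)) (cong suc ih)
  where open +-*-Solver ; size = λ k → length (filter (λ x → kind x ≟ᵏ k) xs)

∈-drop : ∀ {A : Set} {x : A} k {xs} → x ∈ drop k xs → x ∈ xs
∈-drop zero x∈ = x∈
∈-drop (suc k) {_ ∷ _} x∈ = there (∈-drop k x∈)

take-drop-disjoint : {A : Set} (k : ℕ) {xs : List A} {x : A} → Unique xs → x ∈ take k xs → x ∉ drop k xs
take-drop-disjoint (suc k) {_ ∷ _} u (here refl) x∈ = Unique-head u (∈-drop k x∈)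
take-drop-disjoint (suc k) {_ ∷ _} u (there x∈) x∈′ = take-drop-disjoint k (Unique-tail u) x∈ x∈′

Ordered-parent : ∀ {V : Set} {par : V → Maybe V} {vs v u} → Ordered par vs → v ∈ vs → par v ≡ just u → u ∈ vs
Ordered-parent (insert _ p ord) (here refl) eq = there (p eq)
Ordered-parent (insert _ p ord) (there v∈) eq = there (Ordered-parent ord v∈ eq)

dec-if : ∀ {A : Set} {P : Set} {x y : A} (d : Dec P) → P → (if does d then x else y) ≡ x
dec-if (yes _) _ = refl
dec-if (no ¬p) p = contradiction p ¬p

module _ {n : ℕ} where

  at : List (Fin n × Fin n) → Fin n → Fin n
  at [] v = v
  at ((u , y) ∷ M) v = if does (u ≟ᶠ v) then y else at M v

  at-placed : ∀ {M v y} → Unique (map proj₁ M) → (v , y) ∈ M → at M v ≡ y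
  at-placed {(u , _) ∷ M} {v} uk p∈ with u ≟ᶠ v
  at-placed uk (here refl) | yes _ = refl
  at-placed uk (there p∈) | yes refl = contradiction (∈-map⁺ proj₁ p∈) (Unique-head uk)
  at-placed uk (here refl) | no u≢ = contradiction refl u≢
  at-placed uk (there p∈) | no _ = at-placed (Unique-tail uk) p∈

module Tree {n D λₗ : ℕ} {T : Graph n} (tree : RootedTree T D λₗ) where

  open RootedTree tree

  private
    V = Fin n

  _≟ᵐ_ : DecidableEquality (Maybe V)
  _≟ᵐ_ = Maybe-≡-dec _≟ᶠ_

  ∈-children : ∀ {u v} → par v ≡ just u → v ∈ children u
  ∈-children {u} {v} = ∈-filter⁺ (λ v → par v ≟ᵐ just u) (∈-allFin v)

  fibre≤D : ∀ {vs} → Unique vs → (∀ {v} → v ∈ vs → par v ≢ nothing) → ∀ b → length (filter (λ v → par v ≟ᵐ b) vs) ≤ D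
  fibre≤D {vs} u has-parent (just p) = ≤-trans
    (unique-⊆-length (filter⁺ (λ v → par v ≟ᵐ just p) u) (λ v∈ → ∈-children (proj₂ (∈-filter⁻ (λ v → par v ≟ᵐ just p) {xs = vs} v∈)))) (few-children p)
  fibre≤D {vs} u has-parent nothing = ≤-trans (unique-⊆-length {ys = []} (filter⁺ (λ v → par v ≟ᵐ nothing) u)
    (λ v∈ → let v∈vs , eq = ∈-filter⁻ (λ v → par v ≟ᵐ nothing) {xs = vs} v∈ in contradiction eq (has-parent v∈vs))) z≤n

  L-has-parent : ∀ {t} → t ∈ L → par t ≢ nothing
  L-has-parent t∈ eq with _ , _ , eq′ , _ ← L-parent t∈ = case ≡-trans (sym eq) eq′ of λ ()

  distinct-parents : ∀ w → w * D < λₗ → ∃[ ts ] length ts ≡ suc w × (∀ {t} → t ∈ ts → t ∈ L) × Unique (map par ts)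
  distinct-parents w w-small with ts , u , sub , bound ← representatives _≟ᵐ_ par D L (fibre≤D unique-L L-has-parent)
    = take (suc w) ts , length-take-≤ (suc w) {ts} (*-cancelʳ-< D w (length ts) (<-≤-trans w-small (≤-trans (≤-reflexive (sym length-L)) bound)))
    , (λ t∈ → sub (∈-take (suc w) t∈)) , subst Unique (sym (map-take (suc w) ts)) (take⁺ (suc w) u)
    where
    map-take : ∀ k (xs : List V) → map par (take k xs) ≡ take k (map par xs)
    map-take zero xs = refl
    map-take (suc k) [] = refl
    map-take (suc k) (x ∷ xs) = cong (par x ∷_) (map-take k xs)

record Setup (n : ℕ) : Set where
  field
    Λ : Layout n
    m ζ σ w D λₗ : ℕ
    C : List (Edge n)
    good : Pseudorandom.Good Λ m ζ σ (m + m) C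
    T : Graph n
    tree : RootedTree T D λₗ
    A′ B′ L⋆ : List (Fin n)
  open Layout Λ
  open RootedTree tree
  field
    unique-A′ : Unique A′
    unique-B′ : Unique B′
    A′⊆A : ∀ {v} → v ∈ A′ → part v ≡ pA × v ∉ X × v ∉ Z
    B′⊆B : ∀ {v} → v ∈ B′ → part v ≡ pB × (∀ {x} → x ∈ X → v ≢ partner x)
    total : n ≤ length S + (w + w) + length Z + (length A′ + length B′)
    X-w : length X ≡ w
    A-size : λₗ + (m + m) ≤ length A′
    B-size : λₗ + (m + m) ≤ length B′
    L-size : length S + (w + w) + length Z + 6 * m ≤ λₗ
    σ-size : suc (suc w) ≤ σ
    length-L⋆ : length L⋆ ≡ suc w
    L⋆⊆L : ∀ {t} → t ∈ L⋆ → t ∈ L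
    unique-par-L⋆ : Unique (map par L⋆)
    m>0 : 1 ≤ m
    D>0 : 1 ≤ D
    ζ-size : (m + m + w + length S) * D + (m + m + w + length S) * D + (w + (m + m)) * D ≤ ζ

  e a : ℕ
  e = m + m + w + length S
  a = (w + (m + m)) * D

module Embedding {n : ℕ} (E : Setup n) where

  open Setup E
  open Layout Λ
  open Pseudorandom Λ m ζ σ (m + m)
  open RootedTree tree
  open Tree tree
  open Base (proj₁ good)
  open DecMem (_≟ᶠ_ {n}) using (_∈?_)

  IsP IsP⋆ IsQ IsU : V → Set
  IsP v = Any (λ t → par t ≡ just v) L
  IsP⋆ v = Any (λ t → par t ≡ just v) L⋆
  IsQ v = Any (λ t → par v ≡ just t) L
  IsU v = Any (λ t → Any (λ p → par t ≡ just p × par p ≡ just v) (allFin n)) L⋆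

  isP? : Decidable IsP
  isP? v = any? (λ t → par t ≟ᵐ just v) L

  isP⋆? : Decidable IsP⋆
  isP⋆? v = any? (λ t → par t ≟ᵐ just v) L⋆

  isQ? : Decidable IsQ
  isQ? v = any? (λ t → par v ≟ᵐ just t) L

  isU? : Decidable IsU
  isU? v = any? (λ t → any? (λ p → par t ≟ᵐ just p ×-dec par p ≟ᵐ just v) (allFin n)) L⋆

  kind-of : V → Colour → Kind
  kind-of v c0 = if does (v ∈? L) then kL else kO
  kind-of v c1 = if does (isQ? v) then kQ else kO
  kind-of v c2 = if does (isU? v) then kU else kO
  kind-of v c3 = if does (isP? v) then kP else kO

  kind : V → Kind
  kind v = kind-of v (col v)

  data View (v : V) : Kind → Set where
    vL : v ∈ L → View v kL
    vP : IsP v → View v kP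
    vQ : IsQ v → View v kQ
    vU : col v ≡ c2 → IsU v → View v kU
    vO : View v kO

  view : ∀ v → View v (kind v)
  view v with col v in eq
  ... | c0 with v ∈? L
  ...   | yes v∈ = vL v∈
  ...   | no _ = vO
  view v | c1 with isQ? v
  ...   | yes q = vQ q
  ...   | no _ = vO
  view v | c2 with isU? v
  ...   | yes u = vU eq u
  ...   | no _ = vO
  view v | c3 with isP? v
  ...   | yes p = vP p
  ...   | no _ = vO

  before-c0 : ∀ {c} → c0 ≡ next c → c ≡ c3
  before-c0 {c3} _ = refl

  before-c3 : ∀ {c} → c3 ≡ next c → c ≡ c2
  before-c3 {c2} _ = refl

  before-c2 : ∀ {c} → c2 ≡ next c → c ≡ c1
  before-c2 {c1} _ = refl

  kind-L : ∀ {t} → t ∈ L → kind t ≡ kL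
  kind-L {t} t∈ = ≡-trans (cong (kind-of t) (L-colour t∈)) (dec-if (t ∈? L) t∈)

  colour-P : ∀ {t p} → t ∈ L → par t ≡ just p → col p ≡ c3
  colour-P t∈ eq = before-c0 (≡-trans (sym (L-colour t∈)) (col-par eq))

  kind-P : ∀ {t p} → t ∈ L → par t ≡ just p → kind p ≡ kP
  kind-P {t} {p} t∈ eq = ≡-trans (cong (kind-of p) (colour-P t∈ eq)) (dec-if (isP? p) (lose t∈ eq))

  kind-Q : ∀ {t q} → t ∈ L → par q ≡ just t → kind q ≡ kQ
  kind-Q {t} {q} t∈ eq = ≡-trans (cong (kind-of q) (≡-trans (col-par eq) (cong next (L-colour t∈)))) (dec-if (isQ? q) (lose t∈ eq))

  kind-U : ∀ {t p u} → t ∈ L⋆ → par t ≡ just p → par p ≡ just u → kind u ≡ kU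
  kind-U {t} {p} {u} t∈ eq eq′ = ≡-trans (cong (kind-of u) (before-c3 (≡-trans (sym (colour-P (L⋆⊆L t∈) eq)) (col-par eq′))))
    (dec-if (isU? u) (lose t∈ (lose (∈-allFin p) (eq , eq′))))

  number : Kind → ℕ
  number k = length (filter (λ v → kind v ≟ᵏ k) (allFin n))

  private
    of-kind : ∀ {k v} → v ∈ filter (λ v → kind v ≟ᵏ k) (allFin n) → kind v ≡ k
    of-kind {k} v∈ = proj₂ (∈-filter⁻ (λ v → kind v ≟ᵏ k) {xs = allFin n} v∈)

    unique-kind : ∀ k → Unique (filter (λ v → kind v ≟ᵏ k) (allFin n))
    unique-kind k = filter⁺ (λ v → kind v ≟ᵏ k) (allFin⁺ n)

  only-child : ∀ {t v v′} → t ∈ L → par v ≡ just t → par v′ ≡ just t → v ≡ v′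
  only-child {t} {v} {v′} t∈ eq eq′ with v ≟ᶠ v′
  ... | yes v≡ = v≡
  ... | no v≢ = contradiction (≤-trans (unique-⊆-length {xs = v ∷ v′ ∷ []} (Unique-cons (λ { (here eq) → v≢ eq }) ([] ∷ []))
          (λ { (here refl) → ∈-children eq ; (there (here refl)) → ∈-children eq′ })) (L-child t∈)) (<⇒≱ (s≤s (s≤s z≤n)))

  number-P : number kP ≤ λₗ
  number-P = ≤-trans (≤-reflexive (sym (length-map just (filter (λ v → kind v ≟ᵏ kP) (allFin n)))))
    (≤-trans (unique-⊆-length {ys = map par L} (map⁺ just-injective (unique-kind kP)) parents)
      (≤-reflexive (≡-trans (length-map par L) length-L)))
    where
    parents : ∀ {b} → b ∈ map just (filter (λ v → kind v ≟ᵏ kP) (allFin n)) → b ∈ map par L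
    parents b∈ with v , v∈ , refl ← ∈-map⁻ just b∈ with kind v | of-kind {kP} v∈ | view v
    ... | .kP | refl | vP p with t , t∈ , eq ← find p = subst (_∈ map par L) eq (∈-map⁺ par t∈)

  number-Q : number kQ ≤ λₗ
  number-Q = ≤-trans (≤-reflexive (sym (length-map par (filter (λ v → kind v ≟ᵏ kQ) (allFin n)))))
    (≤-trans (unique-⊆-length {ys = map just L} (Unique-map-on only-child′ (unique-kind kQ)) leaves)
      (≤-reflexive (≡-trans (length-map just L) length-L)))
    where
    parent-in-L : ∀ {v} → v ∈ filter (λ v → kind v ≟ᵏ kQ) (allFin n) → ∃[ t ] t ∈ L × par v ≡ just t
    parent-in-L {v} v∈ with kind v | of-kind {kQ} v∈ | view v
    ... | .kQ | refl | vQ q = find q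
    leaves : ∀ {b} → b ∈ map par (filter (λ v → kind v ≟ᵏ kQ) (allFin n)) → b ∈ map just L
    leaves b∈ with v , v∈ , refl ← ∈-map⁻ par b∈ with t , t∈ , eq ← parent-in-L v∈ = subst (_∈ map just L) (sym eq) (∈-map⁺ just t∈)
    only-child′ : ∀ {v v′} → v ∈ filter (λ v → kind v ≟ᵏ kQ) (allFin n) → v′ ∈ filter (λ v → kind v ≟ᵏ kQ) (allFin n) → par v ≡ par v′ → v ≡ v′
    only-child′ v∈ v′∈ eq with t , t∈ , eq′ ← parent-in-L v∈ = only-child t∈ eq′ (≡-trans (sym eq) eq′)

  FA FB FO : List V
  FA = take (number kP + (m + m)) A′
  FB = take (number kQ + (m + m)) B′
  FO = drop (number kP + (m + m)) A′ ++ drop (number kQ + (m + m)) B′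

  Placement : Set
  Placement = List (V × V)

  keys vals : Placement → List V
  keys = map proj₁
  vals = map proj₂

  Zone : Placement → Kind → V → V → Set
  Zone M kL v y = ⊥
  Zone M kP v y = y ∈ FA ⊎ y ∈ Z ⊎ (y ∈ X × IsP⋆ v)
  Zone M kQ v y = y ∈ FB ⊎ (∃[ x ] ∃[ t ] ∃[ p ] x ∈ X × y ≡ partner x × t ∈ L⋆ × par v ≡ just t × par t ≡ just p × (p , x) ∈ M)
  Zone M kU v y = y ∈ S
  Zone M kO v y = y ∈ FO ⊎ y ∈ Z

  Zone-mono : ∀ {M p} k {v y} → Zone M k v y → Zone (p ∷ M) k v y
  Zone-mono kP z = z
  Zone-mono kQ (inj₁ y∈) = inj₁ y∈
  Zone-mono kQ (inj₂ (x , t , p , x∈ , y≡ , t∈ , eq , eq′ , px∈)) = inj₂ (x , t , p , x∈ , y≡ , t∈ , eq , eq′ , there px∈)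
  Zone-mono kU z = z
  Zone-mono kO z = z

  part-clash : ∀ {v p q} {A : Set} → part v ≡ p → part v ≡ q → p ≢ q → A
  part-clash eq eq′ p≢q = contradiction (≡-trans (sym eq) eq′) p≢q

  A≢B : pA ≢ pB
  A≢B ()

  A≢S : pA ≢ pS
  A≢S ()

  B≢S : pB ≢ pS
  B≢S ()

  FA-A′ : ∀ {y} → y ∈ FA → y ∈ A′
  FA-A′ = ∈-take (number kP + (m + m))

  FB-B′ : ∀ {y} → y ∈ FB → y ∈ B′
  FB-B′ = ∈-take (number kQ + (m + m))

  FO-pools : ∀ {y} → y ∈ FO → (y ∈ A′ × y ∉ FA) ⊎ (y ∈ B′ × y ∉ FB)
  FO-pools y∈ with ∈-++⁻ (drop (number kP + (m + m)) A′) y∈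
  ... | inj₁ y∈A = inj₁ (∈-drop (number kP + (m + m)) y∈A , λ y∈FA → take-drop-disjoint (number kP + (m + m)) unique-A′ y∈FA y∈A)
  ... | inj₂ y∈B = inj₂ (∈-drop (number kQ + (m + m)) y∈B , λ y∈FB → take-drop-disjoint (number kQ + (m + m)) unique-B′ y∈FB y∈B)

  data Loc (y : V) : Set where
    inS : part y ≡ pS → Loc y
    inX : y ∈ X → Loc y
    inY : part y ≡ pB → y ∉ B′ → Loc y
    inZ : y ∈ Z → Loc y
    inFA : y ∈ FA → Loc y
    inFB : y ∈ FB → Loc y
    inFO : y ∈ FO → Loc y

  data LocTag : Set where
    tS tX tY tZ tFA tFB tFO : LocTag

  tag : ∀ {y} → Loc y → LocTag
  tag (inS _) = tS
  tag (inX _) = tX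
  tag (inY _ _) = tY
  tag (inZ _) = tZ
  tag (inFA _) = tFA
  tag (inFB _) = tFB
  tag (inFO _) = tFO

  loc-part : ∀ {y} (l : Loc y) → (part y ≡ pS × tag l ≡ tS) ⊎ (part y ≡ pA) ⊎ (part y ≡ pB)
  loc-part (inS p) = inj₁ (p , refl)
  loc-part (inX y∈) = inj₂ (inj₁ (X⊆A y∈))
  loc-part (inY p _) = inj₂ (inj₂ p)
  loc-part (inZ y∈) = inj₂ (inj₁ (Z⊆A y∈))
  loc-part (inFA y∈) = inj₂ (inj₁ (proj₁ (A′⊆A (FA-A′ y∈))))
  loc-part (inFB y∈) = inj₂ (inj₂ (proj₁ (B′⊆B (FB-B′ y∈))))
  loc-part (inFO y∈) with FO-pools y∈
  ... | inj₁ (y∈A , _) = inj₂ (inj₁ (proj₁ (A′⊆A y∈A)))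
  ... | inj₂ (y∈B , _) = inj₂ (inj₂ (proj₁ (B′⊆B y∈B)))

  in-A′ : ∀ {y} → y ∈ A′ → (l : Loc y) → (y ∈ FA × tag l ≡ tFA) ⊎ (y ∉ FA × tag l ≡ tFO)
  in-A′ y∈ (inS p) = part-clash (proj₁ (A′⊆A y∈)) p A≢S
  in-A′ y∈ (inX y∈X) = contradiction y∈X (proj₁ (proj₂ (A′⊆A y∈)))
  in-A′ y∈ (inY p _) = part-clash (proj₁ (A′⊆A y∈)) p A≢B
  in-A′ y∈ (inZ y∈Z) = contradiction y∈Z (proj₂ (proj₂ (A′⊆A y∈)))
  in-A′ y∈ (inFA y∈FA) = inj₁ (y∈FA , refl)
  in-A′ y∈ (inFB y∈FB) = part-clash (proj₁ (A′⊆A y∈)) (proj₁ (B′⊆B (FB-B′ y∈FB))) A≢B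
  in-A′ y∈ (inFO y∈FO) with FO-pools y∈FO
  ... | inj₁ (_ , y∉) = inj₂ (y∉ , refl)
  ... | inj₂ (y∈B , _) = part-clash (proj₁ (A′⊆A y∈)) (proj₁ (B′⊆B y∈B)) A≢B

  in-B′ : ∀ {y} → y ∈ B′ → (l : Loc y) → (y ∈ FB × tag l ≡ tFB) ⊎ (y ∉ FB × tag l ≡ tFO)
  in-B′ y∈ (inS p) = part-clash (proj₁ (B′⊆B y∈)) p B≢S
  in-B′ y∈ (inX y∈X) = part-clash (X⊆A y∈X) (proj₁ (B′⊆B y∈)) A≢B
  in-B′ y∈ (inY _ y∉) = contradiction y∈ y∉
  in-B′ y∈ (inZ y∈Z) = part-clash (Z⊆A y∈Z) (proj₁ (B′⊆B y∈)) A≢B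
  in-B′ y∈ (inFA y∈FA) = part-clash (proj₁ (A′⊆A (FA-A′ y∈FA))) (proj₁ (B′⊆B y∈)) A≢B
  in-B′ y∈ (inFB y∈FB) = inj₁ (y∈FB , refl)
  in-B′ y∈ (inFO y∈FO) with FO-pools y∈FO
  ... | inj₁ (y∈A , _) = part-clash (proj₁ (A′⊆A y∈A)) (proj₁ (B′⊆B y∈)) A≢B
  ... | inj₂ (_ , y∉) = inj₂ (y∉ , refl)

  in-X : ∀ {y} → y ∈ X → (l : Loc y) → tag l ≡ tX
  in-X y∈ (inS p) = part-clash (X⊆A y∈) p A≢S
  in-X y∈ (inX _) = refl
  in-X y∈ (inY p _) = part-clash (X⊆A y∈) p A≢B
  in-X y∈ (inZ y∈Z) = contradiction y∈ (Z∉X y∈Z)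
  in-X y∈ (inFA y∈FA) = contradiction y∈ (proj₁ (proj₂ (A′⊆A (FA-A′ y∈FA))))
  in-X y∈ (inFB y∈FB) = part-clash (X⊆A y∈) (proj₁ (B′⊆B (FB-B′ y∈FB))) A≢B
  in-X y∈ (inFO y∈FO) with FO-pools y∈FO
  ... | inj₁ (y∈A , _) = contradiction y∈ (proj₁ (proj₂ (A′⊆A y∈A)))
  ... | inj₂ (y∈B , _) = part-clash (X⊆A y∈) (proj₁ (B′⊆B y∈B)) A≢B

  in-Z : ∀ {y} → y ∈ Z → (l : Loc y) → tag l ≡ tZ
  in-Z y∈ (inS p) = part-clash (Z⊆A y∈) p A≢S
  in-Z y∈ (inX y∈X) = contradiction y∈X (Z∉X y∈)
  in-Z y∈ (inY p _) = part-clash (Z⊆A y∈) p A≢B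
  in-Z y∈ (inZ _) = refl
  in-Z y∈ (inFA y∈FA) = contradiction y∈ (proj₂ (proj₂ (A′⊆A (FA-A′ y∈FA))))
  in-Z y∈ (inFB y∈FB) = part-clash (Z⊆A y∈) (proj₁ (B′⊆B (FB-B′ y∈FB))) A≢B
  in-Z y∈ (inFO y∈FO) with FO-pools y∈FO
  ... | inj₁ (y∈A , _) = contradiction y∈ (proj₂ (proj₂ (A′⊆A y∈A)))
  ... | inj₂ (y∈B , _) = part-clash (Z⊆A y∈) (proj₁ (B′⊆B y∈B)) A≢B

  in-S : ∀ {y} → part y ≡ pS → (l : Loc y) → tag l ≡ tS
  in-S p l with loc-part l
  ... | inj₁ (_ , eq) = eq
  ... | inj₂ (inj₁ q) = part-clash q p A≢S
  ... | inj₂ (inj₂ q) = part-clash q p B≢S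

  in-Y : ∀ {x} → x ∈ X → (l : Loc (partner x)) → tag l ≡ tY
  in-Y x∈ (inS p) = part-clash (partner-B x∈) p B≢S
  in-Y x∈ (inX y∈) = part-clash (X⊆A y∈) (partner-B x∈) A≢B
  in-Y x∈ (inY _ _) = refl
  in-Y x∈ (inZ y∈) = part-clash (Z⊆A y∈) (partner-B x∈) A≢B
  in-Y x∈ (inFA y∈) = part-clash (proj₁ (A′⊆A (FA-A′ y∈))) (partner-B x∈) A≢B
  in-Y x∈ (inFB y∈) = contradiction refl (proj₂ (B′⊆B (FB-B′ y∈)) x∈)
  in-Y x∈ (inFO y∈) with FO-pools y∈
  ... | inj₁ (y∈A , _) = part-clash (proj₁ (A′⊆A y∈A)) (partner-B x∈) A≢B
  ... | inj₂ (y∈B , _) = contradiction refl (proj₂ (B′⊆B y∈B) x∈)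

  in-FA : ∀ {y} → y ∈ FA → (l : Loc y) → tag l ≡ tFA
  in-FA y∈ l with in-A′ (FA-A′ y∈) l
  ... | inj₁ (_ , eq) = eq
  ... | inj₂ (y∉ , _) = contradiction y∈ y∉

  in-FB : ∀ {y} → y ∈ FB → (l : Loc y) → tag l ≡ tFB
  in-FB y∈ l with in-B′ (FB-B′ y∈) l
  ... | inj₁ (_ , eq) = eq
  ... | inj₂ (y∉ , _) = contradiction y∈ y∉

  in-FO : ∀ {y} → y ∈ FO → (l : Loc y) → tag l ≡ tFO
  in-FO y∈ l with FO-pools y∈
  ... | inj₁ (y∈A , y∉) with in-A′ y∈A l
  ...   | inj₁ (y∈FA , _) = contradiction y∈FA y∉
  ...   | inj₂ (_ , eq) = eq
  in-FO y∈ l | inj₂ (y∈B , y∉) with in-B′ y∈B l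
  ...   | inj₁ (y∈FB , _) = contradiction y∈FB y∉
  ...   | inj₂ (_ , eq) = eq

  zone-loc : ∀ {M} k {v y} → Zone M k v y → Loc y
  zone-loc kP (inj₁ y∈) = inFA y∈
  zone-loc kP (inj₂ (inj₁ y∈)) = inZ y∈
  zone-loc kP (inj₂ (inj₂ (y∈ , _))) = inX y∈
  zone-loc kQ (inj₁ y∈) = inFB y∈
  zone-loc kQ (inj₂ (x , _ , _ , x∈ , refl , _)) = inY (partner-B x∈) (λ y∈ → proj₂ (B′⊆B y∈) x∈ refl)
  zone-loc kU y∈ = inS (S⊆S y∈)
  zone-loc kO (inj₁ y∈) = inFO y∈
  zone-loc kO (inj₂ y∈) = inZ y∈

  home : LocTag → Kind
  home tS = kU
  home tX = kP
  home tY = kQ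
  home tZ = kO
  home tFA = kP
  home tFB = kQ
  home tFO = kO

  zone-home : ∀ {M} k {v y} (z : Zone M k v y) → k ≡ home (tag (zone-loc {M} k z)) ⊎ tag (zone-loc {M} k z) ≡ tZ
  zone-home kP (inj₁ _) = inj₁ refl
  zone-home kP (inj₂ (inj₁ _)) = inj₂ refl
  zone-home kP (inj₂ (inj₂ _)) = inj₁ refl
  zone-home kQ (inj₁ _) = inj₁ refl
  zone-home kQ (inj₂ (_ , _ , _ , _ , refl , _)) = inj₁ refl
  zone-home kU _ = inj₁ refl
  zone-home kO (inj₁ _) = inj₁ refl
  zone-home kO (inj₂ _) = inj₁ refl

  zone-kind : ∀ {M} k {v y τ} → (∀ (l : Loc y) → tag l ≡ τ) → τ ≢ tZ → Zone M k v y → k ≡ home τ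
  zone-kind {M} k at τ≢ z with zone-home {M} k z
  ... | inj₁ eq = ≡-trans eq (cong home (at (zone-loc {M} k z)))
  ... | inj₂ eq = contradiction (≡-trans (sym (at (zone-loc {M} k z))) eq) τ≢

  zone-X : ∀ {M} k {v y} → y ∈ X → Zone M k v y → k ≡ kP × IsP⋆ v
  zone-X kP y∈ (inj₁ y∈FA) = contradiction y∈ (proj₁ (proj₂ (A′⊆A (FA-A′ y∈FA))))
  zone-X kP y∈ (inj₂ (inj₁ y∈Z)) = contradiction y∈ (Z∉X y∈Z)
  zone-X kP y∈ (inj₂ (inj₂ (_ , p⋆))) = refl , p⋆
  zone-X {M} kQ y∈ z = case zone-kind {M} kQ (in-X y∈) (λ ()) z of λ ()
  zone-X {M} kU {v} y∈ z = case zone-kind {M} kU {v} (in-X y∈) (λ ()) z of λ ()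
  zone-X {M} kO {v} y∈ z = case zone-kind {M} kO {v} (in-X y∈) (λ ()) z of λ ()

  zone-Z : ∀ {M} k {v y} → y ∈ Z → Zone M k v y → k ≡ kP ⊎ k ≡ kO
  zone-Z kP _ _ = inj₁ refl
  zone-Z {M} kQ y∈ z@(inj₁ _) = case in-Z y∈ (zone-loc {M} kQ z) of λ ()
  zone-Z {M} kQ y∈ z@(inj₂ (_ , _ , _ , _ , refl , _)) = case in-Z y∈ (zone-loc {M} kQ z) of λ ()
  zone-Z {M} kU {v} y∈ z = case in-Z y∈ (zone-loc {M} kU {v} z) of λ ()
  zone-Z kO _ _ = inj₂ refl

  Pool : Kind → List V
  Pool kP = FA
  Pool kO = FO
  Pool _ = []

  Exhausted : Placement → List V → V → Set
  Exhausted M F x = ∀ {f} → f ∈ F → Joined C x f → f ∈ vals M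

  ParentAt : Placement → V → V → Set
  ParentAt M v x = ∃[ u ] par v ≡ just u × (u , x) ∈ M

  record Partial (vs : List V) (M : Placement) : Set where
    field
      unique-keys : Unique (keys M)
      unique-vals : Unique (vals M)
      keys⊆ : ∀ {v y} → (v , y) ∈ M → v ∈ vs × kind v ≢ kL
      placed : ∀ {v} → v ∈ vs → kind v ≢ kL → ∃[ y ] (v , y) ∈ M
      zones : ∀ {v y} → (v , y) ∈ M → Zone M (kind v) v y
      edges : ∀ {v y x} → (v , y) ∈ M → ParentAt M v x → Joined C x y
      reserve-rule : ∀ {v y} → (v , y) ∈ M → y ∈ Z → ∃[ x ] ParentAt M v x × Exhausted M (Pool (kind v)) x
      P⋆-rule : ∀ {v y} → (v , y) ∈ M → IsP⋆ v → y ∈ X ⊎ (∀ {x} → ParentAt M v x → Exhausted M X x)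
      partner-rule : ∀ {v y t p x} → (v , y) ∈ M → t ∈ L⋆ → par v ≡ just t → par t ≡ just p → (p , x) ∈ M → x ∈ X → y ≡ partner x

  key-functional : ∀ {M v y y′} → Unique (keys M) → (v , y) ∈ M → (v , y′) ∈ M → y ≡ y′
  key-functional u p∈ q∈ = cong proj₂ (Unique-map-injective u p∈ q∈ refl)

  val-functional : ∀ {M v v′ y} → Unique (vals M) → (v , y) ∈ M → (v′ , y) ∈ M → v ≡ v′
  val-functional u p∈ q∈ = cong proj₁ (Unique-map-injective u p∈ q∈ refl)

  ∈-vals : ∀ {M y} → y ∈ vals M → ∃[ v ] (v , y) ∈ M
  ∈-vals y∈ with (v , _) , p∈ , refl ← ∈-map⁻ proj₂ y∈ = v , p∈

  empty : Partial [] []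
  empty = record { unique-keys = [] ; unique-vals = [] ; keys⊆ = λ () ; placed = λ () ; zones = λ () ; edges = λ ()
                 ; reserve-rule = λ () ; P⋆-rule = λ () ; partner-rule = λ () }

  module _ {v vs M} (ord : Ordered par vs) (v∉ : v ∉ vs) (P : Partial vs M) where
    open Partial P

    skip : kind v ≡ kL → Partial (v ∷ vs) M
    skip isL = record
      { Partial P hiding (keys⊆ ; placed)
      ; keys⊆ = λ p∈ → let v∈ , ≢L = keys⊆ p∈ in there v∈ , ≢L
      ; placed = λ { (here refl) ≢L → contradiction isL ≢L ; (there v∈) ≢L → placed v∈ ≢L } }

    module _ (closed : ∀ {u} → par v ≡ just u → u ∈ vs) {y} (not-L : kind v ≢ kL) (fresh : y ∉ vals M) (zone : Zone M (kind v) v y)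
      (new-edge : ∀ {x} → ParentAt M v x → Joined C x y)
      (new-reserve : y ∈ Z → ∃[ x ] ParentAt M v x × Exhausted M (Pool (kind v)) x)
      (new-P⋆ : IsP⋆ v → y ∈ X ⊎ (∀ {x} → ParentAt M v x → Exhausted M X x))
      (new-partner : ∀ {t p x} → t ∈ L⋆ → par v ≡ just t → par t ≡ just p → (p , x) ∈ M → x ∈ X → y ≡ partner x) where

      private
        M′ = (v , y) ∷ M

        lift : ∀ {u x} → ParentAt M u x → ParentAt M′ u x
        lift (p , eq , px∈) = p , eq , there px∈

        lower : ∀ {u x} → u ∈ v ∷ vs → ParentAt M′ u x → ParentAt M u x
        lower _ (p , eq , there px∈) = p , eq , px∈
        lower (here refl) (p , eq , here refl) = contradiction (closed eq) v∉
        lower (there u∈) (p , eq , here refl) = contradiction (Ordered-parent ord u∈ eq) v∉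

        lift-P⋆ : ∀ {u z} → u ∈ v ∷ vs → z ∈ X ⊎ (∀ {x} → ParentAt M u x → Exhausted M X x) → z ∈ X ⊎ (∀ {x} → ParentAt M′ u x → Exhausted M′ X x)
        lift-P⋆ u∈ (inj₁ z∈) = inj₁ z∈
        lift-P⋆ u∈ (inj₂ ex) = inj₂ λ at f∈ j → there (ex (lower u∈ at) f∈ j)

      place-at : Partial (v ∷ vs) M′
      place-at = record
        { unique-keys = Unique-cons (λ v∈ → case ∈-map⁻ proj₁ v∈ of λ { (_ , p∈ , refl) → v∉ (proj₁ (keys⊆ p∈)) }) unique-keys
        ; unique-vals = Unique-cons fresh unique-vals
        ; keys⊆ = λ { (here refl) → here refl , not-L ; (there p∈) → let v∈ , ≢L = keys⊆ p∈ in there v∈ , ≢L }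
        ; placed = λ { (here refl) _ → y , here refl ; (there v∈) ≢L → let y , p∈ = placed v∈ ≢L in y , there p∈ }
        ; zones = λ { (here refl) → Zone-mono {M} (kind v) zone ; {u} (there p∈) → Zone-mono {M} (kind u) (zones p∈) }
        ; edges = λ { (here refl) at → new-edge (lower (here refl) at) ; (there p∈) at → edges p∈ (lower (there (proj₁ (keys⊆ p∈))) at) }
        ; reserve-rule = λ { (here refl) y∈ → let x , at , ex = new-reserve y∈ in x , lift at , λ f∈ j → there (ex f∈ j)
                           ; (there p∈) y∈ → let x , at , ex = reserve-rule p∈ y∈ in x , lift at , λ f∈ j → there (ex f∈ j) }
        ; P⋆-rule = λ { (here refl) p⋆ → lift-P⋆ (here refl) (new-P⋆ p⋆) ; (there p∈) p⋆ → lift-P⋆ (there (proj₁ (keys⊆ p∈))) (P⋆-rule p∈ p⋆) }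
        ; partner-rule = λ { (here refl) t∈ eq eq′ (there px∈) x∈ → new-partner t∈ eq eq′ px∈ x∈
                           ; (here refl) t∈ eq eq′ (here refl) x∈ → contradiction (Ordered-parent ord (closed eq) eq′) v∉
                           ; (there p∈) t∈ eq eq′ (there px∈) x∈ → partner-rule p∈ t∈ eq eq′ px∈ x∈
                           ; (there p∈) t∈ eq eq′ (here refl) x∈ → contradiction (Ordered-parent ord (Ordered-parent ord (proj₁ (keys⊆ p∈)) eq) eq′) v∉ } }

  module Counting {vs M} (P : Partial vs M) where
    open Partial P

    used : List V → ℕ
    used F = length (filter (_∈? F) (vals M))

    fresh-in : ∀ {F} G → Unique F → (∀ {y} → y ∈ F → y ∈ G) → used G < length F → ∃[ y ] y ∈ F × y ∉ vals M
    fresh-in G u F⊆G lt with y , y∈ , y∉ ← exists-fresh _≟ᶠ_ u lt = y , y∈ , λ y∈vals → y∉ (∈-filter⁺ (_∈? G) y∈vals (F⊆G y∈))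

    used-≤ : ∀ F k → (∀ {v y} → (v , y) ∈ M → y ∈ F → kind v ≡ k) → used F ≤ number k
    used-≤ F k home = ≤-trans (≤-reflexive (≡-trans (filter-map-length (_∈? F) proj₂ M) (sym (length-map proj₁ (filter (λ p → proj₂ p ∈? F) M)))))
      (unique-⊆-length (Unique-map-filter (λ p → proj₂ p ∈? F) unique-keys)
        (λ v∈ → case ∈-map⁻ proj₁ v∈ of λ { ((v , y) , p∈ , refl) → let p∈M , y∈F = ∈-filter⁻ (λ p → proj₂ p ∈? F) {xs = M} p∈ in
          ∈-filter⁺ (λ v → kind v ≟ᵏ k) (∈-allFin v) (home p∈M y∈F) }))

    used-in : ∀ F {τ} → τ ≢ tZ → (∀ {y} → y ∈ F → (l : Loc y) → tag l ≡ τ) → used F ≤ number (home τ)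
    used-in F {τ} τ≢ at = used-≤ F (home τ) (λ {v} p∈ y∈ → zone-kind {M} (kind v) (at y∈) τ≢ (zones p∈))

  FA-size : number kP + (m + m) ≤ length FA
  FA-size = ≤-reflexive (sym (length-take-≤ (number kP + (m + m)) (≤-trans (+-monoˡ-≤ (m + m) number-P) A-size)))

  FB-size : number kQ + (m + m) ≤ length FB
  FB-size = ≤-reflexive (sym (length-take-≤ (number kQ + (m + m)) (≤-trans (+-monoˡ-≤ (m + m) number-Q) B-size)))

  unique-FA : Unique FA
  unique-FA = take⁺ (number kP + (m + m)) unique-A′

  unique-FB : Unique FB
  unique-FB = take⁺ (number kQ + (m + m)) unique-B′

  unique-FO : Unique FO
  unique-FO = ++⁺ (drop⁺ (number kP + (m + m)) unique-A′) (drop⁺ (number kQ + (m + m)) unique-B′)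
    (λ (y∈A , y∈B) → part-clash (proj₁ (A′⊆A (∈-drop (number kP + (m + m)) y∈A))) (proj₁ (B′⊆B (∈-drop (number kQ + (m + m)) y∈B))) A≢B)

  FO-size : number kO + (m + m) ≤ length FO
  FO-size = +-cancelˡ-≤ (rest + (number kP + number kQ + 4 * m)) _ _ (begin
    (rest + (number kP + number kQ + 4 * m)) + (number kO + (m + m))
      ≡⟨ solve 5 (λ r p q o m → (r :+ (p :+ q :+ con 4 :* m)) :+ (o :+ (m :+ m)) := (r :+ con 6 :* m) :+ p :+ q :+ o) refl rest (number kP) (number kQ) (number kO) m ⟩
    (rest + 6 * m) + number kP + number kQ + number kO ≤⟨ +-monoˡ-≤ (number kO) (+-monoˡ-≤ (number kQ) (+-monoˡ-≤ (number kP) (≤-trans L-size L≤))) ⟩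
    number kL + number kP + number kQ + number kO ≤⟨ +-monoˡ-≤ (number kO) (m≤m+n _ (number kU)) ⟩
    number kL + number kP + number kQ + number kU + number kO ≡⟨ ≡-trans (kind-sizes kind (allFin n)) (length-allFin n) ⟩
    n ≤⟨ total ⟩
    rest + (length A′ + length B′) ≡⟨ cong (rest +_) (cong₂ _+_ (split (number kP + (m + m)) A′ (≤-trans (+-monoˡ-≤ (m + m) number-P) A-size)) (split (number kQ + (m + m)) B′ (≤-trans (+-monoˡ-≤ (m + m) number-Q) B-size))) ⟩
    rest + ((number kP + (m + m) + dA) + (number kQ + (m + m) + dB))
      ≡⟨ solve 6 (λ r p q m x y → r :+ ((p :+ (m :+ m) :+ x) :+ (q :+ (m :+ m) :+ y)) := (r :+ (p :+ q :+ con 4 :* m)) :+ (x :+ y)) refl rest (number kP) (number kQ) m dA dB ⟩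
    (rest + (number kP + number kQ + 4 * m)) + (dA + dB) ≡⟨ cong (rest + (number kP + number kQ + 4 * m) +_) (sym (length-++ (drop (number kP + (m + m)) A′))) ⟩
    (rest + (number kP + number kQ + 4 * m)) + length FO ∎)
    where
    open ≤-Reasoning
    open +-*-Solver
    rest = length S + (w + w) + length Z
    dA = length (drop (number kP + (m + m)) A′)
    dB = length (drop (number kQ + (m + m)) B′)
    split : ∀ k (xs : List V) → k ≤ length xs → length xs ≡ k + length (drop k xs)
    split k xs le = ≡-trans (cong length (sym (take++drop≡id k xs))) (≡-trans (length-++ (take k xs)) (cong (_+ length (drop k xs)) (length-take-≤ k le)))
    L≤ : λₗ ≤ number kL
    L≤ = ≤-trans (≤-reflexive (sym length-L)) (unique-⊆-length unique-L (λ {t} t∈ → ∈-filter⁺ (λ v → kind v ≟ᵏ kL) (∈-allFin t) (kind-L t∈)))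

  Linkable : List V → Set
  Linkable xs = (∀ {x} → x ∈ xs → part x ≡ pA × x ∉ X) ⊎ (∀ {x} → x ∈ xs → part x ≡ pB)

  Linkable-take : ∀ k {xs} → Linkable xs → Linkable (take k xs)
  Linkable-take k (inj₁ t) = inj₁ λ x∈ → t (∈-take k x∈)
  Linkable-take k (inj₂ t) = inj₂ λ x∈ → t (∈-take k x∈)

  link : ∀ {xs fs} → Unique xs → Unique fs → m ≤ length xs → m + m ≤ length fs → (∀ {x} → x ∈ xs → x ∉ fs) → Linkable xs → ∃[ x ] ∃[ f ] x ∈ xs × f ∈ fs × Joined C x f
  link {xs} {fs} ux uf lx lf disj typed with majority (λ f → sideOf f ≟ᵇ true) fs lf
  ... | inj₁ big = let x , f , x∈ , f∈ , j = joined (take⁺ m ux) (take⁺ m (filter⁺ (λ f → sideOf f ≟ᵇ true) uf)) (length-take-≤ m lx) (length-take-≤ m big)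
                         (λ x∈ f∈ → disj (∈-take m x∈) (proj₁ (∈-filter⁻ (λ f → sideOf f ≟ᵇ true) {xs = fs} (∈-take m f∈))))
                         (Linkable-take m typed) true (λ f∈ → proj₂ (∈-filter⁻ (λ f → sideOf f ≟ᵇ true) {xs = fs} (∈-take m f∈)))
                   in x , f , ∈-take m x∈ , proj₁ (∈-filter⁻ (λ f → sideOf f ≟ᵇ true) {xs = fs} (∈-take m f∈)) , j
  ... | inj₂ big = let x , f , x∈ , f∈ , j = joined (take⁺ m ux) (take⁺ m (filter⁺ (¬? ∘ λ f → sideOf f ≟ᵇ true) uf)) (length-take-≤ m lx) (length-take-≤ m big)
                         (λ x∈ f∈ → disj (∈-take m x∈) (proj₁ (∈-filter⁻ (¬? ∘ λ f → sideOf f ≟ᵇ true) {xs = fs} (∈-take m f∈))))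
                         (Linkable-take m typed) false
                         (λ {f} f∈ → ¬-not {sideOf f} (proj₂ (∈-filter⁻ (¬? ∘ λ f → sideOf f ≟ᵇ true) {xs = fs} (∈-take m f∈))))
                   in x , f , ∈-take m x∈ , proj₁ (∈-filter⁻ (¬? ∘ λ f → sideOf f ≟ᵇ true) {xs = fs} (∈-take m f∈)) , j

  link-mixed : ∀ {xs fs} → Unique xs → Unique fs → m + m ≤ length xs → m + m ≤ length fs → (∀ {x} → x ∈ xs → x ∉ fs) →
    (∀ {x} → x ∈ xs → part x ≢ pS × x ∉ X) → ∃[ x ] ∃[ f ] x ∈ xs × f ∈ fs × Joined C x f
  link-mixed {xs} {fs} ux uf lx lf disj typed with majority (λ x → part x ≟ᵖ pA) xs lx
  ... | inj₁ big = let x , f , x∈ , rest = link (filter⁺ (λ x → part x ≟ᵖ pA) ux) uf big lf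
                         (λ x∈ → disj (proj₁ (∈-filter⁻ (λ x → part x ≟ᵖ pA) {xs = xs} x∈)))
                         (inj₁ λ x∈ → let x∈xs , px = ∈-filter⁻ (λ x → part x ≟ᵖ pA) {xs = xs} x∈ in px , proj₂ (typed x∈xs))
                   in x , f , proj₁ (∈-filter⁻ (λ x → part x ≟ᵖ pA) {xs = xs} x∈) , rest
  ... | inj₂ big = let x , f , x∈ , rest = link (filter⁺ (¬? ∘ λ x → part x ≟ᵖ pA) ux) uf big lf
                         (λ x∈ → disj (proj₁ (∈-filter⁻ (¬? ∘ λ x → part x ≟ᵖ pA) {xs = xs} x∈)))
                         (inj₂ λ {x} x∈ → let x∈xs , px = ∈-filter⁻ (¬? ∘ λ x → part x ≟ᵖ pA) {xs = xs} x∈ in remaining (part x) px (proj₁ (typed x∈xs)))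
                   in x , f , proj₁ (∈-filter⁻ (¬? ∘ λ x → part x ≟ᵖ pA) {xs = xs} x∈) , rest
    where
    remaining : ∀ p → p ≢ pA → p ≢ pS → p ≡ pB
    remaining pA ≢A _ = contradiction refl ≢A
    remaining pB _ _ = refl
    remaining pS _ ≢S = contradiction refl ≢S

  parent-at : Placement → V → V
  parent-at M v with par v
  ... | just u = at M u
  ... | nothing = v

  parent-at-placed : ∀ {M v x} → Unique (keys M) → ParentAt M v x → parent-at M v ≡ x
  parent-at-placed {M} {v} uk (u , eq , ux∈) with par v
  parent-at-placed uk (u , refl , ux∈) | just .u = at-placed uk ux∈

  data Roomy : Kind → Set where
    roomy-P : Roomy kP
    roomy-O : Roomy kO

  unique-Pool : ∀ k → Unique (Pool k)
  unique-Pool kL = []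
  unique-Pool kP = unique-FA
  unique-Pool kQ = []
  unique-Pool kU = []
  unique-Pool kO = unique-FO

  module Reserve {vs M} (P : Partial vs M) where
    open Partial P
    open Counting P

    room : ∀ {k} → Roomy k → used (Pool k) + (m + m) ≤ length (Pool k)
    room roomy-P = ≤-trans (+-monoˡ-≤ (m + m) (used-in FA {tFA} (λ ()) in-FA)) FA-size
    room roomy-O = ≤-trans (+-monoˡ-≤ (m + m) (used-in FO {tFO} (λ ()) in-FO)) FO-size

    private
      in-reserve? : ∀ k → Decidable (λ (p : V × V) → proj₂ p ∈ Z × kind (proj₁ p) ≡ k)
      in-reserve? k p = proj₂ p ∈? Z ×-dec kind (proj₁ p) ≟ᵏ k

      sent : Kind → List V
      sent k = keys (filter (in-reserve? k) M)

      ∈-sent : ∀ {k v} → v ∈ sent k → kind v ≡ k × ∃[ x ] ParentAt M v x × Exhausted M (Pool k) x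
      ∈-sent {k} v∈ with (v , y) , p∈ , refl ← ∈-map⁻ proj₁ v∈ with p∈M , y∈Z , refl ← ∈-filter⁻ (in-reserve? k) {xs = M} p∈ = refl , reserve-rule p∈M y∈Z

      unique-sent : ∀ k → Unique (sent k)
      unique-sent k = Unique-map-filter (in-reserve? k) unique-keys

      sent-parent : ∀ {k v} → v ∈ sent k → par v ≢ nothing
      sent-parent v∈ eq with _ , _ , (_ , eq′ , _) , _ ← ∈-sent v∈ = case ≡-trans (sym eq) eq′ of λ ()

    -- The images of the parents whose children were sent to Z have no free neighbours in the pool.
    few-exhausted : ∀ {k} → Roomy k → (ys : List V) → Unique (map par ys) → (∀ {y} → y ∈ ys → y ∈ sent k) → length ys ≤ e
    few-exhausted {k} roomy ys u-par ys⊆ with length ys ≤? e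
    ... | yes le = le
    ... | no nle = contradiction (link-mixed unique-xs₂ unique-free xs₂-size free-size
            (λ x∈ f∈ → proj₂ (∈-free f∈) (proj₁ (∈-xs₂ x∈))) (λ x∈ → proj₂ (proj₂ (∈-xs₂ x∈)) , proj₁ (proj₂ (∈-xs₂ x∈)))) no-link
      where
      xs xs₁ xs₂ free : List V
      xs = map (parent-at M) ys
      xs₁ = filter (λ x → ¬? (x ∈? S)) xs
      xs₂ = filter (λ x → ¬? (x ∈? X)) xs₁
      free = filter (λ f → ¬? (f ∈? filter (_∈? Pool k) (vals M))) (Pool k)
      image : ∀ {x} → x ∈ xs → ∃[ u ] (u , x) ∈ M × Exhausted M (Pool k) x
      image x∈ with y , y∈ , refl ← ∈-map⁻ (parent-at M) x∈ with _ , x , pa@(u , _ , ux∈) , ex ← ∈-sent (ys⊆ y∈)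
        with refl ← parent-at-placed unique-keys pa = u , ux∈ , ex
      unique-xs : Unique xs
      unique-xs = Unique-map-on inj (Unique-map⁻ u-par)
        where
        inj : ∀ {y y′} → y ∈ ys → y′ ∈ ys → parent-at M y ≡ parent-at M y′ → y ≡ y′
        inj y∈ y′∈ eq with _ , x , pa@(u , eq₁ , ux∈) , _ ← ∈-sent (ys⊆ y∈) | _ , x′ , pa′@(u′ , eq₂ , ux′∈) , _ ← ∈-sent (ys⊆ y′∈)
          with refl ← ≡-trans (sym (parent-at-placed unique-keys pa)) (≡-trans eq (parent-at-placed unique-keys pa′))
          with refl ← val-functional unique-vals ux∈ ux′∈ = Unique-map-injective u-par y∈ y′∈ (≡-trans eq₁ (sym eq₂))
      unique-xs₂ : Unique xs₂
      unique-xs₂ = filter⁺ (λ x → ¬? (x ∈? X)) (filter⁺ (λ x → ¬? (x ∈? S)) unique-xs)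
      ∈-xs₂ : ∀ {x} → x ∈ xs₂ → x ∈ vals M × x ∉ X × part x ≢ pS
      ∈-xs₂ x∈ with x∈xs₁ , x∉X ← ∈-filter⁻ (λ x → ¬? (x ∈? X)) {xs = xs₁} x∈ with x∈xs , x∉S ← ∈-filter⁻ (λ x → ¬? (x ∈? S)) {xs = xs} x∈xs₁ =
        ∈-map⁺ proj₂ (proj₁ (proj₂ (image x∈xs))) , x∉X , x∉S ∘ S-complete
      xs₂-size : m + m ≤ length xs₂
      xs₂-size = +-cancelʳ-≤ (w + length S) (m + m) (length xs₂) (begin
        m + m + (w + length S) ≡⟨ sym (+-assoc (m + m) w (length S)) ⟩
        m + m + w + length S ≤⟨ <⇒≤ (≰⇒> nle) ⟩
        length ys ≡⟨ sym (length-map (parent-at M) ys) ⟩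
        length xs ≤⟨ length-minus _≟ᶠ_ {ys = S} unique-xs ⟩
        length xs₁ + length S ≤⟨ +-monoˡ-≤ (length S) (length-minus _≟ᶠ_ {ys = X} (filter⁺ (λ x → ¬? (x ∈? S)) unique-xs)) ⟩
        length xs₂ + length X + length S ≡⟨ cong (λ k → length xs₂ + k + length S) X-w ⟩
        length xs₂ + w + length S ≡⟨ +-assoc (length xs₂) w (length S) ⟩
        length xs₂ + (w + length S) ∎)
        where open ≤-Reasoning
      unique-free : Unique free
      unique-free = filter⁺ (λ f → ¬? (f ∈? filter (_∈? Pool k) (vals M))) (unique-Pool k)
      ∈-free : ∀ {f} → f ∈ free → f ∈ Pool k × f ∉ vals M
      ∈-free f∈ with f∈P , f∉ ← ∈-filter⁻ (λ f → ¬? (f ∈? filter (_∈? Pool k) (vals M))) {xs = Pool k} f∈ =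
        f∈P , λ f∈vals → f∉ (∈-filter⁺ (_∈? Pool k) f∈vals f∈P)
      free-size : m + m ≤ length free
      free-size = +-cancelˡ-≤ (used (Pool k)) (m + m) (length free) (≤-trans (room roomy)
        (≤-trans (length-minus _≟ᶠ_ {ys = filter (_∈? Pool k) (vals M)} (unique-Pool k)) (≤-reflexive (+-comm (length free) _))))
      no-link : ¬ (∃[ x ] ∃[ f ] x ∈ xs₂ × f ∈ free × Joined C x f)
      no-link (x , f , x∈ , f∈ , j) = proj₂ (∈-free f∈) (proj₂ (proj₂ (image (proj₁ (∈-filter⁻ (λ x → ¬? (x ∈? S)) {xs = xs} (proj₁ (∈-filter⁻ (λ x → ¬? (x ∈? X)) {xs = xs₁} x∈)))))) (proj₁ (∈-free f∈)) j)

    few-sent : ∀ {k} → Roomy k → length (sent k) ≤ e * D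
    few-sent {k} roomy with ys , u , sub , bound ← representatives _≟ᵐ_ par D (sent k) (fibre≤D (unique-sent k) sent-parent) =
      ≤-trans bound (*-monoˡ-≤ D (few-exhausted roomy ys u sub))

    reserve-bound : used Z ≤ e * D + e * D
    reserve-bound = begin
      used Z ≡⟨ filter-map-length (_∈? Z) proj₂ M ⟩
      length (filter (λ p → proj₂ p ∈? Z) M) ≤⟨ unique-⊆-length (filter⁺ (λ p → proj₂ p ∈? Z) (Unique-map⁻ unique-keys)) classify ⟩
      length (filter (in-reserve? kP) M ++ filter (in-reserve? kO) M) ≡⟨ length-++ (filter (in-reserve? kP) M) ⟩
      length (filter (in-reserve? kP) M) + length (filter (in-reserve? kO) M)
        ≡⟨ sym (cong₂ _+_ (length-map proj₁ (filter (in-reserve? kP) M)) (length-map proj₁ (filter (in-reserve? kO) M))) ⟩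
      length (sent kP) + length (sent kO) ≤⟨ +-mono-≤ (few-sent roomy-P) (few-sent roomy-O) ⟩
      e * D + e * D ∎
      where
      open ≤-Reasoning
      classify : ∀ {p} → p ∈ filter (λ p → proj₂ p ∈? Z) M → p ∈ filter (in-reserve? kP) M ++ filter (in-reserve? kO) M
      classify {v , y} p∈ with p∈M , y∈Z ← ∈-filter⁻ (λ p → proj₂ p ∈? Z) {xs = M} p∈ with zone-Z {M} (kind v) y∈Z (zones p∈M)
      ... | inj₁ eq = ∈-++⁺ˡ (∈-filter⁺ (in-reserve? kP) p∈M (y∈Z , eq))
      ... | inj₂ eq = ∈-++⁺ʳ (filter (in-reserve? kP) M) (∈-filter⁺ (in-reserve? kO) p∈M (y∈Z , eq))

    a>0 : 1 ≤ a
    a>0 = *-mono-≤ (≤-trans m>0 (≤-trans (m≤m+n m m) (m≤n+m (m + m) w))) D>0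

    Z-room : ∀ x → used Z < length (filter (joined? C x) Z)
    Z-room x = ≤-trans (s≤s reserve-bound) (≤-trans (≤-trans (≤-reflexive (+-comm 1 (e * D + e * D))) (+-monoʳ-≤ (e * D + e * D) a>0)) (≤-trans ζ-size (degree-Z x)))

    pool-choice : ∀ k x → ∃[ y ] y ∉ vals M × (y ∈ Pool k ⊎ (y ∈ Z × Exhausted M (Pool k) x)) × Joined C x y
    pool-choice k x with any? (λ f → joined? C x f ×-dec ¬? (f ∈? vals M)) (Pool k)
    ... | yes some with f , f∈ , j , f∉ ← find some = f , f∉ , inj₁ f∈ , j
    ... | no none with y , y∈ , y∉ ← fresh-in Z (filter⁺ (joined? C x) unique-Z) (λ y∈ → proj₁ (∈-filter⁻ (joined? C x) y∈)) (Z-room x)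
      with y∈Z , j ← ∈-filter⁻ (joined? C x) {xs = Z} y∈ = y , y∉ , inj₂ (y∈Z , exhausted) , j
      where
      exhausted : Exhausted M (Pool k) x
      exhausted {f} f∈ jf with f ∈? vals M
      ... | yes f∈vals = f∈vals
      ... | no f∉ = contradiction (lose f∈ (jf , f∉)) none

  number-U : number kU ≤ suc w
  number-U = ≤-trans (≤-reflexive (sym (length-map just (filter (λ v → kind v ≟ᵏ kU) (allFin n)))))
    (≤-trans (unique-⊆-length {ys = map grand L⋆} (map⁺ just-injective (filter⁺ (λ v → kind v ≟ᵏ kU) (allFin⁺ n))) grandparents)
      (≤-reflexive (≡-trans (length-map grand L⋆) length-L⋆)))
    where
    grand : V → Maybe V
    grand t with par t
    ... | just p = par p
    ... | nothing = nothing
    grand-just : ∀ {t p u} → par t ≡ just p → par p ≡ just u → grand t ≡ just u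
    grand-just {t} eq eq′ with par t
    grand-just refl eq′ | just p = eq′
    grandparents : ∀ {b} → b ∈ map just (filter (λ v → kind v ≟ᵏ kU) (allFin n)) → b ∈ map grand L⋆
    grandparents b∈ with v , v∈ , refl ← ∈-map⁻ just b∈ with kind v | proj₂ (∈-filter⁻ (λ v → kind v ≟ᵏ kU) {xs = allFin n} v∈) | view v
    ... | .kU | refl | vU _ u with t , t∈ , ps ← find u with p , _ , eq , eq′ ← find ps = subst (_∈ map grand L⋆) (grand-just eq eq′) (∈-map⁺ grand t∈)

  kind-c1 : ∀ {v} → col v ≡ c1 → kind v ≡ kQ ⊎ kind v ≡ kO
  kind-c1 {v} eq with col v
  kind-c1 {v} refl | .c1 with does (isQ? v)
  ... | true = inj₁ refl
  ... | false = inj₂ refl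

  S-large : σ ≤ length S
  S-large with v , v∈ ← nonempty-member {xs = A′} (≤-trans m>0 (≤-trans (≤-trans (m≤m+n m m) (m≤n+m (m + m) λₗ)) A-size)) =
    ≤-trans (degree-S (inj₁ (proj₁ (A′⊆A v∈) , proj₁ (proj₂ (A′⊆A v∈))))) (length-filter (joined? C v) S)

  module Place {v vs M} (ord : Ordered par vs) (v∉ : v ∉ vs) (closed : ∀ {u} → par v ≡ just u → u ∈ vs) (P : Partial vs M) where
    open Partial P
    open Counting P
    open Reserve P

    Next : Set
    Next = ∃[ M′ ] Partial (v ∷ vs) M′

    kind-≢ : ∀ {k k′} → kind v ≡ k → k ≢ k′ → kind v ≢ k′
    kind-≢ refl k≢ = k≢

    parent-functional : ∀ {x x′} → ParentAt M v x → ParentAt M v x′ → x ≡ x′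
    parent-functional pa pa′ = ≡-trans (sym (parent-at-placed unique-keys pa)) (parent-at-placed unique-keys pa′)

    not-P⋆ : ∀ {A : Set} → kind v ≢ kP → IsP⋆ v → A
    not-P⋆ ≢P p⋆ with t , t∈ , eq ← find p⋆ = contradiction (kind-P (L⋆⊆L t∈) eq) ≢P

    not-Q : ∀ {A : Set} {t} → kind v ≢ kQ → t ∈ L⋆ → par v ≡ just t → A
    not-Q ≢Q t∈ eq = contradiction (kind-Q (L⋆⊆L t∈) eq) ≢Q

    parent-image : ∀ {u} → kind v ≢ kQ → par v ≡ just u → ∃[ x ] (u , x) ∈ M
    parent-image {u} ≢Q eq = placed (closed eq) not-L
      where
      not-L : kind u ≢ kL
      not-L isL with kind u | isL | view u
      ... | .kL | refl | vL u∈ = ≢Q (kind-Q u∈ eq)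

    no-parent : ∀ {A : Set} {x} → par v ≡ nothing → ParentAt M v x → A
    no-parent eq (_ , eq′ , _) = case ≡-trans (sym eq) eq′ of λ ()

    clash : ∀ {y} {A : Set} (l : Loc y) → y ∈ Z → tag l ≢ tZ → A
    clash l y∈ ≢Z = contradiction (in-Z y∈ l) ≢Z

    from-pool : ∀ k → Roomy k → kind v ≡ k → ∀ {x} → ParentAt M v x →
      (∀ {y} → (y ∈ Pool k ⊎ y ∈ Z) → Zone M k v y) → (IsP⋆ v → Exhausted M X x) → Next
    from-pool k roomy kv {x} pa zone ex-P⋆ with pool-choice k x
    ... | y , y∉ , where-y , j = _ , place-at ord v∉ P closed (λ eq → not-roomy-L roomy (≡-trans (sym kv) eq)) y∉
            (subst (λ k → Zone M k v y) (sym kv) (zone ([ inj₁ , inj₂ ∘ proj₁ ]′ where-y)))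
            (λ pa′ → subst (λ x → Joined C x y) (parent-functional pa pa′) j)
            (λ y∈Z → x , pa , subst (λ k → Exhausted M (Pool k) x) (sym kv) (exhausted where-y y∈Z))
            (λ p⋆ → inj₂ λ pa′ → subst (Exhausted M X) (parent-functional pa pa′) (ex-P⋆ p⋆))
            (λ t∈ eq → not-Q (λ eq′ → not-roomy-Q roomy (≡-trans (sym kv) eq′)) t∈ eq)
      where
      not-roomy-L : ∀ {k} → Roomy k → k ≢ kL
      not-roomy-L roomy-P ()
      not-roomy-L roomy-O ()
      not-roomy-Q : ∀ {k} → Roomy k → k ≢ kQ
      not-roomy-Q roomy-P ()
      not-roomy-Q roomy-O ()
      pool-off-Z : ∀ {k} → Roomy k → y ∈ Pool k → y ∉ Z
      pool-off-Z roomy-P y∈ y∈Z = clash (inFA y∈) y∈Z λ ()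
      pool-off-Z roomy-O y∈ y∈Z = clash (inFO y∈) y∈Z λ ()
      exhausted : (y ∈ Pool k ⊎ (y ∈ Z × Exhausted M (Pool k) x)) → y ∈ Z → Exhausted M (Pool k) x
      exhausted (inj₁ y∈) y∈Z = contradiction y∈Z (pool-off-Z roomy y∈)
      exhausted (inj₂ (_ , ex)) _ = ex

    place-O : kind v ≡ kO → Next
    place-O kv = go (par v) refl
      where
      go : ∀ b → par v ≡ b → Next
      go nothing eq with y , y∈ , y∉ ← fresh-in FO unique-FO id (≤-trans (s≤s (used-in FO {tFO} (λ ()) in-FO)) (≤-trans (≤-trans (≤-reflexive (+-comm 1 (number kO))) (+-monoʳ-≤ (number kO) (≤-trans m>0 (m≤m+n m m)))) FO-size)) =
        _ , place-at ord v∉ P closed (kind-≢ kv λ ()) y∉ (subst (λ k → Zone M k v y) (sym kv) (inj₁ y∈))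
          (no-parent eq) (λ y∈Z → clash (inFO y∈) y∈Z λ ()) (not-P⋆ (kind-≢ kv λ ()))
          (not-Q (kind-≢ kv λ ()))
      go (just u) eq with x , ux∈ ← parent-image (kind-≢ kv λ ()) eq =
        from-pool kO roomy-O kv (u , eq , ux∈) id (not-P⋆ (kind-≢ kv λ ()))

    place-P : kind v ≡ kP → IsP v → Next
    place-P kv isP with t , t∈ , eq ← find isP with p , u , eq₁ , eq₂ ← L-parent t∈ with refl ← just-injective (≡-trans (sym eq) eq₁)
      with x , ux∈ ← parent-image (kind-≢ kv λ ()) eq₂
      with isP⋆? v | any? (λ f → joined? C x f ×-dec ¬? (f ∈? vals M)) X
    ... | no ¬p⋆ | _ = from-pool kP roomy-P kv (u , eq₂ , ux∈) [ inj₁ , inj₂ ∘ inj₁ ]′ (λ p⋆ → contradiction p⋆ ¬p⋆)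
    ... | yes p⋆ | yes some with f , f∈ , j , f∉ ← find some = _ , place-at ord v∉ P closed (kind-≢ kv λ ()) f∉
        (subst (λ k → Zone M k v f) (sym kv) (inj₂ (inj₂ (f∈ , p⋆))))
        (λ pa → subst (λ x → Joined C x f) (parent-functional (u , eq₂ , ux∈) pa) j)
        (λ f∈Z → contradiction f∈ (Z∉X f∈Z)) (λ _ → inj₁ f∈) (not-Q (kind-≢ kv λ ()))
    ... | yes p⋆ | no none = from-pool kP roomy-P kv (u , eq₂ , ux∈) [ inj₁ , inj₂ ∘ inj₁ ]′ (λ _ → exhausted)
      where
      exhausted : Exhausted M X x
      exhausted {f} f∈ j with f ∈? vals M
      ... | yes f∈vals = f∈vals
      ... | no f∉ = contradiction (lose f∈ (j , f∉)) none

    place-in-S : kind v ≡ kU → ∀ {y} → y ∈ S → y ∉ vals M → (∀ {x} → ParentAt M v x → Joined C x y) → Next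
    place-in-S kv {y} y∈ y∉ j = _ , place-at ord v∉ P closed (kind-≢ kv λ ()) y∉ (subst (λ k → Zone M k v y) (sym kv) y∈) j
      (λ y∈Z → clash (inS (S⊆S y∈)) y∈Z λ ()) (not-P⋆ (kind-≢ kv λ ())) (not-Q (kind-≢ kv λ ()))

    S-room : used S < σ
    S-room = ≤-trans (s≤s (≤-trans (used-in S {tS} (λ ()) (λ y∈ → in-S (S⊆S y∈))) number-U)) σ-size

    typed-zone : ∀ {u x} k → k ≡ kQ ⊎ k ≡ kO → Zone M k u x → (part x ≡ pA × x ∉ X) ⊎ part x ≡ pB
    typed-zone kQ _ (inj₁ x∈) = inj₂ (proj₁ (B′⊆B (FB-B′ x∈)))
    typed-zone kQ _ (inj₂ (_ , _ , _ , z∈ , refl , _)) = inj₂ (partner-B z∈)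
    typed-zone kO _ (inj₁ x∈) = [ (λ (x∈A , _) → inj₁ (proj₁ (A′⊆A x∈A) , proj₁ (proj₂ (A′⊆A x∈A)))) , (λ (x∈B , _) → inj₂ (proj₁ (B′⊆B x∈B))) ]′ (FO-pools x∈)
    typed-zone kO _ (inj₂ x∈) = inj₁ (Z⊆A x∈ , Z∉X x∈)
    typed-zone kL (inj₁ ())
    typed-zone kL (inj₂ ())
    typed-zone kP (inj₁ ())
    typed-zone kP (inj₂ ())
    typed-zone kU (inj₁ ())
    typed-zone kU (inj₂ ())
    typed : ∀ {u x} → (u , x) ∈ M → kind u ≡ kQ ⊎ kind u ≡ kO → (part x ≡ pA × x ∉ X) ⊎ part x ≡ pB
    typed {u} ux∈ ku = typed-zone (kind u) ku (zones ux∈)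

    place-U : kind v ≡ kU → col v ≡ c2 → Next
    place-U kv cv = go (par v) refl
      where
      go : ∀ b → par v ≡ b → Next
      go nothing eq with y , y∈ , y∉ ← fresh-in S unique-S id (<-≤-trans S-room S-large) = place-in-S kv y∈ y∉ (no-parent eq)
      go (just u) eq with x , ux∈ ← parent-image (kind-≢ kv λ ()) eq
          with y , y∈ , y∉ ← fresh-in S (filter⁺ (joined? C x) unique-S) (λ y∈ → proj₁ (∈-filter⁻ (joined? C x) y∈)) (<-≤-trans S-room (degree-S (typed ux∈ (kind-c1 (before-c2 (≡-trans (sym cv) (col-par eq)))))))
          with y∈S , j ← ∈-filter⁻ (joined? C x) {xs = S} y∈ =
        place-in-S kv y∈S y∉ (λ pa → subst (λ x → Joined C x y) (parent-functional (u , eq , ux∈) pa) j)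

    leaf-unplaced : ∀ {A : Set} {t u z} → t ∈ L → par v ≡ just t → par v ≡ just u → (u , z) ∈ M → A
    leaf-unplaced t∈ eq eq′ uz∈ with refl ← just-injective (≡-trans (sym eq) eq′) = contradiction (kind-L t∈) (proj₂ (keys⊆ uz∈))

    free-Q : kind v ≡ kQ → ∀ {t} → t ∈ L → par v ≡ just t →
      (∀ {t p x y} → t ∈ L⋆ → par v ≡ just t → par t ≡ just p → (p , x) ∈ M → x ∈ X → y ≡ partner x) → Next
    free-Q kv t∈ eq none with y , y∈ , y∉ ← fresh-in FB unique-FB id (≤-trans (s≤s (used-in FB {tFB} (λ ()) in-FB)) (≤-trans (≤-trans (≤-reflexive (+-comm 1 (number kQ))) (+-monoʳ-≤ (number kQ) (≤-trans m>0 (m≤m+n m m)))) FB-size)) =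
      _ , place-at ord v∉ P closed (kind-≢ kv λ ()) y∉ (subst (λ k → Zone M k v y) (sym kv) (inj₁ y∈))
        (λ (_ , eq′ , uz∈) → leaf-unplaced t∈ eq eq′ uz∈) (λ y∈Z → clash (inFB y∈) y∈Z λ ()) (not-P⋆ (kind-≢ kv λ ())) none

    place-Q : kind v ≡ kQ → IsQ v → Next
    place-Q kv isQ with t , t∈ , eq ← find isQ with p , _ , eq₁ , _ ← L-parent t∈
      with x , px∈ ← placed (Ordered-parent ord (closed eq) eq₁) (λ isL → case ≡-trans (sym (kind-P t∈ eq₁)) isL of λ ())
      with t ∈? L⋆ | x ∈? X
    ... | yes t∈⋆ | yes x∈ = _ , place-at ord v∉ P closed (kind-≢ kv λ ()) fresh
        (subst (λ k → Zone M k v (partner x)) (sym kv) (inj₂ (x , t , p , x∈ , refl , t∈⋆ , eq , eq₁ , px∈)))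
        (λ (_ , eq′ , uz∈) → leaf-unplaced t∈ eq eq′ uz∈) (λ y∈Z → part-clash (Z⊆A y∈Z) (partner-B x∈) A≢B) (not-P⋆ (kind-≢ kv λ ()))
        same-partner
      where
      same-partner : ∀ {t′ p′ x′} → t′ ∈ L⋆ → par v ≡ just t′ → par t′ ≡ just p′ → (p′ , x′) ∈ M → x′ ∈ X → partner x ≡ partner x′
      same-partner _ eq′ eq₁′ px′∈ _ with refl ← just-injective (≡-trans (sym eq) eq′) with refl ← just-injective (≡-trans (sym eq₁) eq₁′) = cong partner (key-functional unique-keys px∈ px′∈)
      taken : ∀ {v′} k → (v′ , partner x) ∈ M → k ≡ kQ → Zone M k v′ (partner x) → ⊥
      taken kQ _ _ (inj₁ y∈) = case in-Y x∈ (inFB y∈) of λ ()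
      taken kQ v′y∈ _ (inj₂ (x′ , t′ , p′ , x′∈ , y≡ , t′∈ , eq′ , eq₁′ , px′∈)) with refl ← partner-injective x∈ x′∈ y≡
        with refl ← val-functional unique-vals px∈ px′∈ with refl ← Unique-map-injective unique-par-L⋆ t∈⋆ t′∈ (≡-trans eq₁ (sym eq₁′))
        with refl ← only-child t∈ eq eq′ = v∉ (proj₁ (keys⊆ v′y∈))
      fresh : partner x ∉ vals M
      fresh y∈ with v′ , v′y∈ ← ∈-vals y∈ = taken (kind v′) v′y∈ (zone-kind {M} (kind v′) (in-Y x∈) (λ ()) (zones v′y∈)) (zones v′y∈)
    ... | no t∉⋆ | _ = free-Q kv t∈ eq (λ t′∈ eq′ _ _ _ → contradiction (subst (_∈ L⋆) (just-injective (≡-trans (sym eq′) eq)) t′∈) t∉⋆)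
    ... | yes _ | no x∉ = free-Q kv t∈ eq λ _ eq′ eq₁′ px′∈ x′∈ → contradiction (subst (_∈ X)
        (key-functional unique-keys (subst (λ u → (u , _) ∈ M) (just-injective (≡-trans (sym eq₁′) (≡-trans (cong par (just-injective (≡-trans (sym eq′) eq))) eq₁))) px′∈) px∈) x′∈) x∉

    place : Next
    place with kind v in kv | view v
    ... | kL | _ = M , skip ord v∉ P kv
    ... | kP | vP isP = place-P kv isP
    ... | kQ | vQ isQ = place-Q kv isQ
    ... | kU | vU cv _ = place-U kv cv
    ... | kO | _ = place-O kv

  embed : ∀ {vs} → Ordered par vs → ∃[ M ] Partial vs M
  embed [] = [] , empty
  embed (insert v∉ closed ord) = Place.place ord v∉ closed (proj₂ (embed ord))

  module Finish {M} (P : Partial order M) where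
    open Partial P
    open Counting P
    open Reserve P

    R : List V
    R = filter (λ v → ¬? (v ∈? vals M)) (allFin n)

    ∈-R : ∀ {v} → v ∈ R → v ∉ vals M
    ∈-R v∈ = proj₂ (∈-filter⁻ (λ v → ¬? (v ∈? vals M)) {xs = allFin n} v∈)

    R-∈ : ∀ {v} → v ∉ vals M → v ∈ R
    R-∈ v∉ = ∈-filter⁺ (λ v → ¬? (v ∈? vals M)) (∈-allFin _) v∉

    unique-R : Unique R
    unique-R = filter⁺ (λ v → ¬? (v ∈? vals M)) (allFin⁺ n)

    image : ∀ {v} → kind v ≢ kL → (v , at M v) ∈ M
    image {v} ≢L with y , p∈ ← placed (complete v) ≢L = subst (λ y → (v , y) ∈ M) (sym (at-placed unique-keys p∈)) p∈

    P≢L : ∀ {t p} → t ∈ L → par t ≡ just p → kind p ≢ kL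
    P≢L t∈ eq isL = case ≡-trans (sym (kind-P t∈ eq)) isL of λ ()

    Q≢L : ∀ {t q} → t ∈ L → par q ≡ just t → kind q ≢ kL
    Q≢L t∈ eq isL = case ≡-trans (sym (kind-Q t∈ eq)) isL of λ ()

    parent-at-just : ∀ {t p} → par t ≡ just p → parent-at M t ≡ at M p
    parent-at-just {t} eq with par t
    parent-at-just refl | just _ = refl

    parent-image : ∀ {t} → t ∈ L → ∃[ p ] par t ≡ just p × (p , parent-at M t) ∈ M
    parent-image {t} t∈ with p , _ , eq , _ ← L-parent t∈ = p , eq , subst (λ x → (p , x) ∈ M) (sym (parent-at-just eq)) (image (P≢L t∈ eq))

    parent-part : ∀ {t} → t ∈ L → part (parent-at M t) ≡ pA
    parent-part {t} t∈ with p , eq , px∈ ← parent-image t∈ = in-A (kind p) (kind-P t∈ eq) (zones px∈)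
      where
      in-A : ∀ k → k ≡ kP → Zone M k p (parent-at M t) → part (parent-at M t) ≡ pA
      in-A kP _ (inj₁ x∈) = proj₁ (A′⊆A (FA-A′ x∈))
      in-A kP _ (inj₂ (inj₁ x∈)) = Z⊆A x∈
      in-A kP _ (inj₂ (inj₂ (x∈ , _))) = X⊆A x∈

    child-part : ∀ {t q} → t ∈ L → par q ≡ just t → part (at M q) ≡ pB
    child-part {t} {q} t∈ eq = in-B (kind q) (kind-Q t∈ eq) (zones (image (Q≢L t∈ eq)))
      where
      in-B : ∀ k → k ≡ kQ → Zone M k q (at M q) → part (at M q) ≡ pB
      in-B kQ _ (inj₁ y∈) = proj₁ (B′⊆B (FB-B′ y∈))
      in-B kQ _ (inj₂ (x , _ , _ , x∈ , y≡ , _)) = ≡-trans (cong part y≡) (partner-B x∈)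

    H : V → V → Set
    H t r = Joined C (parent-at M t) r × All (λ q → Joined C (at M q) r) (children t)

    H? : ∀ t r → Dec (H t r)
    H? t r = joined? C (parent-at M t) r ×-dec all? (λ q → joined? C (at M q) r) (children t)

    child-parent : ∀ {t q} → q ∈ children t → par q ≡ just t
    child-parent {t} q∈ = proj₂ (∈-filter⁻ (λ v → par v ≟ᵐ just t) {xs = allFin n} q∈)

    from-Z : ∀ {t} {Q : Pred V 0ℓ} (Q? : Decidable Q) → ζ ≤ length (filter Q? Z) → (∀ {z} → Q z → H t z) → a ≤ length (filter (H? t) R)
    from-Z {t} Q? ζ≤ good-z = +-cancelˡ-≤ (e * D + e * D) a _ (begin
      e * D + e * D + a ≤⟨ ≤-trans ζ-size ζ≤ ⟩
      length (filter Q? Z) ≤⟨ length-minus _≟ᶠ_ {ys = filter (_∈? Z) (vals M)} (filter⁺ Q? unique-Z) ⟩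
      length (filter (λ z → ¬? (z ∈? filter (_∈? Z) (vals M))) (filter Q? Z)) + used Z ≤⟨ +-mono-≤ (unique-⊆-length (filter⁺ (λ z → ¬? (z ∈? filter (_∈? Z) (vals M))) (filter⁺ Q? unique-Z)) free) reserve-bound ⟩
      length (filter (H? t) R) + (e * D + e * D) ≡⟨ +-comm (length (filter (H? t) R)) (e * D + e * D) ⟩
      e * D + e * D + length (filter (H? t) R) ∎)
      where
      open ≤-Reasoning
      free : ∀ {z} → z ∈ filter (λ z → ¬? (z ∈? filter (_∈? Z) (vals M))) (filter Q? Z) → z ∈ filter (H? t) R
      free z∈ with z∈Q , z∉ ← ∈-filter⁻ (λ z → ¬? (z ∈? filter (_∈? Z) (vals M))) {xs = filter Q? Z} z∈ with z∈Z , q ← ∈-filter⁻ Q? {xs = Z} z∈Q =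
        ∈-filter⁺ (H? t) (R-∈ (λ z∈vals → z∉ (∈-filter⁺ (_∈? Z) z∈vals z∈Z))) (good-z q)

    degree-L : ∀ {t} → t ∈ L → a ≤ length (filter (H? t) R)
    degree-L {t} t∈ with any? (λ q → par q ≟ᵐ just t) (allFin n)
    ... | no childless = from-Z (joined? C (parent-at M t)) (degree-Z (parent-at M t))
            (λ j → j , All-tabulate (λ q∈ → contradiction (lose (∈-allFin _) (child-parent q∈)) childless))
    ... | yes some with q , _ , eq ← find some = from-Z (λ z → joined? C (parent-at M t) z ×-dec joined? C (at M q) z) (codegree-Z (parent-part t∈) (child-part t∈ eq))
            (λ (j , j′) → j , All-tabulate (λ q′∈ → subst (λ q → Joined C (at M q) _) (only-child t∈ eq (child-parent q′∈)) j′))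

    unique-images : ∀ {ts} → Unique (map par ts) → (∀ {t} → t ∈ ts → t ∈ L) → Unique (map (parent-at M) ts)
    unique-images {ts} u ts⊆L = Unique-map-on inj (Unique-map⁻ u)
      where
      inj : ∀ {t t′} → t ∈ ts → t′ ∈ ts → parent-at M t ≡ parent-at M t′ → t ≡ t′
      inj t∈ t′∈ eq with p , eq₁ , px∈ ← parent-image (ts⊆L t∈) | p′ , eq₂ , px′∈ ← parent-image (ts⊆L t′∈)
        with refl ← val-functional unique-vals px∈ (subst (λ x → (p′ , x) ∈ M) (sym eq) px′∈) = Unique-map-injective u t∈ t′∈ (≡-trans eq₁ (sym eq₂))

    image-of-X : ∀ {x} → x ∈ X → x ∈ vals M → ∃[ t ] t ∈ L⋆ × parent-at M t ≡ x × (∀ {q} → par q ≡ just t → at M q ≡ partner x)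
    image-of-X x∈ x∈vals with p , px∈ ← ∈-vals x∈vals with _ , p⋆ ← zone-X {M} (kind p) x∈ (zones px∈) with t , t∈ , eq ← find p⋆ =
      t , t∈ , ≡-trans (parent-at-just eq) (at-placed unique-keys px∈)
      , λ eq′ → partner-rule (image (Q≢L (L⋆⊆L t∈) eq′)) t∈ eq′ eq px∈ x∈

    -- Since |L⋆| > |X|, some parent did not fit into X; then the neighbourhood in X of the image of its own parent is used up.
    saturated : ∃[ u ] part u ≡ pS × u ∈ vals M × Exhausted M X u
    saturated with x , x∈ , x∉ ← exists-fresh _≟ᶠ_ {ys = X} (unique-images unique-par-L⋆ L⋆⊆L) (≤-reflexive (≡-trans (cong suc X-w) (≡-trans (sym length-L⋆) (sym (length-map (parent-at M) L⋆)))))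
      with t , t∈ , refl ← ∈-map⁻ (parent-at M) x∈ with p , u , eq , eq′ ← L-parent (L⋆⊆L t∈)
      with P⋆-rule (image (P≢L (L⋆⊆L t∈) eq)) (lose t∈ eq)
    ... | inj₁ in-x = contradiction (subst (_∈ X) (sym (parent-at-just eq)) in-x) x∉
    ... | inj₂ ex = at M u , S⊆S (in-S-zone (kind u) (kind-U t∈ eq eq′) (zones u∈)) , ∈-map⁺ proj₂ u∈ , ex (u , eq′ , u∈)
      where
      u∈ : (u , at M u) ∈ M
      u∈ = image (λ isL → case ≡-trans (sym (kind-U t∈ eq eq′)) isL of λ ())
      in-S-zone : ∀ k → k ≡ kU → Zone M k u (at M u) → at M u ∈ S
      in-S-zone kU _ y∈ = y∈

    degree-R : ∀ {v} → v ∈ R → m + m ≤ length (filter (λ t → H? t v) L)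
    degree-R {v} v∈ with u , pu , u∈ , ex ← saturated = ≤-trans (proj₂ good pu (λ { refl → ∈-R v∈ u∈ }))
      (≤-trans (unique-⊆-length (filter⁺ (λ x → joined? C u x ×-dec joined-to-both? C v x) unique-X) covering)
        (≤-reflexive (length-map (parent-at M) (filter (λ t → H? t v) L))))
      where
      covering : ∀ {x} → x ∈ filter (λ x → joined? C u x ×-dec joined-to-both? C v x) X → x ∈ map (parent-at M) (filter (λ t → H? t v) L)
      covering x∈ with x∈X , ux , vx , vy ← ∈-filter⁻ (λ x → joined? C u x ×-dec joined-to-both? C v x) {xs = X} x∈
        with t , t∈ , refl , partners ← image-of-X x∈X (ex x∈X ux) =
        ∈-map⁺ (parent-at M) (∈-filter⁺ (λ t → H? t v) (L⋆⊆L t∈)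
          (Joined-sym {u = v} vx , All-tabulate (λ {q} q∈ → subst (λ y → Joined C y v) (sym (partners (child-parent q∈))) (Joined-sym {u = v} vy))))

    child-of : V → V
    child-of t with any? (λ q → par q ≟ᵐ just t) (allFin n)
    ... | yes some = proj₁ (find some)
    ... | no _ = t

    child-of-par : ∀ {t} → Any (λ q → par q ≡ just t) (allFin n) → par (child-of t) ≡ just t
    child-of-par {t} has with any? (λ q → par q ≟ᵐ just t) (allFin n)
    ... | yes some = proj₂ (proj₂ (find some))
    ... | no none = contradiction has none

    module _ {ts : List V} (unique-par : Unique (map par ts)) (ts⊆L : ∀ {t} → t ∈ ts → t ∈ L) (off-X : ∀ {t} → t ∈ ts → parent-at M t ∉ X) (big : m ≤ length ts)
      {Y : List V} (unique-Y : Unique Y) (Y⊆R : ∀ {v} → v ∈ Y → v ∈ R) (Y-big : m + m ≤ length Y) where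

      private
        image-∉Y : ∀ {x} → x ∈ vals M → x ∉ Y
        image-∉Y x∈ x∈Y = ∈-R (Y⊆R x∈Y) x∈

      childless-link : (∀ {t} → t ∈ ts → ¬ Any (λ q → par q ≡ just t) (allFin n)) → ∃[ t ] ∃[ v ] t ∈ ts × v ∈ Y × H t v
      childless-link childless with x , v , x∈ , v∈ , j ← link (unique-images unique-par ts⊆L) unique-Y (≤-trans big (≤-reflexive (sym (length-map (parent-at M) ts)))) Y-big
          (λ x∈ → case ∈-map⁻ (parent-at M) x∈ of λ { (t , t∈ , refl) → image-∉Y (∈-map⁺ proj₂ (proj₂ (proj₂ (parent-image (ts⊆L t∈))))) })
          (inj₁ λ x∈ → case ∈-map⁻ (parent-at M) x∈ of λ { (t , t∈ , refl) → parent-part (ts⊆L t∈) , off-X t∈ })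
        with t , t∈ , refl ← ∈-map⁻ (parent-at M) x∈ = t , v , t∈ , v∈ , j , All-tabulate (λ q∈ → contradiction (lose (∈-allFin _) (child-parent q∈)) (childless t∈))

      module _ (with-child : ∀ {t} → t ∈ ts → Any (λ q → par q ≡ just t) (allFin n)) where

        private
          ts′ : List V
          ts′ = take m ts

          both : V → V × V
          both t = parent-at M t , at M (child-of t)

          child-par : ∀ {t} → t ∈ ts → par (child-of t) ≡ just t
          child-par t∈ = child-of-par (with-child t∈)

          child-image : ∀ {t} → t ∈ ts → (child-of t , at M (child-of t)) ∈ M
          child-image t∈ = image (Q≢L (ts⊆L t∈) (child-par t∈))

          in-ts : ∀ {t} → t ∈ ts′ → t ∈ ts
          in-ts = ∈-take m

          first : Unique (map proj₁ (map both ts′))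
          first = subst Unique (map-∘ ts′) (Unique-map-on
            (λ t∈ t′∈ → Unique-map-injective (unique-images unique-par ts⊆L) (in-ts t∈) (in-ts t′∈)) (take⁺ m (Unique-map⁻ unique-par)))

          second-unique : Unique (map proj₂ (map both ts′))
          second-unique = subst Unique (map-∘ ts′) (Unique-map-on inj (take⁺ m (Unique-map⁻ unique-par)))
            where
            inj : ∀ {t t′} → t ∈ ts′ → t′ ∈ ts′ → at M (child-of t) ≡ at M (child-of t′) → t ≡ t′
            inj t∈ t′∈ eq = just-injective (≡-trans (sym (child-par (in-ts t∈))) (≡-trans
              (cong par (val-functional unique-vals (child-image (in-ts t∈)) (subst (λ y → (child-of _ , y) ∈ M) (sym eq) (child-image (in-ts t′∈))))) (child-par (in-ts t′∈))))

          geometry : ∀ {x y qs} → (∀ {q} → q ∈ qs → q ∈ Y) → (x , y) ∈ map both ts′ → part x ≡ pA × x ∉ X × part y ≡ pB × x ∉ qs × y ∉ qs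
          geometry qs⊆Y p∈ with t , t∈ , refl ← ∈-map⁻ both p∈ =
            parent-part (ts⊆L (in-ts t∈)) , off-X (in-ts t∈) , child-part (ts⊆L (in-ts t∈)) (child-par (in-ts t∈))
            , (λ x∈ → image-∉Y (∈-map⁺ proj₂ (proj₂ (proj₂ (parent-image (ts⊆L (in-ts t∈)))))) (qs⊆Y x∈))
            , (λ y∈ → image-∉Y (∈-map⁺ proj₂ (child-image (in-ts t∈))) (qs⊆Y y∈))

          one-side : ∀ b (qs : List V) → Unique qs → m ≤ length qs → (∀ {q} → q ∈ qs → q ∈ Y × sideOf q ≡ b) → ∃[ t ] ∃[ v ] t ∈ ts × v ∈ Y × H t v
          one-side b qs uq big-q qs⊆ with x , y , v , p∈ , v∈ , j , j′ ← pairs (≡-trans (length-map both ts′) (length-take-≤ m big)) (length-take-≤ m big-q) first second-unique (take⁺ m uq)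
              (geometry (λ q∈ → proj₁ (qs⊆ (∈-take m q∈)))) b (λ q∈ → proj₂ (qs⊆ (∈-take m q∈)))
            with t , t∈ , refl ← ∈-map⁻ both p∈ = t , v , in-ts t∈ , proj₁ (qs⊆ (∈-take m v∈)) , j
              , All-tabulate (λ q∈ → subst (λ q → Joined C (at M q) v) (only-child (ts⊆L (in-ts t∈)) (child-par (in-ts t∈)) (child-parent q∈)) j′)

        child-link : ∃[ t ] ∃[ v ] t ∈ ts × v ∈ Y × H t v
        child-link with majority (λ v → sideOf v ≟ᵇ true) Y Y-big
        ... | inj₁ big-q = one-side true (filter (λ v → sideOf v ≟ᵇ true) Y) (filter⁺ (λ v → sideOf v ≟ᵇ true) unique-Y) big-q (λ q∈ → ∈-filter⁻ (λ v → sideOf v ≟ᵇ true) {xs = Y} q∈)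
        ... | inj₂ big-q = one-side false (filter (λ v → ¬? (sideOf v ≟ᵇ true)) Y) (filter⁺ (λ v → ¬? (sideOf v ≟ᵇ true)) unique-Y) big-q
            (λ {q} q∈ → let q∈Y , ≢t = ∈-filter⁻ (λ v → ¬? (sideOf v ≟ᵇ true)) {xs = Y} q∈ in q∈Y , ¬-not {sideOf q} ≢t)

    has-child? : Decidable (λ t → Any (λ q → par q ≡ just t) (allFin n))
    has-child? t = any? (λ q → par q ≟ᵐ just t) (allFin n)

    linked : ∀ {ts Y} → Unique ts → Unique Y → (∀ {t} → t ∈ ts → t ∈ L) → (∀ {v} → v ∈ Y → v ∈ R) → a ≤ length ts → m + m ≤ length Y → ∃[ t ] ∃[ v ] t ∈ ts × v ∈ Y × H t v
    linked {ts} {Y} u-ts uY ts⊆L Y⊆R a≤ Y-big with us , u-par , us⊆ , bound ← representatives _≟ᵐ_ par D ts (fibre≤D u-ts (L-has-parent ∘ ts⊆L)) = split (majority has-child? os os-big)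
      where
      in-X? : Decidable (λ t → parent-at M t ∈ X)
      in-X? t = parent-at M t ∈? X
      os : List V
      os = filter (¬? ∘ in-X?) us
      os-props : ∀ {t} → t ∈ os → t ∈ us × parent-at M t ∉ X
      os-props = ∈-filter⁻ (¬? ∘ in-X?) {xs = us}
      u-os : Unique (map par os)
      u-os = Unique-map-filter (¬? ∘ in-X?) u-par
      few-in-X : length (filter in-X? us) ≤ w
      few-in-X = ≤-trans (≤-reflexive (sym (length-map (parent-at M) (filter in-X? us))))
        (≤-trans (unique-⊆-length {ys = X} (unique-images (Unique-map-filter in-X? u-par) (λ t∈ → ts⊆L (us⊆ (proj₁ (∈-filter⁻ in-X? {xs = us} t∈)))))
          (λ x∈ → case ∈-map⁻ (parent-at M) x∈ of λ { (t , t∈ , refl) → proj₂ (∈-filter⁻ in-X? {xs = us} t∈) })) (≤-reflexive X-w))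
      os-big : m + m ≤ length os
      os-big = +-cancelˡ-≤ w (m + m) (length os) (begin
        w + (m + m) ≤⟨ *-cancelʳ-≤ (w + (m + m)) (length us) D {{>-nonZero D>0}} (≤-trans a≤ bound) ⟩
        length us ≡⟨ sym (length-filter-split in-X? us) ⟩
        length (filter in-X? us) + length os ≤⟨ +-monoˡ-≤ (length os) few-in-X ⟩
        w + length os ∎)
        where open ≤-Reasoning
      split : m ≤ length (filter has-child? os) ⊎ m ≤ length (filter (¬? ∘ has-child?) os) → ∃[ t ] ∃[ v ] t ∈ ts × v ∈ Y × H t v
      split (inj₁ big) with t , v , t∈ , rest ← child-link (Unique-map-filter has-child? u-os) (λ t∈ → ts⊆L (us⊆ (proj₁ (os-props (proj₁ (∈-filter⁻ has-child? {xs = os} t∈))))))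
          (λ t∈ → proj₂ (os-props (proj₁ (∈-filter⁻ has-child? {xs = os} t∈)))) big uY Y⊆R Y-big (λ t∈ → proj₂ (∈-filter⁻ has-child? {xs = os} t∈))
        = t , v , us⊆ (proj₁ (os-props (proj₁ (∈-filter⁻ has-child? {xs = os} t∈)))) , rest
      split (inj₂ big) with t , v , t∈ , rest ← childless-link (Unique-map-filter (¬? ∘ has-child?) u-os) (λ t∈ → ts⊆L (us⊆ (proj₁ (os-props (proj₁ (∈-filter⁻ (¬? ∘ has-child?) {xs = os} t∈))))))
          (λ t∈ → proj₂ (os-props (proj₁ (∈-filter⁻ (¬? ∘ has-child?) {xs = os} t∈)))) big uY Y⊆R Y-big (λ t∈ → proj₂ (∈-filter⁻ (¬? ∘ has-child?) {xs = os} t∈))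
        = t , v , us⊆ (proj₁ (os-props (proj₁ (∈-filter⁻ (¬? ∘ has-child?) {xs = os} t∈)))) , rest

    private
      keys∌L : ∀ {t} → t ∈ keys M → t ∉ L
      keys∌L t∈ t∈L with (_ , y) , p∈ , refl ← ∈-map⁻ proj₁ t∈ = proj₂ (keys⊆ p∈) (kind-L t∈L)

      ∈-L-or-key : ∀ v → v ∈ keys M ⊎ v ∈ L
      ∈-L-or-key v with v ∈? L
      ... | yes v∈ = inj₂ v∈
      ... | no v∉ = inj₁ (∈-map⁺ proj₁ (image (not-L v∉)))
        where
        not-L : ∀ {v} → v ∉ L → kind v ≢ kL
        not-L {v} v∉ isL with kind v | isL | view v
        ... | .kL | refl | vL v∈ = v∉ v∈

      fills : ∀ {xs ys : List V} → Unique xs → Unique ys → (∀ {v} → v ∈ xs → v ∉ ys) → (∀ v → v ∈ xs ⊎ v ∈ ys) → length xs + length ys ≡ n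
      fills {xs} {ys} ux uy disj all-v = ≤-antisym
        (≤-trans (≤-reflexive (sym (length-++ xs))) (≤-trans (unique-⊆-length (++⁺ ux uy (λ (v∈ , v∈′) → disj v∈ v∈′)) (λ {v} _ → ∈-allFin v)) (≤-reflexive (length-allFin n))))
        (≤-trans (≤-reflexive (sym (length-allFin n))) (≤-trans (unique-⊆-length {ys = xs ++ ys} (allFin⁺ n) (λ {v} _ → [ ∈-++⁺ˡ , ∈-++⁺ʳ xs ]′ (all-v v))) (≤-reflexive (length-++ xs))))

    L≡R : length L ≡ length R
    L≡R = +-cancelˡ-≡ (length (keys M)) (length L) (length R) (≡-trans (fills unique-keys unique-L keys∌L ∈-L-or-key)
      (≡-trans (sym (fills unique-vals unique-R (λ v∈ v∈R → ∈-R v∈R v∈) val-or-R)) (cong (_+ length R) (≡-trans (length-map proj₂ M) (sym (length-map proj₁ M))))))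
      where
      val-or-R : ∀ v → v ∈ vals M ⊎ v ∈ R
      val-or-R v with v ∈? vals M
      ... | yes v∈ = inj₁ v∈
      ... | no v∉ = inj₂ (R-∈ v∉)

    module _ {N : Placement} (keys-N : keys N ↭ L) (vals-N : vals N ↭ R) (matched : ∀ {t v} → (t , v) ∈ N → H t v) where

      private
        Φ : V → V
        Φ = at (M ++ N)

      all-keys : Unique (keys (M ++ N))
      all-keys = subst Unique (sym (map-++ proj₁ M N)) (++⁺ unique-keys (Unique-resp-↭ (↭-sym keys-N) unique-L) (λ (v∈ , v∈′) → keys∌L v∈ (∈-resp-↭ keys-N v∈′)))
      all-vals : Unique (vals (M ++ N))
      all-vals = subst Unique (sym (map-++ proj₂ M N)) (++⁺ unique-vals (Unique-resp-↭ (↭-sym vals-N) unique-R) (λ (v∈ , v∈′) → ∈-R (∈-resp-↭ vals-N v∈′) v∈))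
      old : ∀ {v y} → (v , y) ∈ M → Φ v ≡ y
      old p∈ = at-placed all-keys (∈-++⁺ˡ p∈)
      new : ∀ {t} → t ∈ L → ∃[ r ] (t , r) ∈ N × Φ t ≡ r
      new t∈ with (_ , r) , p∈ , refl ← ∈-map⁻ proj₁ (∈-resp-↭ (↭-sym keys-N) t∈) = r , p∈ , at-placed all-keys (∈-++⁺ʳ M p∈)
      total-map : ∀ v → (v , Φ v) ∈ M ++ N
      total-map v with ∈-L-or-key v
      ... | inj₁ v∈ with (_ , y) , p∈ , refl ← ∈-map⁻ proj₁ v∈ = subst (λ y → (v , y) ∈ M ++ N) (sym (old p∈)) (∈-++⁺ˡ p∈)
      ... | inj₂ v∈ with r , p∈ , eq ← new v∈ = subst (λ y → (v , y) ∈ M ++ N) (sym eq) (∈-++⁺ʳ M p∈)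
      injective : Injective _≡_ _≡_ (Φ)
      injective {u} {v} eq = val-functional all-vals (total-map u) (subst (λ y → (v , y) ∈ M ++ N) (sym eq) (total-map v))
      via : ∀ {u v x y} → Φ u ≡ x → Φ v ≡ y → Joined C x y → Joined C (Φ u) (Φ v)
      via refl refl j = j
      along-leaf : ∀ {u v} → v ∈ L → par v ≡ just u → Joined C (Φ u) (Φ v)
      along-leaf {u} {v} v∈ eq with r , p∈ , at-v ← new v∈ =
        via (old (image (P≢L v∈ eq))) at-v (subst (λ x → Joined C x r) (parent-at-just eq) (proj₁ (matched p∈)))
      along-above : ∀ {u v} → u ∈ L → par v ≡ just u → Joined C (Φ u) (Φ v)
      along-above {u} {v} u∈ eq with r , p∈ , at-u ← new u∈ =
        via at-u (old (image (Q≢L u∈ eq))) (Joined-sym {u = at M v} (All-lookup (proj₂ (matched p∈)) (∈-children eq)))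
      along : ∀ {u v} → par v ≡ just u → Joined C (Φ u) (Φ v)
      along {u} {v} eq with ∈-L-or-key v | ∈-L-or-key u
      ... | inj₂ v∈ | _ = along-leaf v∈ eq
      ... | inj₁ _ | inj₂ u∈ = along-above u∈ eq
      ... | inj₁ v∈ | inj₁ u∈ with (_ , y) , vy∈ , refl ← ∈-map⁻ proj₁ v∈ | (_ , x) , ux∈ , refl ← ∈-map⁻ proj₁ u∈ =
        via (old ux∈) (old vy∈) (edges vy∈ (u , eq , ux∈))
      adjacent : ∀ u v → Adj T u v → ClientAdj C (Φ u) (Φ v)
      adjacent u v uv with edge-par uv
      ... | inj₁ eq = Joined⇒ClientAdj {C = C} {Φ u} {Φ v} (Joined-sym {u = Φ v} {Φ u} (along {v} {u} eq))
      ... | inj₂ eq = Joined⇒ClientAdj {C = C} {Φ u} {Φ v} (along {u} {v} eq)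


      copy-from : ContainsCopy C T
      copy-from = Φ , injective , adjacent

    copy : ContainsCopy C T
    copy = finish (perfect-matching _≟ᶠ_ _≟ᶠ_ H? unique-L unique-R a (m + m) degree-L degree-R linked L≡R)
      where
      finish : (∃[ N ] keys N ↭ L × vals N ↭ R × (∀ {t v} → (t , v) ∈ N → H t v)) → ContainsCopy C T
      finish (_ , keys-N , vals-N , matched) = copy-from keys-N vals-N matched

  contains-copy : ContainsCopy C T
  contains-copy = Finish.copy (proj₂ (embed ordered))

-- Layout of the vertex set

Unique-++⁻ : {A : Set} (xs : List A) {ys : List A} → Unique (xs ++ ys) → Unique xs × Unique ys × (∀ {x} → x ∈ xs → x ∉ ys)
Unique-++⁻ [] u = [] , u , λ ()
Unique-++⁻ (x ∷ xs) u with uxs , uys , disj ← Unique-++⁻ xs (Unique-tail u) =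
  Unique-cons (Unique-head u ∘ ∈-++⁺ˡ) uxs , uys , λ { (here refl) x∈ys → Unique-head u (∈-++⁺ʳ xs x∈ys) ; (there x∈) → disj x∈ }

split-at : {A : Set} (k : ℕ) (xs : List A) → k ≤ length xs → ∃[ as ] ∃[ bs ] xs ≡ as ++ bs × length as ≡ k
split-at k xs le = take k xs , drop k xs , sym (take++drop≡id k xs) , length-take-≤ k le

length-rest : {A : Set} {xs : List A} (as : List A) {bs : List A} {k r : ℕ} → xs ≡ as ++ bs → length as ≡ k → k + r ≤ length xs → r ≤ length bs
length-rest as {bs} {k} {r} refl refl le = +-cancelˡ-≤ (length as) r (length bs) (≤-trans le (≤-reflexive (length-++ as)))

zip-proj₁ : {A B : Set} (xs : List A) (ys : List B) → length xs ≡ length ys → map proj₁ (zip xs ys) ≡ xs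
zip-proj₁ [] [] _ = refl
zip-proj₁ (x ∷ xs) (y ∷ ys) eq = cong (x ∷_) (zip-proj₁ xs ys (suc-injective eq))

zip-proj₂ : {A B : Set} (xs : List A) (ys : List B) → length xs ≡ length ys → map proj₂ (zip xs ys) ≡ ys
zip-proj₂ [] [] _ = refl
zip-proj₂ (x ∷ xs) (y ∷ ys) eq = cong (y ∷_) (zip-proj₂ xs ys (suc-injective eq))

record Arrangement (n s w z k : ℕ) : Set where
  field
    Λ : Layout n
  open Layout Λ public
  field
    A′ B′ : List (Fin n)
    unique-A′ : Unique A′
    unique-B′ : Unique B′
    A′⊆A : ∀ {v} → v ∈ A′ → part v ≡ pA × v ∉ X × v ∉ Z
    B′⊆B : ∀ {v} → v ∈ B′ → part v ≡ pB × (∀ {x} → x ∈ X → v ≢ partner x)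
    length-S : length S ≡ s
    length-X : length X ≡ w
    length-Z : length Z ≡ z
    length-A′ : length A′ ≡ k
    length-B′ : k ≤ length B′
    total : n ≤ length S + (w + w) + length Z + (length A′ + length B′)

module _ {n : ℕ} (S X Y Z A′ B′ : List (Fin n)) (whole : allFin n ≡ S ++ X ++ Y ++ Z ++ A′ ++ B′) (X≡Y : length X ≡ length Y) where

  private
    open DecMem (_≟ᶠ_ {n}) using (_∈?_)

    u₀ = Unique-++⁻ S (subst Unique whole (allFin⁺ n))
    u₁ = Unique-++⁻ X (proj₁ (proj₂ u₀))
    u₂ = Unique-++⁻ Y (proj₁ (proj₂ u₁))
    u₃ = Unique-++⁻ Z (proj₁ (proj₂ u₂))
    u₄ = Unique-++⁻ A′ (proj₁ (proj₂ u₃))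

    S-apart : ∀ {v} → v ∈ S → v ∉ X ++ Y ++ Z ++ A′ ++ B′
    S-apart = proj₂ (proj₂ u₀)
    X-apart : ∀ {v} → v ∈ X → v ∉ Y ++ Z ++ A′ ++ B′
    X-apart = proj₂ (proj₂ u₁)
    Y-apart : ∀ {v} → v ∈ Y → v ∉ Z ++ A′ ++ B′
    Y-apart = proj₂ (proj₂ u₂)
    Z-apart : ∀ {v} → v ∈ Z → v ∉ A′ ++ B′
    Z-apart = proj₂ (proj₂ u₃)
    A′-apart : ∀ {v} → v ∈ A′ → v ∉ B′
    A′-apart = proj₂ (proj₂ u₄)

    part : Fin n → Part
    part v = if does (v ∈? S) then pS else if does (v ∈? Y ++ B′) then pB else pA

    part-S : ∀ {v} → v ∈ S → part v ≡ pS
    part-S {v} v∈ with v ∈? S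
    ... | yes _ = refl
    ... | no v∉ = contradiction v∈ v∉

    part-B : ∀ {v} → v ∉ S → v ∈ Y ++ B′ → part v ≡ pB
    part-B {v} v∉S v∈ with v ∈? S | v ∈? Y ++ B′
    ... | yes v∈S | _ = contradiction v∈S v∉S
    ... | no _ | yes _ = refl
    ... | no _ | no v∉ = contradiction v∈ v∉

    part-A : ∀ {v} → v ∉ S → v ∉ Y ++ B′ → part v ≡ pA
    part-A {v} v∉S v∉ with v ∈? S | v ∈? Y ++ B′
    ... | yes v∈S | _ = contradiction v∈S v∉S
    ... | no _ | yes v∈ = contradiction v∈ v∉
    ... | no _ | no _ = refl

    S-part : ∀ {v} → part v ≡ pS → v ∈ S
    S-part {v} eq with v ∈? S | v ∈? Y ++ B′
    ... | yes v∈ | _ = v∈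
    S-part () | no _ | yes _
    S-part () | no _ | no _

    in-Y : ∀ {v} → v ∈ Y → v ∈ X ++ Y ++ Z ++ A′ ++ B′
    in-Y v∈ = ∈-++⁺ʳ X (∈-++⁺ˡ v∈)
    in-Z : ∀ {v} → v ∈ Z → v ∈ Y ++ Z ++ A′ ++ B′
    in-Z v∈ = ∈-++⁺ʳ Y (∈-++⁺ˡ v∈)
    in-A′ : ∀ {v} → v ∈ A′ → v ∈ Z ++ A′ ++ B′
    in-A′ v∈ = ∈-++⁺ʳ Z (∈-++⁺ˡ v∈)
    in-B′ : ∀ {v} → v ∈ B′ → v ∈ Z ++ A′ ++ B′
    in-B′ v∈ = ∈-++⁺ʳ Z (∈-++⁺ʳ A′ v∈)

    XY : List (Fin n × Fin n)
    XY = zip X Y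

    unique-XY₁ : Unique (map proj₁ XY)
    unique-XY₁ = subst Unique (sym (zip-proj₁ X Y X≡Y)) (proj₁ u₁)

    unique-XY₂ : Unique (map proj₂ XY)
    unique-XY₂ = subst Unique (sym (zip-proj₂ X Y X≡Y)) (proj₁ u₂)

    partnered : ∀ {x} → x ∈ X → (x , at XY x) ∈ XY
    partnered x∈ with (_ , y) , p∈ , refl ← ∈-map⁻ proj₁ (subst (_ ∈_) (sym (zip-proj₁ X Y X≡Y)) x∈) =
      subst (λ y → (_ , y) ∈ XY) (sym (at-placed unique-XY₁ p∈)) p∈

    partner-Y : ∀ {x} → x ∈ X → at XY x ∈ Y
    partner-Y {x} x∈ = subst (at XY x ∈_) (zip-proj₂ X Y X≡Y) (∈-map⁺ proj₂ (partnered x∈))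

  layout : Layout n
  layout = record
    { part = part ; X = X ; Z = Z ; S = S ; partner = at XY
    ; unique-X = proj₁ u₁ ; unique-Z = proj₁ u₃ ; unique-S = proj₁ u₀
    ; X⊆A = λ x∈ → part-A (λ v∈S → S-apart v∈S (∈-++⁺ˡ x∈)) (λ v∈ → X-apart x∈ ([ ∈-++⁺ˡ , (λ v∈B → ∈-++⁺ʳ Y (in-B′ v∈B)) ]′ (∈-++⁻ Y v∈)))
    ; Z⊆A = λ z∈ → part-A (λ v∈S → S-apart v∈S (∈-++⁺ʳ X (in-Z z∈))) (λ v∈ → [ (λ v∈Y → Y-apart v∈Y (∈-++⁺ˡ z∈)) , (λ v∈B → Z-apart z∈ (∈-++⁺ʳ A′ v∈B)) ]′ (∈-++⁻ Y v∈))
    ; Z∉X = λ z∈ x∈ → X-apart x∈ (in-Z z∈)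
    ; S⊆S = part-S ; S-complete = S-part
    ; partner-B = λ x∈ → part-B (λ v∈S → S-apart v∈S (in-Y (partner-Y x∈))) (∈-++⁺ˡ (partner-Y x∈))
    ; partner-injective = λ x∈ y∈ eq → cong proj₁ (Unique-map-injective unique-XY₂ (partnered x∈) (partnered y∈) eq) }

  arrangement : ∀ {s w z k} → length S ≡ s → length X ≡ w → length Z ≡ z → length A′ ≡ k → k ≤ length B′ → Arrangement n s w z k
  arrangement {s} {w} {z} {k} lS lX lZ lA lB = record
    { Λ = layout ; A′ = A′ ; B′ = B′ ; unique-A′ = proj₁ u₄ ; unique-B′ = proj₁ (proj₂ u₄)
    ; A′⊆A = λ a∈ → part-A (λ v∈S → S-apart v∈S (∈-++⁺ʳ X (∈-++⁺ʳ Y (in-A′ a∈)))) (λ v∈ → [ (λ v∈Y → Y-apart v∈Y (in-A′ a∈)) , A′-apart a∈ ]′ (∈-++⁻ Y v∈))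
                  , (λ x∈ → X-apart x∈ (∈-++⁺ʳ Y (in-A′ a∈))) , (λ z∈ → Z-apart z∈ (∈-++⁺ˡ a∈))
    ; B′⊆B = λ b∈ → part-B (λ v∈S → S-apart v∈S (∈-++⁺ʳ X (∈-++⁺ʳ Y (in-B′ b∈)))) (∈-++⁺ʳ Y b∈)
                  , (λ { x∈ refl → Y-apart (partner-Y x∈) (in-B′ b∈) })
    ; length-S = lS ; length-X = lX ; length-Z = lZ ; length-A′ = lA ; length-B′ = lB
    ; total = ≤-reflexive (begin
        n ≡⟨ sym (length-allFin n) ⟩
        length (allFin n) ≡⟨ cong length whole ⟩
        length (S ++ X ++ Y ++ Z ++ A′ ++ B′) ≡⟨ length-++ S ⟩
        length S + length (X ++ Y ++ Z ++ A′ ++ B′) ≡⟨ cong (length S +_) (≡-trans (length-++ X) (cong (length X +_) (≡-trans (length-++ Y) (cong (length Y +_) (≡-trans (length-++ Z) (cong (length Z +_) (length-++ A′))))))) ⟩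
        length S + (length X + (length Y + (length Z + (length A′ + length B′)))) ≡⟨ cong₂ (λ x y → length S + (x + (y + (length Z + (length A′ + length B′))))) lX (≡-trans (sym X≡Y) lX) ⟩
        length S + (w + (w + (length Z + (length A′ + length B′)))) ≡⟨ solve 4 (λ s w z r → s :+ (w :+ (w :+ (z :+ r))) := s :+ (w :+ w) :+ z :+ r) refl (length S) w (length Z) (length A′ + length B′) ⟩
        length S + (w + w) + length Z + (length A′ + length B′) ∎) }
    where
    open ≡-Reasoning
    open +-*-Solver

arrange : ∀ {n} s w z k → s + (w + (w + (z + (k + k)))) ≤ n → Arrangement n s w z k
arrange {n} s w z k le
  with S , r₁ , eq₁ , lS ← split-at s (allFin n) (≤-trans (≤-trans (m≤m+n s _) le) (≤-reflexive (sym (length-allFin n))))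
  with le₁ ← length-rest S eq₁ lS (≤-trans le (≤-reflexive (sym (length-allFin n))))
  with X , r₂ , eq₂ , lX ← split-at w r₁ (≤-trans (m≤m+n w _) le₁)
  with le₂ ← length-rest X eq₂ lX le₁
  with Y , r₃ , eq₃ , lY ← split-at w r₂ (≤-trans (m≤m+n w _) le₂)
  with le₃ ← length-rest Y eq₃ lY le₂
  with Z , r₄ , eq₄ , lZ ← split-at z r₃ (≤-trans (m≤m+n z _) le₃)
  with le₄ ← length-rest Z eq₄ lZ le₃
  with A′ , B′ , eq₅ , lA ← split-at k r₄ (≤-trans (m≤m+n k _) le₄)
  = arrangement S X Y Z A′ B′
      (≡-trans eq₁ (cong (S ++_) (≡-trans eq₂ (cong (X ++_) (≡-trans eq₃ (cong (Y ++_) (≡-trans eq₄ (cong (Z ++_) eq₅))))))))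
      (≡-trans lX (sym lY)) lS lX lZ lA (length-rest A′ eq₅ lA le₄)

-- Choice of the parameters

binary-logarithm : ∀ n → 1 ≤ n → ∃[ k ] 2 ^ k ≤ n × n < 2 ^ suc k
binary-logarithm (suc zero) _ = 0 , s≤s z≤n , s≤s (s≤s z≤n)
binary-logarithm (suc n@(suc _)) _ with k , le , lt ← binary-logarithm n (s≤s z≤n) with suc n <? 2 ^ suc k
... | yes lt′ = k , m≤n⇒m≤1+n le , lt′
... | no nlt = suc k , ≮⇒≥ nlt , ≤-trans (s≤s lt) (2^suc<)
  where
  2^suc< : suc (2 ^ suc k) ≤ 2 ^ suc (suc k)
  2^suc< = ≤-trans (≤-reflexive (+-comm 1 (2 ^ suc k))) (+-monoʳ-≤ (2 ^ suc k) (≤-trans (2^>0 (suc k)) (m≤m+n _ 0)))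

2^-cancel-≤ : ∀ {a b} → 2 ^ a ≤ 2 ^ b → a ≤ b
2^-cancel-≤ {a} {b} le with a ≤? b
... | yes a≤b = a≤b
... | no a≰b = contradiction le (<⇒≱ (≤-trans (≤-trans (≤-reflexive (+-comm 1 (2 ^ b))) (+-monoʳ-≤ (2 ^ b) (≤-trans (2^>0 b) (m≤m+n _ 0)))) (^-monoʳ-≤ 2 (≰⇒> a≰b))))

module _ (t : ℕ) where

  const-bound : ∀ c → 1 ≤ t → c ≤ t * c
  const-bound c t>0 = ≤-trans (≤-reflexive (sym (*-identityˡ c))) (*-monoˡ-≤ c t>0)

  +-bound : ∀ {x y i j} → x ≤ t * i → y ≤ t * j → x + y ≤ t * (i + j)
  +-bound {i = i} {j} x≤ y≤ = ≤-trans (+-mono-≤ x≤ y≤) (≤-reflexive (sym (*-distribˡ-+ t i j)))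

  *-bound : ∀ c {x i} → x ≤ t * i → c * x ≤ t * (c * i)
  *-bound c {x} {i} x≤ = ≤-trans (*-monoʳ-≤ c x≤) (≤-reflexive (swap-* c t i))
    where
    swap-* : ∀ a b c → a * (b * c) ≡ b * (a * c)
    swap-* a b c = ≡-trans (sym (*-assoc a b c)) (≡-trans (cong (_* c) (*-comm a b)) (*-assoc b a c))

  scale-bound : ∀ D {x i} → x ≤ t * i → x * D ≤ (t * D) * i
  scale-bound D {x} {i} x≤ = ≤-trans (*-monoˡ-≤ D x≤) (≤-reflexive (≡-trans (*-assoc t i D) (≡-trans (cong (t *_) (*-comm i D)) (sym (*-assoc t D i)))))

-- The coefficients of ℓ and t = ℓ D below are crude; all that matters is that twelve times the one of λₗ is at most 2³⁵.
module Parameters (n ℓ D : ℕ) (n≤2^ℓ : n ≤ 2 ^ ℓ) (ℓ>0 : 1 ≤ ℓ) (D>0 : 1 ≤ D) (ample : (ℓ * D) * 34359738368 ≤ n) where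

  m w σ s e a ζ z λₗ k₁ k₂ c : ℕ
  m = ℓ * 1024
  w = suc (512 * (m + m))
  σ = 2 + w
  s = 8 * σ
  e = (m + m) + w + s
  a = (w + (m + m)) * D
  ζ = e * D + e * D + a
  z = suc (64 * ζ)
  λₗ = s + (w + w) + z + 6 * m
  k₁ = 4 + (ℓ * 2 + (ℓ * m) * 3)
  k₂ = 6 + ℓ * 4
  c = suc k₁

  t : ℕ
  t = ℓ * D

  ℓ≤t : ℓ ≤ t
  ℓ≤t = ≤-trans (≤-reflexive (sym (*-identityʳ ℓ))) (*-monoʳ-≤ ℓ D>0)

  t>0 : 1 ≤ t
  t>0 = ≤-trans ℓ>0 ℓ≤t

  m-bound : m ≤ ℓ * 1024
  m-bound = ≤-refl

  w-bound : w ≤ ℓ * 1048577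
  w-bound = +-bound ℓ {1} {512 * (m + m)} {1} {1048576} (const-bound ℓ 1 ℓ>0) (*-bound ℓ 512 {m + m} {2048} (+-bound ℓ {m} {m} {1024} {1024} m-bound m-bound))

  2m-bound : m + m ≤ ℓ * 2048
  2m-bound = +-bound ℓ {m} {m} {1024} {1024} m-bound m-bound

  s-bound : s ≤ ℓ * 8388632
  s-bound = *-bound ℓ 8 {σ} {1048579} (+-bound ℓ {2} {w} {2} {1048577} (const-bound ℓ 2 ℓ>0) w-bound)

  e-bound : e ≤ ℓ * 9439257
  e-bound = +-bound ℓ {m + m + w} {s} {1050625} {8388632} (+-bound ℓ {m + m} {w} {2048} {1048577} 2m-bound w-bound) s-bound

  ζ-bound : ζ ≤ t * 19929139
  ζ-bound = +-bound t {e * D + e * D} {a} {18878514} {1050625}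
    (+-bound t {e * D} {e * D} {9439257} {9439257} (scale-bound ℓ D {e} {9439257} e-bound) (scale-bound ℓ D {e} {9439257} e-bound))
    (scale-bound ℓ D {w + (m + m)} {1050625} (+-bound ℓ {w} {m + m} {1048577} {2048} w-bound 2m-bound))

  lift-bound : ∀ {x i} → x ≤ ℓ * i → x ≤ t * i
  lift-bound {i = i} x≤ = ≤-trans x≤ (*-monoˡ-≤ i ℓ≤t)

  λ-bound : λₗ ≤ t * 1285956827
  λ-bound = +-bound t {s + (w + w) + z} {6 * m} {1285950683} {6144}
    (+-bound t {s + (w + w)} {z} {10485786} {1275464897}
      (+-bound t {s} {w + w} {8388632} {2097154} (lift-bound s-bound) (+-bound t {w} {w} {1048577} {1048577} (lift-bound w-bound) (lift-bound w-bound)))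
      (+-bound t {1} {64 * ζ} {1} {1275464896} (const-bound t 1 t>0) (*-bound t 64 {ζ} {19929139} ζ-bound)))
    (*-bound t 6 {m} {1024} (lift-bound m-bound))

  12λ≤n : 12 * λₗ ≤ n
  12λ≤n = ≤-trans (*-bound t 12 {λₗ} {1285956827} λ-bound) (≤-trans (*-monoʳ-≤ t (≤ᵇ⇒≤ 15431481924 34359738368 tt)) ample)

  z≤λ : z ≤ λₗ
  z≤λ = ≤-trans (m≤n+m z (s + (w + w))) (m≤m+n (s + (w + w) + z) (6 * m))

  ζ≤λ : ζ ≤ λₗ
  ζ≤λ = ≤-trans (≤-trans (m≤m+n ζ (63 * ζ)) (n≤1+n (64 * ζ))) z≤λ

  D≤λ : D ≤ λₗ
  D≤λ = ≤-trans (≤-trans (m≤m+n D ((512 * (m + m) + (m + m)) * D)) (m≤n+m a (e * D + e * D))) ζ≤λ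

  wD<λ : w * D < λₗ
  wD<λ = ≤-trans (s≤s (≤-trans (*-monoˡ-≤ D (m≤m+n w (m + m))) (≤-trans (m≤n+m a (e * D + e * D)) (m≤m+n ζ (63 * ζ))))) z≤λ

  λ>0 : 1 ≤ λₗ
  λ>0 = ≤-trans D>0 D≤λ

  tree-room : 8 * λₗ + 2 * suc D ≤ n
  tree-room = begin
    8 * λₗ + 2 * suc D ≤⟨ +-monoʳ-≤ (8 * λₗ) (*-monoʳ-≤ 2 (+-mono-≤ λ>0 D≤λ)) ⟩
    8 * λₗ + 2 * (λₗ + λₗ) ≡⟨ solve 1 (λ x → con 8 :* x :+ con 2 :* (x :+ x) := con 12 :* x) refl λₗ ⟩
    12 * λₗ ≤⟨ 12λ≤n ⟩
    n ∎
    where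
    open ≤-Reasoning
    open +-*-Solver

  2m≤λ : m + m ≤ λₗ
  2m≤λ = ≤-trans (+-monoʳ-≤ m (m≤m+n m (4 * m))) (m≤n+m (6 * m) (s + (w + w) + z))

  layout-room : s + (w + (w + (z + ((λₗ + (m + m)) + (λₗ + (m + m)))))) ≤ n
  layout-room = begin
    s + (w + (w + (z + ((λₗ + (m + m)) + (λₗ + (m + m))))))
      ≡⟨ solve 5 (λ s w z l m → s :+ (w :+ (w :+ (z :+ ((l :+ (m :+ m)) :+ (l :+ (m :+ m)))))) := (s :+ (w :+ w) :+ z) :+ ((l :+ (m :+ m)) :+ (l :+ (m :+ m)))) refl s w z λₗ m ⟩
    (s + (w + w) + z) + ((λₗ + (m + m)) + (λₗ + (m + m)))
      ≤⟨ +-mono-≤ (m≤m+n (s + (w + w) + z) (6 * m)) (+-mono-≤ (+-monoʳ-≤ λₗ 2m≤λ) (+-monoʳ-≤ λₗ 2m≤λ)) ⟩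
    λₗ + ((λₗ + λₗ) + (λₗ + λₗ)) ≤⟨ m≤m+n (λₗ + ((λₗ + λₗ) + (λₗ + λₗ))) (7 * λₗ) ⟩
    λₗ + ((λₗ + λₗ) + (λₗ + λₗ)) + 7 * λₗ ≡⟨ solve 1 (λ x → x :+ ((x :+ x) :+ (x :+ x)) :+ con 7 :* x := con 12 :* x) refl λₗ ⟩
    12 * λₗ ≤⟨ 12λ≤n ⟩
    n ∎
    where
    open ≤-Reasoning
    open +-*-Solver

  m>0 : 1 ≤ m
  m>0 = *-mono-≤ ℓ>0 (s≤s (z≤n {1023}))

  private
    n² : n * n ≤ 2 ^ (ℓ * 2)
    n² = ≤-trans (*-mono-≤ n≤2^ℓ n≤2^ℓ) (≤-reflexive (≡-trans (sym (^-distribˡ-+-* 2 ℓ ℓ)) (cong (2 ^_) (solve 1 (λ l → l :+ l := l :* con 2) refl ℓ))))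
      where open +-*-Solver

    pairs-bound : 4 * suc (n * n) ≤ 2 ^ (3 + ℓ * 2)
    pairs-bound = ≤-trans (*-monoʳ-≤ 4 (+-mono-≤ (2^>0 (ℓ * 2)) n²)) (≤-reflexive (solve 1 (λ x → con 4 :* (x :+ x) := con 2 :* (con 2 :* (con 2 :* x))) refl (2 ^ (ℓ * 2))))
      where open +-*-Solver

    n^m : n ^ m ≤ 2 ^ (ℓ * m)
    n^m = ≤-trans (^-monoˡ-≤ m n≤2^ℓ) (≤-reflexive (^-*-assoc 2 ℓ m))

    n²^m : (n * n) ^ m ≤ 2 ^ ((ℓ * 2) * m)
    n²^m = ≤-trans (^-monoˡ-≤ m n²) (≤-reflexive (^-*-assoc 2 (ℓ * 2) m))

  few₁ : ((n * n) ^ m * n ^ m + n ^ m * n ^ m) * (4 * suc (n * n)) ≤ 2 ^ k₁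
  few₁ = begin
    ((n * n) ^ m * n ^ m + n ^ m * n ^ m) * (4 * suc (n * n)) ≤⟨ *-mono-≤ (+-mono-≤ (*-mono-≤ n²^m n^m) (*-mono-≤ n^m n^m)) pairs-bound ⟩
    (2 ^ ((ℓ * 2) * m) * 2 ^ (ℓ * m) + 2 ^ (ℓ * m) * 2 ^ (ℓ * m)) * 2 ^ (3 + ℓ * 2)
      ≡⟨ cong (_* 2 ^ (3 + ℓ * 2)) (cong₂ _+_ (sym (^-distribˡ-+-* 2 ((ℓ * 2) * m) (ℓ * m))) (sym (^-distribˡ-+-* 2 (ℓ * m) (ℓ * m)))) ⟩
    (2 ^ ((ℓ * 2) * m + ℓ * m) + 2 ^ (ℓ * m + ℓ * m)) * 2 ^ (3 + ℓ * 2)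
      ≤⟨ *-monoˡ-≤ (2 ^ (3 + ℓ * 2)) (+-mono-≤ (≤-reflexive (cong (2 ^_) (solve 2 (λ l m → l :* con 2 :* m :+ l :* m := l :* m :* con 3) refl ℓ m)))
          (^-monoʳ-≤ 2 (≤-trans (m≤m+n (ℓ * m + ℓ * m) (ℓ * m)) (≤-reflexive (solve 1 (λ x → x :+ x :+ x := x :* con 3) refl (ℓ * m)))))) ⟩
    (2 ^ (ℓ * m * 3) + 2 ^ (ℓ * m * 3)) * 2 ^ (3 + ℓ * 2) ≡⟨ cong (_* 2 ^ (3 + ℓ * 2)) (cong (2 ^ (ℓ * m * 3) +_) (sym (+-identityʳ (2 ^ (ℓ * m * 3))))) ⟩
    2 ^ suc (ℓ * m * 3) * 2 ^ (3 + ℓ * 2) ≡⟨ sym (^-distribˡ-+-* 2 (suc (ℓ * m * 3)) (3 + ℓ * 2)) ⟩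
    2 ^ (suc (ℓ * m * 3) + (3 + ℓ * 2)) ≡⟨ cong (2 ^_) (solve 2 (λ x y → con 1 :+ x :+ (con 3 :+ y) := con 4 :+ (y :+ x)) refl (ℓ * m * 3) (ℓ * 2)) ⟩
    2 ^ k₁ ∎
    where
    open ≤-Reasoning
    open +-*-Solver

  few₂ : (4 * n + n * n) * (4 * suc (n * n)) ≤ 2 ^ k₂
  few₂ = begin
    (4 * n + n * n) * (4 * suc (n * n)) ≤⟨ *-mono-≤ (+-mono-≤ (*-monoʳ-≤ 4 (≤-trans n≤2^ℓ (^-monoʳ-≤ 2 (≤-trans (m≤m+n ℓ ℓ) (≤-reflexive (solve 1 (λ l → l :+ l := l :* con 2) refl ℓ)))))) n²) pairs-bound ⟩
    (4 * 2 ^ (ℓ * 2) + 2 ^ (ℓ * 2)) * 2 ^ (3 + ℓ * 2) ≤⟨ *-monoˡ-≤ (2 ^ (3 + ℓ * 2)) (≤-trans (m≤m+n (4 * 2 ^ (ℓ * 2) + 2 ^ (ℓ * 2)) (3 * 2 ^ (ℓ * 2)))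
        (≤-reflexive (solve 1 (λ x → con 4 :* x :+ x :+ con 3 :* x := con 2 :* (con 2 :* (con 2 :* x))) refl (2 ^ (ℓ * 2))))) ⟩
    2 ^ (3 + ℓ * 2) * 2 ^ (3 + ℓ * 2) ≡⟨ sym (^-distribˡ-+-* 2 (3 + ℓ * 2) (3 + ℓ * 2)) ⟩
    2 ^ ((3 + ℓ * 2) + (3 + ℓ * 2)) ≡⟨ cong (2 ^_) (solve 1 (λ l → (con 3 :+ l :* con 2) :+ (con 3 :+ l :* con 2) := con 6 :+ l :* con 4) refl ℓ) ⟩
    2 ^ k₂ ∎
    where
    open ≤-Reasoning
    open +-*-Solver

  large-c : suc k₁ ≤ 2 * c
  large-c = m≤m+n c (c + 0)

  m-c : 64 * c ≤ m * m
  m-c = ≤-trans (*-bound u 64 {c} {10} (+-bound u {5} {ℓ * 2 + u * 3} {5} {5} (const-bound u 5 u>0) (+-bound u {ℓ * 2} {u * 3} {2} {3} (*-monoˡ-≤ 2 ℓ≤u) ≤-refl)))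
    (≤-trans (*-monoʳ-≤ u (≤ᵇ⇒≤ 640 1024 tt)) (≤-reflexive (≡-trans (*-assoc ℓ m 1024) (≡-trans (cong (ℓ *_) (*-comm m 1024)) (sym (*-assoc ℓ 1024 m))))))
    where
    u = ℓ * m
    ℓ≤u : ℓ ≤ u
    ℓ≤u = ≤-trans (≤-reflexive (sym (*-identityʳ ℓ))) (*-monoʳ-≤ ℓ m>0)
    u>0 : 1 ≤ u
    u>0 = ≤-trans ℓ>0 ℓ≤u

  k₂<m : suc k₂ ≤ m
  k₂<m = ≤-trans (+-bound ℓ {7} {ℓ * 4} {7} {4} (const-bound ℓ 7 ℓ>0) ≤-refl) (*-monoʳ-≤ ℓ (≤ᵇ⇒≤ 11 1024 tt))

  large : ∀ {x} → m ≤ x → suc k₂ ≤ 2 * x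
  large {x} m≤ = ≤-trans k₂<m (≤-trans m≤ (m≤m+n x (x + 0)))

  m≤w : m ≤ w
  m≤w = ≤-trans (≤-trans (m≤m+n m m) (m≤m+n (m + m) (511 * (m + m)))) (n≤1+n (512 * (m + m)))

  m≤ζ : m ≤ ζ
  m≤ζ = ≤-trans (≤-trans (≤-trans m≤w (m≤m+n w (m + m))) (≤-trans (≤-reflexive (sym (*-identityʳ (w + (m + m))))) (*-monoʳ-≤ (w + (m + m)) D>0))) (m≤n+m a (e * D + e * D))

  Arranged : Set
  Arranged = Arrangement n s w z (λₗ + (m + m))

  arranged : Arranged
  arranged = arrange s w z (λₗ + (m + m)) layout-room

  module _ (arr : Arranged) where
    open Arrangement arr

    waiter-forces : Forces (λ _ → Pseudorandom.Good Λ m ζ σ (m + m)) (allEdges n) []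
    waiter-forces = Stages.Waiter-forces-good (record
      { Λ = Λ ; m = m ; c = c ; k₁ = k₁ ; k₂ = k₂ ; ζ = ζ ; σ = σ ; h = m + m ; few₁ = few₁ ; few₂ = few₂
      ; large-c = large-c ; large-h = large (m≤m+n m m) ; large-ζ = large m≤ζ ; large-σ = large (≤-trans m≤w (m≤n+m w 2)) ; m-c = m-c
      ; X-h = ≤-reflexive (sym length-X) ; Z-ζ = ≤-reflexive (sym length-Z) ; S-σ = ≤-reflexive (sym length-S) })

    universal : ∀ {C} → Pseudorandom.Good Λ m ζ σ (m + m) C → ∀ (T : Graph n) → IsTree T → (∀ v → degree T v ≤ D) → ContainsCopy C T
    universal {C} good T is-tree deg≤ = from-leaves (Tree.distinct-parents tree w wD<λ)
      where
      tree : RootedTree T D λₗ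
      tree = rooted-tree T is-tree (≤-trans λ>0 (≤-trans (m≤m+n λₗ (11 * λₗ)) 12λ≤n)) deg≤ tree-room
      from-leaves : (∃[ ts ] length ts ≡ suc w × (∀ {t} → t ∈ ts → t ∈ RootedTree.L tree) × Unique (map (RootedTree.par tree) ts)) → ContainsCopy C T
      from-leaves (ts , len , sub , u) = Embedding.contains-copy (record
        { Λ = Λ ; m = m ; ζ = ζ ; σ = σ ; w = w ; D = D ; λₗ = λₗ ; C = C ; good = good ; T = T ; tree = tree ; A′ = A′ ; B′ = B′ ; L⋆ = ts
        ; unique-A′ = unique-A′ ; unique-B′ = unique-B′ ; A′⊆A = A′⊆A ; B′⊆B = B′⊆B ; total = total ; X-w = length-X
        ; A-size = ≤-reflexive (sym length-A′) ; B-size = length-B′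
        ; L-size = ≤-reflexive (cong₂ (λ x y → x + (w + w) + y + 6 * m) length-S length-Z)
        ; σ-size = ≤-refl ; length-L⋆ = len ; L⋆⊆L = sub ; unique-par-L⋆ = u ; m>0 = m>0 ; D>0 = D>0
        ; ζ-size = ≤-reflexive (cong (λ x → ((m + m) + w + x) * D + ((m + m) + w + x) * D + a) length-S) })

ContainsCopy-mono : ∀ {n} {C : List (Edge n)} {e T} → ContainsCopy C T → ContainsCopy (e ∷ C) T
ContainsCopy-mono (φ , inj , adj) = φ , inj , λ u v uv → [ inj₁ ∘ there , inj₂ ∘ there ]′ (adj u v uv)

log-small : ∀ K b → suc b * K ≤ 2 ^ b → ∀ j → suc (j + b) * K ≤ 2 ^ (j + b)
log-small K b base zero = base
log-small K b base (suc j) = begin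
  K + suc (j + b) * K ≤⟨ +-monoˡ-≤ (suc (j + b) * K) (m≤m+n K ((j + b) * K)) ⟩
  suc (j + b) * K + suc (j + b) * K ≤⟨ +-mono-≤ (log-small K b base j) (≤-trans (log-small K b base j) (m≤m+n _ 0)) ⟩
  2 ^ suc (j + b) ∎
  where open ≤-Reasoning

module Strategy (n K b : ℕ) (K>0 : 1 ≤ K) (K-value : 34359738368 ≤ K) (base : suc b * K ≤ 2 ^ b) (b>0 : 1 ≤ b) (large-n : 2 ^ b ≤ n) where

  module _ (k : ℕ) (2^k≤n : 2 ^ k ≤ n) (n<2^ℓ : n < 2 ^ suc k) where

    private
      ℓ = suc k

      k≥b : b ≤ k
      k≥b with b ≤? k
      ... | yes le = le
      ... | no nle = contradiction (^-monoʳ-≤ 2 (≰⇒> nle)) (<⇒≱ (≤-<-trans large-n n<2^ℓ))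

      ℓK≤n : ℓ * K ≤ n
      ℓK≤n = ≤-trans (subst (λ k → suc k * K ≤ 2 ^ k) (m∸n+n≡m k≥b) (log-small K b base (k ∸ b))) 2^k≤n

      instance
        ℓK-nonZero : NonZero (ℓ * K)
        ℓK-nonZero = >-nonZero (*-mono-≤ (s≤s (z≤n {k})) K>0)

      D = n / (ℓ * K)

      D>0 : 1 ≤ D
      D>0 = m≥n⇒m/n>0 ℓK≤n

      ample : (ℓ * D) * 34359738368 ≤ n
      ample = ≤-trans (*-monoʳ-≤ (ℓ * D) K-value) (≤-trans (≤-reflexive (≡-trans (cong (_* K) (*-comm ℓ D)) (*-assoc D ℓ K))) (m/n*n≤m n (ℓ * K)))

      degree-bound : ∀ d → n ^ (d * (K + K)) ≤ 2 ^ (1 * n) → d ≤ D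
      degree-bound d le = ≤-trans (≤-reflexive (sym (m*n/n≡m d (ℓ * K)))) (/-monoˡ-≤ (ℓ * K) (begin
        d * (ℓ * K) ≤⟨ *-monoʳ-≤ d (*-monoˡ-≤ K (+-monoˡ-≤ k (≤-trans b>0 k≥b))) ⟩
        d * ((k + k) * K) ≡⟨ solve 3 (λ d k x → d :* ((k :+ k) :* x) := k :* (d :* (x :+ x))) refl d k K ⟩
        k * (d * (K + K)) ≤⟨ 2^-cancel-≤ (≤-trans (≤-reflexive (sym (^-*-assoc 2 k (d * (K + K))))) (≤-trans (^-monoˡ-≤ (d * (K + K)) 2^k≤n) le)) ⟩
        1 * n ≡⟨ *-identityˡ n ⟩
        n ∎))
        where
        open ≤-Reasoning
        open +-*-Solver

      open Parameters n ℓ D (<⇒≤ n<2^ℓ) (s≤s z≤n) D>0 ample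

    waiter-wins : WaiterWins (λ C → ∀ (T : Graph n) → IsTree T → (∀ v → n ^ (degree T v * (K + K)) ≤ 2 ^ (1 * n)) → ContainsCopy C T) (allEdges n) []
    waiter-wins = Forces⇒WaiterWins (λ copies T is-tree deg≤ → ContainsCopy-mono {T = T} (copies T is-tree deg≤))
      (Forces-bind (waiter-forces arranged) λ good → stop λ T is-tree deg≤ → universal arranged good T is-tree (λ v → degree-bound (degree T v) (deg≤ v)))

  strategy : WaiterWins (λ C → ∀ (T : Graph n) → IsTree T → (∀ v → n ^ (degree T v * (K + K)) ≤ 2 ^ (1 * n)) → ContainsCopy C T) (allEdges n) []
  strategy with k , 2^k≤n , n<2^ℓ ← binary-logarithm n (≤-trans (2^>0 b) large-n) = waiter-wins k 2^k≤n n<2^ℓ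

theorem1p2 : Σ ℕ λ p → Σ ℕ λ q → 0 < p × 0 < q × Σ ℕ λ N → ∀ n → N ≤ n →
    WaiterWins (λ C → ∀ (T : Graph n) → IsTree T →
    (∀ v → n ^ (degree T v * q) ≤ 2 ^ (p * n)) → ContainsCopy C T)
    (allEdges n) []
theorem1p2 = 1 , 34359738368 + 34359738368 , s≤s z≤n , s≤s z≤n , 2 ^ 45 ,
  λ n → Strategy.strategy n 34359738368 45 (s≤s z≤n) ≤-refl (≤ᵇ⇒≤ (46 * 34359738368) (2 ^ 45) tt) (s≤s z≤n)
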